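{- For every composition $\alpha\models n$, $$\boldsymbol{h}_\alpha=\sum_{W\in\mathcal{IW}_\alpha}\frac{1}{\mathrm{fb}(W)}\frac{\boldsymbol{\phi}_{\mathrm{type}(W)}}{z_{\mathrm{type}(W)}},\qquad \boldsymbol{e}_\alpha=\sum_{W\in\mathcal{IW}_\alpha}\frac{(-1)^{|\mathrm{sh}(W)|-\ell(\mathrm{type}(W))}}{\mathrm{fb}(W)}\frac{\boldsymbol{\phi}_{\mathrm{type}(W)}}{z_{\mathrm{type}(W)}},$$ $$\phi_\alpha=\sum_{W\in\mathcal{IW}^\alpha}\frac{1}{\mathrm{fb}(W)}M_{\mathrm{sh}(W)},\qquad \phi_\alpha=\sum_{W\in\mathcal{IW}^\alpha}\frac{(-1)^{|\mathrm{sh}(W)|-\ell(\mathrm{type}(W))}}{\mathrm{fb}(W)}\mathrm{For}_{\mathrm{sh}(W)}.$$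
   Context: For a composition $\alpha=(\alpha_1,\dots,\alpha_\ell)\models n$: $|\alpha|=n$, $\ell(\alpha)=\ell$, $\mathrm{set}(\alpha)=\{\alpha_1,\dots,\alpha_1+\cdots+\alpha_{\ell-1}\}$, $\alpha^c$ the composition with $\mathrm{set}(\alpha^c)=[n-1]\setminus\mathrm{set}(\alpha)$; $\beta\preceq\alpha$ iff $\mathrm{set}(\beta)\supseteq\mathrm{set}(\alpha)$, in which case $\beta$ splits into consecutive blocks $\beta^{(1)},\dots,\beta^{(\ell(\alpha))}$ with $|\beta^{(i)}|=\alpha_i$. $m_i(\alpha)$ = number of parts equal to $i$, and $z_\alpha=\prod_i i^{m_i(\alpha)}m_i(\alpha)!$. Walls: for $\beta\preceq\alpha$, the $\alpha\beta$-wall is the diagram with rows of lengths $\alpha_1,\alpha_2,\dots$ (bottom to top), row $i$ filled left to right by bricks (horizontal strips) of lengths given by $\beta^{(i)}$; it has shape $\mathrm{sh}(W)=\alpha$, type $\mathrm{type}(W)=\beta$. An indexed $\alpha\beta$-wall is a bijective labelling of its bricks by $1,\dots,\ell(\beta)$ with labels increasing with brick size (equal-size bricks labelled in any order). $\mathcal{IW}_\alpha$ is the set of all indexed walls of shape $\alpha$, $\mathcal{IW}^\beta$ the set of all indexed walls of type $\beta$. For such $W$, $\mathrm{fb}(W)=\prod_{i=1}^{\ell(\alpha)}\ell(\beta^{(i)})!$. Noncommutative side ($\boldsymbol{x}_i$ noncommuting): $\boldsymbol{r}_\alpha=\sum\boldsymbol{x}_{i_1}\cdots\boldsymbol{x}_{i_n}$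 over $I\in(\mathbb{Z}^+)^n$ with $\{j:i_j>i_{j+1}\}=\mathrm{set}(\alpha)$; $\boldsymbol{e}_n=\sum_{i_1>\cdots>i_n\ge1}\boldsymbol{x}_{i_1}\cdots\boldsymbol{x}_{i_n}$, $\boldsymbol{h}_n=\sum_{1\le i_1\le\cdots\le i_n}\boldsymbol{x}_{i_1}\cdots\boldsymbol{x}_{i_n}$, $\boldsymbol{\phi}_n=\sum_{\gamma\models n}\frac{(-1)^{\ell(\gamma)-1}}{\binom{n-1}{\ell(\gamma)-1}}\boldsymbol{r}_\gamma$, all extended multiplicatively over parts. Quasisymmetric side (commuting $x_i$): $M_\alpha=\sum_{i_1<\cdots<i_\ell}x_{i_1}^{\alpha_1}\cdots x_{i_\ell}^{\alpha_\ell}$, $F_\alpha=\sum x_{i_1}\cdots x_{i_n}$ over $i_1\le\cdots\le i_n$ with $i_k<i_{k+1}$ for $k\in\mathrm{set}(\alpha)$; $\psi$ is the linear map on QSym with $\psi(F_\alpha)=F_{\alpha^c}$, and $\mathrm{For}_\alpha=\psi(M_\alpha)$. The bilinear pairing $\langle\cdot,\cdot\rangle:\mathrm{QSym}\times\mathbf{NSym}\to\mathbb{C}$ is defined by $\langle F_\alpha,\boldsymbol{r}_\beta\rangle=\mathbbm{1}_{\alpha=\beta}$, and $\{\phi_\alpha\}$ is the basis of QSym determined by $\langle\phi_\alpha,\boldsymbol{\phi}_\beta\rangle=z_\alpha\mathbbm{1}_{\alpha=\beta}$. -}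

module Defs where

open import Level using (Level; _⊔_) renaming (suc to lsuc)
open import Algebra.Bundles using (CommutativeRing)
open import Algebra.Morphism.Structures using (module RingMorphisms)
open import Data.Fin.Base using (Fin)
import Data.Fin.Base as Fin
import Data.Fin.Properties as Fin
import Data.Integer.Base as ℤ
open import Data.List.Base using (List; []; _∷_; _++_; map; concatMap; filter; foldr; length; lookup; replicate; applyUpTo; allFin; [_])
open import Data.List.Properties using (≡-dec; map-∘; map-cong; map-id)
open import Data.List.Membership.DecPropositional using () renaming (_∈?_ to mem?)
open import Data.List.NonEmpty.Base using (List⁺; toList; foldr₁) renaming ([_] to [_]⁺; length to length⁺; _∷⁺_ to cons⁺)
open import Data.List.Relation.Unary.All using (All; all?; []; _∷_)
import Data.List.Relation.Unary.All.Properties as All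
open import Data.List.Relation.Unary.Linked using (Linked; linked?; [-]; _∷_)
import Data.List.Relation.Unary.Linked.Properties as Linked
open import Data.Nat.Base using (ℕ; zero; suc; _+_; _*_; _∸_; _^_; _≤_; _<_; _>_; _!; z≤n; s≤s)
open import Data.Nat.Combinatorics using (_C_)
open import Data.Nat.ListAction using (sum; product)
import Data.Nat.Properties as ℕ
open import Data.Product.Base using (_×_; _,_; ∃; map₁)
open import Data.Rational.Base using (ℚ; 0ℚ; 1ℚ; +-*-rawRing)
import Data.Rational.Base as ℚ
open import Data.Vec.Base using (Vec) renaming ([] to []ᵛ; _∷_ to _∷ᵛ_; lookup to lookupᵛ)
open import Function.Base using (_on_)
open import Relation.Binary.Core using (Rel)
open import Relation.Binary.Definitions using (Decidable; DecidableEquality)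
open import Relation.Binary.PropositionalEquality using (_≡_; refl; sym; trans; cong; cong₂; module ≡-Reasoning)
open import Relation.Nullary.Decidable using (Dec; yes; no; does; ¬?; map′; _×-dec_; _→-dec_; dec-true; dec-false)
open import Relation.Nullary.Negation using (¬_; contradiction)
open import Data.Bool.Base using (if_then_else_)

-- Positive integers; 1+ k stands for k + 1.
record ℕ⁺ : Set where
  constructor 1+_
  field pred : ℕ

  value : ℕ
  value = suc pred

open ℕ⁺ public using (value)

_≟⁺_ : DecidableEquality ℕ⁺
(1+ m) ≟⁺ (1+ n) = map′ (cong 1+_) (cong ℕ⁺.pred) (m ℕ.≟ n)

_+⁺_ : ℕ⁺ → ℕ⁺ → ℕ⁺
(1+ m) +⁺ (1+ n) = 1+ (m + suc n)

_<⁺_ _≤⁺_ _>⁺_ : Rel ℕ⁺ _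
_<⁺_ = _<_ on value
_≤⁺_ = _≤_ on value
_>⁺_ = _>_ on value

_<⁺?_ : Decidable _<⁺_
i <⁺? j = value i ℕ.<? value j

_≤⁺?_ : Decidable _≤⁺_
i ≤⁺? j = value i ℕ.≤? value j

_>⁺?_ : Decidable _>⁺_
i >⁺? j = value j ℕ.<? value i

Composition : Set
Composition = List ℕ⁺

_≟ᶜ_ : DecidableEquality Composition
_≟ᶜ_ = ≡-dec _≟⁺_

size : Composition → ℕ
size α = sum (map value α)

-- Finite sets of positive integers are represented by increasing lists.
set : Composition → List ℕ
set []          = []
set (_ ∷ [])    = []
set (a ∷ b ∷ α) = value a ∷ map (λ k → value a + k) (set (b ∷ α))

-- Every composition of n + 1 arises exactly once from a composition of n, by
-- prepending a part 1 or by enlarging the first part.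
compositions : ℕ → List Composition
compositions zero    = [ [] ]
compositions (suc n) = concatMap grow (compositions n)
  where
  grow : Composition → List Composition
  grow []            = [ [ 1+ 0 ] ]
  grow ((1+ k) ∷ α)  = (1+ 0 ∷ 1+ k ∷ α) ∷ (1+ (suc k) ∷ α) ∷ []

complementSet : Composition → List ℕ
complementSet α = filter (λ k → ¬? (mem? ℕ._≟_ k (set α))) (applyUpTo suc (size α ∸ 1))

differences : ℕ → List ℕ → ℕ → Composition
differences p []       n = [ 1+ (n ∸ suc p) ]
differences p (k ∷ ks) n = 1+ (k ∸ suc p) ∷ differences k ks n

-- The composition of n whose set is the given increasing list in [n-1].
fromSet : ℕ → List ℕ → Composition
fromSet zero    _  = []
fromSet (suc n) ks = differences 0 ks (suc n)

_ᶜ : Composition → Composition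
α ᶜ = fromSet (size α) (complementSet α)

set-ᶜ : ∀ α → set (α ᶜ) ≡ complementSet α
set-ᶜ []      = refl
set-ᶜ α@(a ∷ β) = trans (sym (map-id _)) (set-differences 0 (complementSet α) sorted)
  where
  set-∷-differences : ∀ d k ks {n} → set (d ∷ differences k ks n) ≡ value d ∷ map (λ j → value d + j) (set (differences k ks n))
  set-∷-differences d k []      = refl
  set-∷-differences d k (_ ∷ _) = refl

  set-differences : ∀ p ks {n} → Linked _<_ (p ∷ ks) → map (λ j → p + j) (set (differences p ks n)) ≡ ks
  set-differences p []           _         = refl
  set-differences p (k ∷ ks) {n} (p<k ∷ l) = begin
    map (p +_) (set (d ∷ differences k ks n))
      ≡⟨ cong (map (p +_)) (set-∷-differences d k ks) ⟩
    p + value d ∷ map (p +_) (map (value d +_) (set (differences k ks n)))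
      ≡⟨ cong₂ _∷_ p+d≡k (sym (map-∘ (set (differences k ks n)))) ⟩
    k ∷ map (λ j → p + (value d + j)) (set (differences k ks n))
      ≡⟨ cong (k ∷_) (map-cong (λ j → trans (sym (ℕ.+-assoc p (value d) j)) (cong (_+ j) p+d≡k)) (set (differences k ks n))) ⟩
    k ∷ map (k +_) (set (differences k ks n))
      ≡⟨ cong (k ∷_) (set-differences k ks l) ⟩
    k ∷ ks ∎
    where
    open ≡-Reasoning
    d = 1+ (k ∸ suc p)
    p+d≡k : p + value d ≡ k
    p+d≡k = trans (ℕ.+-suc p (k ∸ suc p)) (ℕ.m+[n∸m]≡n p<k)

  cons : ∀ {p ks} → All (p <_) ks → Linked _<_ ks → Linked _<_ (p ∷ ks)
  cons []        _ = [-]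
  cons (p<k ∷ _) l = p<k ∷ l

  sorted : Linked _<_ (0 ∷ complementSet α)
  sorted = cons
    (All.filter⁺ _ (All.applyUpTo⁺₂ suc (size α ∸ 1) (λ _ → s≤s z≤n)))
    (Linked.filter⁺ _ ℕ.<-trans (Linked.applyUpTo⁺₂ suc (size α ∸ 1) (λ _ → ℕ.≤-refl)))

multiplicity : ℕ → Composition → ℕ
multiplicity i α = length (filter (λ a → value a ℕ.≟ i) α)

-- Parts larger than |α| have multiplicity 0 and contribute the factor 1.
z : Composition → ℕ
z α = product (map (λ i → i ^ multiplicity i α * multiplicity i α !) (applyUpTo suc (size α)))

-- A wall is the list of its rows from bottom to top, a row the list of its
-- brick lengths from left to right. For β ⪯ α, the αβ-wall is the unique wall
-- with shape α and type β.
Row Wall : Set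
Row  = List⁺ ℕ⁺
Wall = List Row

sh : Wall → Composition
sh = map (foldr₁ _+⁺_)

type : Wall → Composition
type = concatMap toList

fb : Wall → ℕ
fb W = product (map (λ row → length⁺ row !) W)

-- All walls of a given type, i.e. all ways to cut a list of bricks into
-- consecutive nonempty rows.
wallsOfType : Composition → List Wall
wallsOfType []      = [ [] ]
wallsOfType (b ∷ β) = concatMap place (wallsOfType β)
  where
  place : Wall → List Wall
  place []         = [ [ [ b ]⁺ ] ]
  place (row ∷ W)  = ([ b ]⁺ ∷ row ∷ W) ∷ (cons⁺ b row ∷ W) ∷ []

-- Bricks are numbered in the order in which they occur in the type; the label
-- k ∈ {1,…,ℓ(β)} is represented by the element k - 1 of Fin ℓ(β).
Labels : Composition → Set
Labels β = Vec (Fin (length β)) (length β)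

IsIndexing : (β : Composition) → Labels β → Set
IsIndexing β σ =
    (∀ i j → lookupᵛ σ i ≡ lookupᵛ σ j → i ≡ j)
  × (∀ k → ∃ λ i → lookupᵛ σ i ≡ k)
  × (∀ i j → lookup β i <⁺ lookup β j → lookupᵛ σ i Fin.< lookupᵛ σ j)

isIndexing? : (β : Composition) (σ : Labels β) → Dec (IsIndexing β σ)
isIndexing? β σ =
        Fin.all? (λ i → Fin.all? λ j → (lookupᵛ σ i Fin.≟ lookupᵛ σ j) →-dec (i Fin.≟ j))
  ×-dec Fin.all? (λ k → Fin.any? λ i → lookupᵛ σ i Fin.≟ k)
  ×-dec Fin.all? (λ i → Fin.all? λ j → (lookup β i <⁺? lookup β j) →-dec (lookupᵛ σ i Fin.<? lookupᵛ σ j))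

allVectors : ∀ m n → List (Vec (Fin m) n)
allVectors m zero    = [ []ᵛ ]
allVectors m (suc n) = concatMap (λ i → map (i ∷ᵛ_) (allVectors m n)) (allFin m)

indexings : (β : Composition) → List (Labels β)
indexings β = filter (isIndexing? β) (allVectors (length β) (length β))

record LabelledWall : Set where
  constructor _,_
  field
    wall   : Wall
    labels : Labels (type wall)

open LabelledWall public

-- All indexed walls with n cells.
indexedWalls : ℕ → List LabelledWall
indexedWalls n =
  concatMap (λ W → map (λ σ → W , σ) (indexings (type W)))
            (concatMap wallsOfType (compositions n))

IW-sh : Composition → List LabelledWall
IW-sh α = filter (λ W → sh (wall W) ≟ᶜ α) (indexedWalls (size α))

IW-type : Composition → List LabelledWall
IW-type β = filter (λ W → type (wall W) ≟ᶜ β) (indexedWalls (size β))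

-- 1 / n, with the convention 1 / 0 = 0; only used for n > 0.
1/_ : ℕ → ℚ
1/ zero    = 0ℚ
1/ (suc n) = ℤ.+ 1 ℚ./ suc n

sign : ℕ → ℚ
sign zero    = 1ℚ
sign (suc n) = ℚ.- sign n

-- A noncommutative monomial x_{i₁}⋯x_{iₙ} is the word i₁…iₙ.
Word : Set
Word = List ℕ⁺

_≟ʷ_ : DecidableEquality Word
_≟ʷ_ = ≡-dec _≟⁺_

-- {j : i_j ∼ i_{j+1}}
positions : ∀ {r} {_∼_ : Rel ℕ⁺ r} → Decidable _∼_ → Word → List ℕ
positions _∼?_ []          = []
positions _∼?_ (_ ∷ [])    = []
positions _∼?_ (i ∷ j ∷ w) =
  (if does (i ∼? j) then [ 1 ] else []) ++ map suc (positions _∼?_ (j ∷ w))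

descents ascents : Word → List ℕ
descents = positions _>⁺?_
ascents  = positions _<⁺?_

splits : Word → List (Word × Word)
splits []      = [ [] , [] ]
splits (i ∷ w) = ([] , i ∷ w) ∷ map (map₁ (i ∷_)) (splits w)

-- A commutative monomial x₁^{a₁}⋯x_k^{a_k} is the list a₁,…,a_k of exponents;
-- lists differing by trailing zeros denote the same monomial.
Exponents : Set
Exponents = List ℕ

nonzero : Exponents → Composition
nonzero []          = []
nonzero (zero ∷ a)  = nonzero a
nonzero (suc e ∷ a) = 1+ e ∷ nonzero a

wordFrom : ℕ⁺ → Exponents → Word
wordFrom i      []      = []
wordFrom (1+ i) (e ∷ a) = replicate e (1+ i) ++ wordFrom (1+ suc i) a

-- The unique i₁ ≤ … ≤ iₙ with x_{i₁}⋯x_{iₙ} equal to the given monomial.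
sortedWord : Exponents → Word
sortedWord = wordFrom (1+ 0)

degree : Exponents → ℕ
degree = sum

degree-nonzero : ∀ a → degree a ≡ size (nonzero a)
degree-nonzero []          = refl
degree-nonzero (zero ∷ a)  = degree-nonzero a
degree-nonzero (suc e ∷ a) = cong (suc e +_) (degree-nonzero a)

ascents-sortedWord : ∀ a → ascents (sortedWord a) ≡ set (nonzero a)
ascents-sortedWord = go (1+ 0)
  where
  data Above (i : ℕ⁺) : Word → Set where
    none : Above i []
    some : ∀ {j w} → i <⁺ j → Above i (j ∷ w)

  weaken : ∀ {i w} → Above (1+ suc i) w → Above (1+ i) w
  weaken none     = none
  weaken (some p) = some (ℕ.<-trans ℕ.≤-refl p)

  above : ∀ i a → Above (1+ i) (wordFrom (1+ suc i) a)
  above i []          = none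
  above i (zero ∷ a)  = weaken (above (suc i) a)
  above i (suc e ∷ a) = some ℕ.≤-refl

  step : ℕ → List ℕ → Word → List ℕ
  step e ks []      = []
  step e ks (_ ∷ _) = suc e ∷ map (suc e +_) ks

  map-suc : ∀ e ks w → map suc (step e ks w) ≡ step (suc e) ks w
  map-suc e ks []      = refl
  map-suc e ks (_ ∷ _) = cong (suc (suc e) ∷_) (sym (map-∘ ks))

  run : ∀ i e {w} → Above i w → ascents (replicate (suc e) i ++ w) ≡ step e (ascents w) w
  run i zero    none = refl
  run i zero {j ∷ w} (some p) =
    cong (λ b → (if b then [ 1 ] else []) ++ map suc (ascents (j ∷ w))) (dec-true (i <⁺? j) p)
  run i (suc e) {w} p = begin
    ascents (i ∷ i ∷ replicate e i ++ w)
      ≡⟨ cong (λ b → (if b then [ 1 ] else []) ++ map suc (ascents (i ∷ replicate e i ++ w)))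
              (dec-false (i <⁺? i) (ℕ.<-irrefl refl)) ⟩
    map suc (ascents (i ∷ replicate e i ++ w))  ≡⟨ cong (map suc) (run i e p) ⟩
    map suc (step e (ascents w) w)              ≡⟨ map-suc e (ascents w) w ⟩
    step (suc e) (ascents w) w                  ∎
    where open ≡-Reasoning

  finish : ∀ e i a → step e (set (nonzero a)) (wordFrom i a) ≡ set (1+ e ∷ nonzero a)
  finish e i []          = refl
  finish e i (zero ∷ a)  = finish e (1+ suc (ℕ⁺.pred i)) a
  finish e i (suc _ ∷ a) = refl

  go : ∀ i a → ascents (wordFrom i a) ≡ set (nonzero a)
  go i      []          = refl
  go (1+ i) (zero ∷ a)  = go (1+ suc i) a
  go (1+ i) (suc e ∷ a) = begin
    ascents (replicate (suc e) (1+ i) ++ w)   ≡⟨ run (1+ i) e (above i a) ⟩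
    step e (ascents w) w                      ≡⟨ cong (λ ks → step e ks w) (go (1+ suc i) a) ⟩
    step e (set (nonzero a)) w                ≡⟨ finish e (1+ suc i) a ⟩
    set (1+ e ∷ nonzero a)                    ∎
    where
    open ≡-Reasoning
    w = wordFrom (1+ suc i) a

-- The coefficient ring: any commutative ring receiving a homomorphism from ℚ,
-- in particular ℂ.
record ℚ-Algebra (c ℓ : Level) : Set (lsuc (c ⊔ ℓ)) where
  field
    commutativeRing : CommutativeRing c ℓ
  open CommutativeRing commutativeRing public using (Carrier; rawRing)
  field
    ι      : ℚ → Carrier
    ι-homo : RingMorphisms.IsRingHomomorphism +-*-rawRing rawRing ι

module Over {c ℓ : Level} {{K : ℚ-Algebra c ℓ}} where

  open ℚ-Algebra K using (commutativeRing)
  open ℚ-Algebra K public using (ι)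
  open CommutativeRing commutativeRing
    using (Carrier; _≈_; 0#; 1#; +-cong; *-cong; +-identityˡ; zeroʳ)
    renaming (_+_ to _+ᴷ_; _*_ to _*ᴷ_; refl to ≈-refl; trans to ≈-trans; reflexive to ≈-reflexive)

  𝟙 : ∀ {p} {P : Set p} → Dec P → Carrier
  𝟙 P? = if does P? then 1# else 0#

  -- Formal power series over the monomials X.
  Series : Set → Set c
  Series X = X → Carrier

  infix 4 _≋_
  infixl 6 _⊕_
  infixr 7 _•_

  _≋_ : ∀ {X} → Series X → Series X → Set ℓ
  f ≋ g = ∀ x → f x ≈ g x

  _⊕_ : ∀ {X} → Series X → Series X → Series X
  (f ⊕ g) x = f x +ᴷ g x

  _•_ : ∀ {X} → Carrier → Series X → Series X
  (k • f) x = k *ᴷ f x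

  𝟎 : ∀ {X} → Series X
  𝟎 _ = 0#

  ∑ : ∀ {X A : Set} → List A → (A → Series X) → Series X
  ∑ as f = foldr (λ a s → f a ⊕ s) 𝟎 as

  infixl 7 _⊛_

  _⊛_ : Series Word → Series Word → Series Word
  (f ⊛ g) w = foldr (λ { (u , v) s → f u *ᴷ g v +ᴷ s }) 0# (splits w)

  one : Series Word
  one w = 𝟙 (w ≟ʷ [])

  multiplicatively : (ℕ⁺ → Series Word) → Composition → Series Word
  multiplicatively f α = foldr (λ a s → f a ⊛ s) one α

  𝐫 : Composition → Series Word
  𝐫 α w = 𝟙 ((length w ℕ.≟ size α) ×-dec ≡-dec ℕ._≟_ (descents w) (set α))

  𝐡₁ 𝐞₁ 𝛟₁ : ℕ⁺ → Series Word
  𝐡₁ n w = 𝟙 ((length w ℕ.≟ value n) ×-dec linked? _≤⁺?_ w)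
  𝐞₁ n w = 𝟙 ((length w ℕ.≟ value n) ×-dec linked? _>⁺?_ w)
  𝛟₁ n = ∑ (compositions (value n)) λ γ →
    ι (sign (length γ ∸ 1) ℚ.* 1/ ((value n ∸ 1) C (length γ ∸ 1))) • 𝐫 γ

  𝐡 𝐞 𝛟 : Composition → Series Word
  𝐡 = multiplicatively 𝐡₁
  𝐞 = multiplicatively 𝐞₁
  𝛟 = multiplicatively 𝛟₁

  -- NSym is the subalgebra generated by the ribbon series (which in fact span it).
  data IsNSym : Series Word → Set (c ⊔ ℓ) where
    ribbon : ∀ α → IsNSym (𝐫 α)
    unit   : IsNSym one
    zero   : IsNSym 𝟎
    plus   : ∀ {f g} → IsNSym f → IsNSym g → IsNSym (f ⊕ g)
    scale  : ∀ k {f} → IsNSym f → IsNSym (k • f)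
    times  : ∀ {f g} → IsNSym f → IsNSym g → IsNSym (f ⊛ g)
    resp   : ∀ {f g} → f ≋ g → IsNSym f → IsNSym g

  record NSym : Set (c ⊔ ℓ) where
    constructor mkNSym
    field
      series : Series Word
      isNSym : IsNSym series

  _≈ᴺ_ : Rel NSym ℓ
  f ≈ᴺ g = NSym.series f ≋ NSym.series g

  _+ᴺ_ : NSym → NSym → NSym
  mkNSym f p +ᴺ mkNSym g q = mkNSym (f ⊕ g) (plus p q)

  _·ᴺ_ : Carrier → NSym → NSym
  k ·ᴺ mkNSym f p = mkNSym (k • f) (scale k p)

  𝐫ᴺ : Composition → NSym
  𝐫ᴺ α = mkNSym (𝐫 α) (ribbon α)

  𝛟ᴺ : Composition → NSym
  𝛟ᴺ α = mkNSym (𝛟 α) (product-isNSym α)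
    where
    sum-isNSym : ∀ {A : Set} (as : List A) {f : A → Series Word} → (∀ a → IsNSym (f a)) → IsNSym (∑ as f)
    sum-isNSym []       p = zero
    sum-isNSym (a ∷ as) p = plus (p a) (sum-isNSym as p)

    product-isNSym : ∀ α → IsNSym (𝛟 α)
    product-isNSym []      = unit
    product-isNSym (a ∷ α) = times (sum-isNSym (compositions (value a)) λ γ → scale _ (ribbon γ)) (product-isNSym α)

  -- Power series of bounded degree in which the coefficients of
  -- x_{i₁}^{α₁}⋯x_{i_ℓ}^{α_ℓ} and x_{j₁}^{α₁}⋯x_{j_ℓ}^{α_ℓ} agree whenever
  -- i₁ < … < i_ℓ and j₁ < … < j_ℓ.
  record QSym : Set (c ⊔ ℓ) where
    field
      series         : Series Exponents
      bound          : ℕ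
      bounded        : ∀ a → bound < degree a → series a ≈ 0#
      quasisymmetric : ∀ a b → nonzero a ≡ nonzero b → series a ≈ series b

  _≈ᵠ_ : Rel QSym ℓ
  f ≈ᵠ g = QSym.series f ≋ QSym.series g

  _+ᵠ_ : QSym → QSym → QSym
  f +ᵠ g = record
    { series         = f.series ⊕ g.series
    ; bound          = f.bound + g.bound
    ; bounded        = λ a p → ≈-trans
        (+-cong (f.bounded a (ℕ.≤-<-trans (ℕ.m≤m+n f.bound g.bound) p))
                (g.bounded a (ℕ.≤-<-trans (ℕ.m≤n+m g.bound f.bound) p)))
        (+-identityˡ 0#)
    ; quasisymmetric = λ a b p → +-cong (f.quasisymmetric a b p) (g.quasisymmetric a b p)
    }
    where
    module f = QSym f
    module g = QSym g

  _·ᵠ_ : Carrier → QSym → QSym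
  k ·ᵠ f = record
    { series         = k • f.series
    ; bound          = f.bound
    ; bounded        = λ a p → ≈-trans (*-cong ≈-refl (f.bounded a p)) (zeroʳ k)
    ; quasisymmetric = λ a b p → *-cong ≈-refl (f.quasisymmetric a b p)
    }
    where module f = QSym f

  M : Composition → Series Exponents
  M α a = 𝟙 (nonzero a ≟ᶜ α)

  F : Composition → Series Exponents
  F α a = 𝟙 ((degree a ℕ.≟ size α) ×-dec all? (λ k → mem? ℕ._≟_ k (ascents (sortedWord a))) (set α))

  private
    𝟙-no : ∀ {p} {P : Set p} (P? : Dec P) → ¬ P → 𝟙 P? ≈ 0#
    𝟙-no (yes p) ¬p = contradiction p ¬p
    𝟙-no (no _)  _  = ≈-refl

  Mᵠ : Composition → QSym
  Mᵠ α = record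
    { series         = M α
    ; bound          = size α
    ; bounded        = λ a p → 𝟙-no (nonzero a ≟ᶜ α) λ eq →
        ℕ.<-irrefl (sym (trans (degree-nonzero a) (cong size eq))) p
    ; quasisymmetric = λ a b p → ≈-reflexive (cong (λ β → 𝟙 (β ≟ᶜ α)) p)
    }

  Fᵠ : Composition → QSym
  Fᵠ α = record
    { series         = F α
    ; bound          = size α
    ; bounded        = λ a p → 𝟙-no ((degree a ℕ.≟ size α) ×-dec all? _ (set α)) λ { (eq , _) → ℕ.<-irrefl (sym eq) p }
    ; quasisymmetric = λ a b p → ≈-reflexive (cong₂
        (λ d ks → 𝟙 ((d ℕ.≟ size α) ×-dec all? (λ k → mem? ℕ._≟_ k ks) (set α)))
        (trans (degree-nonzero a) (trans (cong size p) (sym (degree-nonzero b))))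
        (trans (ascents-sortedWord a) (trans (cong set p) (sym (ascents-sortedWord b)))))
    }

  -- The linear map ψ; the fields determine it because the F_α span QSym.
  record Psi : Set (c ⊔ ℓ) where
    field
      ψ      : QSym → QSym
      ψ-cong : ∀ {f g} → f ≈ᵠ g → ψ f ≈ᵠ ψ g
      ψ-+    : ∀ f g → ψ (f +ᵠ g) ≈ᵠ (ψ f +ᵠ ψ g)
      ψ-·    : ∀ k f → ψ (k ·ᵠ f) ≈ᵠ (k ·ᵠ ψ f)
      ψ-F    : ∀ α → ψ (Fᵠ α) ≈ᵠ Fᵠ (α ᶜ)

    For : Composition → Series Exponents
    For α = QSym.series (ψ (Mᵠ α))

  -- The bilinear pairing; the fields determine it because the F_α span QSym
  -- and the 𝐫_β span NSym.
  record Pairing : Set (c ⊔ ℓ) where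
    field
      ⟨_,_⟩  : QSym → NSym → Carrier
      ⟨⟩-cong : ∀ {f f′ g g′} → f ≈ᵠ f′ → g ≈ᴺ g′ → ⟨ f , g ⟩ ≈ ⟨ f′ , g′ ⟩
      ⟨⟩-+ˡ   : ∀ f f′ g → ⟨ f +ᵠ f′ , g ⟩ ≈ ⟨ f , g ⟩ +ᴷ ⟨ f′ , g ⟩
      ⟨⟩-·ˡ   : ∀ k f g → ⟨ k ·ᵠ f , g ⟩ ≈ k *ᴷ ⟨ f , g ⟩
      ⟨⟩-+ʳ   : ∀ f g g′ → ⟨ f , g +ᴺ g′ ⟩ ≈ ⟨ f , g ⟩ +ᴷ ⟨ f , g′ ⟩
      ⟨⟩-·ʳ   : ∀ k f g → ⟨ f , k ·ᴺ g ⟩ ≈ k *ᴷ ⟨ f , g ⟩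
      ⟨F,𝐫⟩   : ∀ α β → ⟨ Fᵠ α , 𝐫ᴺ β ⟩ ≈ 𝟙 (α ≟ᶜ β)

  -- The family {φ_α} in QSym determined by duality with {𝛟_β}.
  record DualBasis (P : Pairing) : Set (c ⊔ ℓ) where
    open Pairing P
    field
      φᵠ    : Composition → QSym
      ⟨φ,𝛟⟩ : ∀ α β → ⟨ φᵠ α , 𝛟ᴺ β ⟩ ≈ ι (ℤ.+ z α ℚ./ 1) *ᴷ 𝟙 (α ≟ᶜ β)

    φ : Composition → Series Exponents
    φ α = QSym.series (φᵠ α)

  -- (-1)^{|sh(W)| - ℓ(type(W))}; the exponent is never negative.
  wallSign : LabelledWall → ℚ
  wallSign W = sign (size (sh (wall W)) ∸ length (type (wall W)))

open Over {{...}} public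

{-# OPTIONS --safe #-}

-- Both 𝐡 (s = false) and 𝐞 (s = true) reduce to a single row: at a word with
-- descent pattern p, the claim is that the sum over all ways of cutting p into k
-- pieces of (1/k!) Π c(piece) is 1 if p is constantly s, and 0 otherwise. Here
-- c(p) = (-1)^d B(d+1, a+1) for d descents and a non-descents (up to the sign
-- (-1)^(d+a) for 𝐞) is the coefficient of 𝛟_n/n. The recurrence
-- B(d+1, a+2) + B(d+2, a+1) = B(d+1, a+1) passes to the cut sums and reduces them
-- to constant patterns, where they are the coefficients of
-- exp(-log(1-x)) = 1/(1-x). Summing over the Π m_i! labellings of a wall turns
-- 1/z into the product of the 1/β_j.
-- On the dual side, f = Σ_β ⟨f, 𝐡_β⟩ M_β and ψ f = Σ_β ⟨f, 𝐞_β⟩ M_β because both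
-- hold for the F_α, which span QSym; apply these to φ_α and use ψ² = 1.

module Submission where

open import Defs
open import Level using (Level; _⊔_)
open import Algebra.Bundles using (CommutativeRing)
open import Algebra.Morphism.Structures using (module RingMorphisms)
import Algebra.Solver.Ring.NaturalCoefficients.Default as SemiringSolver
open import Data.Bool.Base using (Bool; true; false; not; if_then_else_)
import Data.Bool.Properties as Bool
open import Data.Empty using (⊥-elim)
open import Data.Fin.Base as Fin using (Fin; zero; suc; toℕ; punchIn; punchOut)
import Data.Fin.Properties as Fin
import Data.Integer.Base as ℤ
import Data.Integer.Properties as ℤ
open import Data.List.Base using (List; []; _∷_; _++_; _∷ʳ_; [_]; map; concatMap; filter; foldr; length; lookup; replicate; applyUpTo; upTo; allFin)
open import Data.List.Membership.DecPropositional using () renaming (_∈?_ to mem?)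
open import Data.List.Membership.Propositional using (_∈_; _∉_; find; lose)
open import Data.List.Membership.Propositional.Properties using (∈-map⁺; ∈-map⁻; ∈-filter⁺; ∈-filter⁻; ∈-concatMap⁺; ∈-concatMap⁻; ∈-allFin; ∈-upTo⁺; ∈-upTo⁻)
open import Data.List.Membership.Propositional.Properties.WithK using (unique∧set⇒bag)
open import Data.List.NonEmpty.Base using (toList; foldr₁) renaming (_∷_ to _∷⁺_; [_] to [_]⁺; length to length⁺)
open import Data.List.Properties using (≡-dec; ∷-injective; ∷-injectiveˡ; ∷-injectiveʳ; ++-identityʳ; map-++; map-∘; map-cong; map-id; map-injective; map-applyUpTo; map-tabulate; tabulate-lookup; length-++; length-map; length-replicate; filter-++; filter-accept; filter-reject; applyUpTo-∷ʳ)
open import Data.List.Relation.Binary.BagAndSetEquality using (∼bag⇒↭)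
open import Data.List.Relation.Binary.Permutation.Propositional as ↭ using (_↭_)
open import Data.List.Relation.Binary.Permutation.Propositional.Properties using (↭-length; filter-↭)
open import Data.List.Relation.Unary.All as All using (All; all?; []; _∷_)
open import Data.List.Relation.Unary.AllPairs using ([]; _∷_)
open import Data.List.Relation.Unary.Any using (here; there)
open import Data.List.Relation.Unary.Linked using (linked?; _∷_)
open import Data.List.Relation.Unary.Unique.Propositional using (Unique)
import Data.List.Relation.Unary.Unique.Propositional.Properties as Unique
open import Data.Nat.Base using (ℕ; zero; suc; _+_; _∸_; _^_; _!; _≤_; _<_; z≤n; s≤s; NonZero; ≢-nonZero; ≢-nonZero⁻¹)
import Data.Nat.Base as ℕ
open import Data.Nat.Combinatorics using (_C_; nCk≡n!/k![n-k]!; k![n∸k]!∣n!; nCn≡1; nCk≡nC[n∸k])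
open import Data.Nat.DivMod using (m/n*n≡m)
open import Data.Nat.ListAction using (sum; product)
open import Data.Nat.ListAction.Properties using (sum-++; product-++)
import Data.Nat.Properties as ℕ
import Data.Nat.Solver as ℕ
open import Data.Product.Base using (_×_; _,_; ∃; proj₁; proj₂; map₁)
open import Data.Rational.Base using (ℚ; 1ℚ; _*_)
import Data.Rational.Base as ℚ
import Data.Rational.Properties as ℚ
import Data.Rational.Solver as ℚ
import Data.Rational.Unnormalised.Base as ℚᵘ
import Data.Rational.Unnormalised.Properties as ℚᵘ
open import Data.Sum.Base using (_⊎_; inj₁; inj₂; [_,_]′)
open import Data.Vec.Base as Vec using (Vec) renaming ([] to []ᵛ; _∷_ to _∷ᵛ_; lookup to lookupᵛ)
import Data.Vec.Properties as Vec
open import Function.Base using (_∘_; _$_)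
open import Function.Bundles using (mk⇔)
open import Relation.Binary.Core using (Rel)
import Relation.Binary.Definitions as Binary
open import Relation.Binary.PropositionalEquality using (_≡_; _≢_; refl; sym; trans; cong; cong₂; subst; module ≡-Reasoning)
open import Relation.Nullary.Decidable using (Dec; yes; no; does; ¬?; _×-dec_; dec-true; dec-false)
open import Relation.Nullary.Negation using (¬_; contradiction)
open import Relation.Unary using (Pred; Decidable)

-- The coefficient of a word in a product of series sees the descents inside the segment of each
-- factor, but not the comparison of the two letters at a boundary between factors. This forgotten
-- comparison is the letter that a cut swallows. The Beta integrals come from 𝛟: with d descents and
-- a non-descents, n = d + a + 1, the number 1/(n binom(n-1,d)) is the integral of t^d (1-t)^a over
-- [0,1], and the recurrence is t + (1-t) = 1 under the integral sign. It exchanges a letter at any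
-- position of a pattern, at the price of a pattern with that letter deleted; this freedom of
-- position is what makes it compatible with cutting. On the dual side the pairing is given on F
-- against 𝐫 and on φ against 𝛟. The bridge is that each 𝐡_β and each 𝐞_β has two expansions, one in
-- ribbons and one in the 𝛟, and `⟨⟩-cong` allows either to be used: the first to identify
-- coefficients of a quasisymmetric function, the second to evaluate them on φ_α.

-- Duplicate-free lists as finite sets.

unique-sets-↭ : ∀ {A : Set} {xs ys : List A} → Unique xs → Unique ys →
                (∀ {x} → x ∈ xs → x ∈ ys) → (∀ {x} → x ∈ ys → x ∈ xs) → xs ↭ ys
unique-sets-↭ u v f g = ∼bag⇒↭ (unique∧set⇒bag u v (mk⇔ f g))

∈-concatMap-intro : ∀ {A B : Set} (f : A → List B) {xs x y} → x ∈ xs → y ∈ f x → y ∈ concatMap f xs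
∈-concatMap-intro f x∈ y∈ = ∈-concatMap⁺ f (lose x∈ y∈)

∈-concatMap-elim : ∀ {A B : Set} (f : A → List B) {xs y} → y ∈ concatMap f xs → ∃ λ x → x ∈ xs × y ∈ f x
∈-concatMap-elim f {xs} y∈ = find (∈-concatMap⁻ f {xs} y∈)

-- A left inverse "parent" keeps the pieces of the concatenation disjoint.
concatMap-unique : ∀ {A B : Set} (f : A → List B) (parent : B → A) →
                   (∀ x {y} → y ∈ f x → parent y ≡ x) → (∀ x → Unique (f x)) →
                   ∀ {xs} → Unique xs → Unique (concatMap f xs)
concatMap-unique f parent inv uf []       = []
concatMap-unique f parent inv uf (_∷_ {x} {xs} x∉ u) =
  Unique.++⁺ (uf x) (concatMap-unique f parent inv uf u) λ (y∈ , y∈′) →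
    let (x′ , x′∈ , y∈x′) = ∈-concatMap-elim f {xs} y∈′
    in All.lookup x∉ x′∈ (trans (sym (inv x y∈)) (inv x′ y∈x′))

-- Indicators and finite sums in the coefficient ring.

module Sums {c ℓ : Level} {{K : ℚ-Algebra c ℓ}} where

  open ℚ-Algebra K public using (commutativeRing; ι-homo)
  open CommutativeRing commutativeRing public
    renaming (_+_ to _+ᴷ_; _*_ to _*ᴷ_; -_ to -ᴷ_; refl to ≈-refl; sym to ≈-sym; trans to ≈-trans; reflexive to ≈-reflexive)
    hiding (rawRing; zero)
  open import Relation.Binary.Reasoning.Setoid setoid public
  module Solver = SemiringSolver commutativeSemiring

  open RingMorphisms.IsRingHomomorphism ι-homo public
    using () renaming (+-homo to ι-+; *-homo to ι-*; 1#-homo to ι-1; 0#-homo to ι-0)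

  𝟙-yes : ∀ {p} {P : Set p} (P? : Dec P) → P → 𝟙 P? ≈ 1#
  𝟙-yes (yes _) _ = ≈-refl
  𝟙-yes (no ¬p) p = contradiction p ¬p

  𝟙-no : ∀ {p} {P : Set p} (P? : Dec P) → ¬ P → 𝟙 P? ≈ 0#
  𝟙-no (yes p) ¬p = contradiction p ¬p
  𝟙-no (no _)  _  = ≈-refl

  𝟙-cong : ∀ {p q} {P : Set p} {Q : Set q} (P? : Dec P) (Q? : Dec Q) → (P → Q) → (Q → P) → 𝟙 P? ≈ 𝟙 Q?
  𝟙-cong (yes p) Q? f g = ≈-sym (𝟙-yes Q? (f p))
  𝟙-cong (no ¬p) Q? f g = ≈-sym (𝟙-no Q? (¬p ∘ g))

  𝟙-× : ∀ {p q} {P : Set p} {Q : Set q} (P? : Dec P) (Q? : Dec Q) → 𝟙 (P? ×-dec Q?) ≈ 𝟙 P? *ᴷ 𝟙 Q?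
  𝟙-× (yes _) (yes _) = ≈-sym (*-identityˡ _)
  𝟙-× (yes _) (no _)  = ≈-sym (*-identityˡ _)
  𝟙-× (no _)  _       = ≈-sym (zeroˡ _)

  𝟙-guard : ∀ {p} {P : Set p} (P? : Dec P) {x y} → (P → x ≈ y) → 𝟙 P? *ᴷ x ≈ 𝟙 P? *ᴷ y
  𝟙-guard (yes p) e = *-congˡ (e p)
  𝟙-guard (no _)  e = ≈-trans (zeroˡ _) (≈-sym (zeroˡ _))

  S : ∀ {A : Set} → List A → (A → Carrier) → Carrier
  S as f = foldr (λ a s → f a +ᴷ s) 0# as

  ∑-S : ∀ {X A : Set} (as : List A) (f : A → Series X) x → ∑ as f x ≈ S as (λ a → f a x)
  ∑-S []       f x = ≈-refl
  ∑-S (a ∷ as) f x = +-congˡ (∑-S as f x)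

  module _ {A : Set} where

    S-cong∈ : ∀ (as : List A) {f g} → (∀ {a} → a ∈ as → f a ≈ g a) → S as f ≈ S as g
    S-cong∈ []       e = ≈-refl
    S-cong∈ (a ∷ as) e = +-cong (e (here refl)) (S-cong∈ as (e ∘ there))

    S-cong : ∀ (as : List A) {f g} → (∀ a → f a ≈ g a) → S as f ≈ S as g
    S-cong as e = S-cong∈ as (λ {a} _ → e a)

    S-zero∈ : ∀ (as : List A) {f} → (∀ {a} → a ∈ as → f a ≈ 0#) → S as f ≈ 0#
    S-zero∈ []       e = ≈-refl
    S-zero∈ (a ∷ as) e = ≈-trans (+-cong (e (here refl)) (S-zero∈ as (e ∘ there))) (+-identityˡ 0#)

    S-zero : ∀ (as : List A) {f} → (∀ a → f a ≈ 0#) → S as f ≈ 0#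
    S-zero as e = S-zero∈ as (λ {a} _ → e a)

    S-++ : ∀ (as bs : List A) f → S (as ++ bs) f ≈ S as f +ᴷ S bs f
    S-++ []       bs f = ≈-sym (+-identityˡ _)
    S-++ (a ∷ as) bs f = ≈-trans (+-congˡ (S-++ as bs f)) (≈-sym (+-assoc _ _ _))

    S-+ : ∀ (as : List A) f g → S as (λ a → f a +ᴷ g a) ≈ S as f +ᴷ S as g
    S-+ []       f g = ≈-sym (+-identityˡ 0#)
    S-+ (a ∷ as) f g = ≈-trans (+-congˡ (S-+ as f g))
      (solve 4 (λ x y s t → (x :+ y) :+ (s :+ t) := (x :+ s) :+ (y :+ t)) ≈-refl (f a) (g a) (S as f) (S as g))
      where open Solver

    S-*ˡ : ∀ k (as : List A) f → k *ᴷ S as f ≈ S as (λ a → k *ᴷ f a)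
    S-*ˡ k []       f = zeroʳ k
    S-*ˡ k (a ∷ as) f = ≈-trans (distribˡ k _ _) (+-congˡ (S-*ˡ k as f))

    S-filter : ∀ {p} {P : Pred A p} (P? : Decidable P) (as : List A) f →
               S (filter P? as) f ≈ S as (λ a → 𝟙 (P? a) *ᴷ f a)
    S-filter P? []       f = ≈-refl
    S-filter P? (a ∷ as) f with P? a
    ... | yes _ = +-cong (≈-sym (*-identityˡ _)) (S-filter P? as f)
    ... | no _  = ≈-trans (S-filter P? as f)
                    (≈-trans (≈-sym (+-identityˡ _)) (+-congʳ (≈-sym (zeroˡ _))))

    S-↭ : ∀ {as bs : List A} f → as ↭ bs → S as f ≈ S bs f
    S-↭ f ↭.refl          = ≈-refl
    S-↭ f (↭.prep a p)    = +-congˡ (S-↭ f p)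
    S-↭ {bs = _ ∷ _ ∷ bs} f (↭.swap a b p) = ≈-trans (+-congˡ (+-congˡ (S-↭ f p)))
      (solve 3 (λ x y s → x :+ (y :+ s) := y :+ (x :+ s)) ≈-refl (f a) (f b) (S bs f))
      where open Solver
    S-↭ f (↭.trans p q)   = ≈-trans (S-↭ f p) (S-↭ f q)

    S-delta : (_≟_ : Binary.DecidableEquality A) {as : List A} → Unique as → ∀ {x} → x ∈ as → (f : A → Carrier) →
              S as (λ a → f a *ᴷ 𝟙 (x ≟ a)) ≈ f x
    S-delta _≟_ {a ∷ as} (a∉ ∷ u) {x} (here refl) f = begin
      f x *ᴷ 𝟙 (x ≟ x) +ᴷ S as (λ b → f b *ᴷ 𝟙 (x ≟ b))
        ≈⟨ +-cong (≈-trans (*-congˡ (𝟙-yes (x ≟ x) refl)) (*-identityʳ _))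
                  (S-zero∈ as (λ {b} b∈ → ≈-trans (*-congˡ (𝟙-no (x ≟ b) (All.lookup a∉ b∈))) (zeroʳ _))) ⟩
      f x +ᴷ 0#  ≈⟨ +-identityʳ _ ⟩
      f x        ∎
    S-delta _≟_ {a ∷ as} (a∉ ∷ u) {x} (there x∈) f = begin
      f a *ᴷ 𝟙 (x ≟ a) +ᴷ S as (λ b → f b *ᴷ 𝟙 (x ≟ b))
        ≈⟨ +-cong (≈-trans (*-congˡ (𝟙-no (x ≟ a) (λ { refl → All.lookup a∉ x∈ refl }))) (zeroʳ _))
                  (S-delta _≟_ u x∈ f) ⟩
      0# +ᴷ f x  ≈⟨ +-identityˡ _ ⟩
      f x        ∎

  S-map : ∀ {A B : Set} (h : A → B) as f → S (map h as) f ≈ S as (f ∘ h)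
  S-map h []       f = ≈-refl
  S-map h (a ∷ as) f = +-congˡ (S-map h as f)

  S-concatMap : ∀ {A B : Set} (h : A → List B) as f → S (concatMap h as) f ≈ S as (λ a → S (h a) f)
  S-concatMap h []       f = ≈-refl
  S-concatMap h (a ∷ as) f = ≈-trans (S-++ (h a) _ f) (+-congˡ (S-concatMap h as f))

-- Natural numbers and their reciprocals in ℚ.

-- Kept abstract: unfolding the normalisation of fractions is expensive.
abstract
  nat recip : ℕ → ℚ
  nat n = ℤ.+ n ℚ./ 1
  recip n = 1/ n

  nat-def : ∀ n → nat n ≡ ℤ.+ n ℚ./ 1
  nat-def n = refl

  recip-def : ∀ n → recip n ≡ 1/ n
  recip-def n = refl

  toℚᵘ-/ : ∀ i n → ℚ.toℚᵘ (i ℚ./ suc n) ℚᵘ.≃ ℚᵘ.mkℚᵘ i n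
  toℚᵘ-/ i n = ℚ.toℚᵘ-fromℚᵘ (ℚᵘ.mkℚᵘ i n)

  nat-+ : ∀ m n → nat (m + n) ≡ nat m ℚ.+ nat n
  nat-+ m n = ℚ.toℚᵘ-injective (begin
    ℚ.toℚᵘ (nat (m + n))                      ≈⟨ toℚᵘ-/ (ℤ.+ (m + n)) 0 ⟩
    ℚᵘ.mkℚᵘ (ℤ.+ (m + n)) 0
      ≡⟨ cong (λ i → ℚᵘ.mkℚᵘ i 0) (trans (ℤ.pos-+ m n)
           (sym (cong₂ ℤ._+_ (ℤ.*-identityʳ (ℤ.+ m)) (ℤ.*-identityʳ (ℤ.+ n))))) ⟩
    ℚᵘ.mkℚᵘ (ℤ.+ m) 0 ℚᵘ.+ ℚᵘ.mkℚᵘ (ℤ.+ n) 0  ≈⟨ ℚᵘ.+-cong (toℚᵘ-/ (ℤ.+ m) 0) (toℚᵘ-/ (ℤ.+ n) 0) ⟨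
    ℚ.toℚᵘ (nat m) ℚᵘ.+ ℚ.toℚᵘ (nat n)        ≈⟨ ℚ.toℚᵘ-homo-+ (nat m) (nat n) ⟨
    ℚ.toℚᵘ (nat m ℚ.+ nat n)                  ∎)
    where open ℚᵘ.≃-Reasoning

  nat-* : ∀ m n → nat (m ℕ.* n) ≡ nat m ℚ.* nat n
  nat-* m n = ℚ.toℚᵘ-injective (begin
    ℚ.toℚᵘ (nat (m ℕ.* n))                      ≈⟨ toℚᵘ-/ (ℤ.+ (m ℕ.* n)) 0 ⟩
    ℚᵘ.mkℚᵘ (ℤ.+ (m ℕ.* n)) 0                   ≡⟨ cong (λ i → ℚᵘ.mkℚᵘ i 0) (ℤ.pos-* m n) ⟩
    ℚᵘ.mkℚᵘ (ℤ.+ m) 0 ℚᵘ.* ℚᵘ.mkℚᵘ (ℤ.+ n) 0  ≈⟨ ℚᵘ.*-cong (toℚᵘ-/ (ℤ.+ m) 0) (toℚᵘ-/ (ℤ.+ n) 0) ⟨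
    ℚ.toℚᵘ (nat m) ℚᵘ.* ℚ.toℚᵘ (nat n)        ≈⟨ ℚ.toℚᵘ-homo-* (nat m) (nat n) ⟨
    ℚ.toℚᵘ (nat m ℚ.* nat n)                  ∎)
    where open ℚᵘ.≃-Reasoning

  nat-recip : ∀ n .{{_ : NonZero n}} → nat n ℚ.* recip n ≡ 1ℚ
  nat-recip (suc n) = ℚ.toℚᵘ-injective (begin
    ℚ.toℚᵘ (nat (suc n) ℚ.* recip (suc n))                 ≈⟨ ℚ.toℚᵘ-homo-* (nat (suc n)) (recip (suc n)) ⟩
    ℚ.toℚᵘ (nat (suc n)) ℚᵘ.* ℚ.toℚᵘ (recip (suc n))       ≈⟨ ℚᵘ.*-cong (toℚᵘ-/ (ℤ.+ suc n) 0) (toℚᵘ-/ (ℤ.+ 1) n) ⟩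
    ℚᵘ.mkℚᵘ (ℤ.+ suc n) 0 ℚᵘ.* ℚᵘ.mkℚᵘ (ℤ.+ 1) n      ≈⟨ ℚᵘ.*≡* (cong (λ k → ℤ.+ suc k) lemma) ⟩
    ℚᵘ.1ℚᵘ                                            ∎)
    where
    open ℚᵘ.≃-Reasoning
    lemma : n ℕ.* 1 ℕ.* 1 ≡ n + 0 + 0
    lemma = trans (trans (ℕ.*-identityʳ (n ℕ.* 1)) (ℕ.*-identityʳ n)) (sym (trans (ℕ.+-identityʳ (n + 0)) (ℕ.+-identityʳ n)))

recip-unique : ∀ m .{{_ : NonZero m}} {x y} → nat m ℚ.* x ≡ y → x ≡ recip m ℚ.* y
recip-unique m {x} {y} e = begin
  x                          ≡⟨ ℚ.*-identityˡ x ⟨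
  1ℚ ℚ.* x                   ≡⟨ cong (ℚ._* x) (trans (ℚ.*-comm (recip m) (nat m)) (nat-recip m)) ⟨
  (recip m ℚ.* nat m) ℚ.* x     ≡⟨ ℚ.*-assoc (recip m) (nat m) x ⟩
  recip m ℚ.* (nat m ℚ.* x)     ≡⟨ cong (recip m ℚ.*_) e ⟩
  recip m ℚ.* y                 ∎
  where open ≡-Reasoning

recip-* : ∀ m n .{{_ : NonZero m}} .{{_ : NonZero n}} → recip (m ℕ.* n) ≡ recip m ℚ.* recip n
recip-* m n = recip-unique m (trans (recip-unique n lemma) (ℚ.*-identityʳ (recip n)))
  where
  open ≡-Reasoning
  instance
    _ = ℕ.m*n≢0 m n
  lemma : nat n ℚ.* (nat m ℚ.* recip (m ℕ.* n)) ≡ 1ℚ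
  lemma = begin
    nat n ℚ.* (nat m ℚ.* recip (m ℕ.* n))  ≡⟨ ℚ.*-assoc (nat n) (nat m) _ ⟨
    (nat n ℚ.* nat m) ℚ.* recip (m ℕ.* n)  ≡⟨ cong (ℚ._* recip (m ℕ.* n)) (trans (ℚ.*-comm (nat n) (nat m)) (sym (nat-* m n))) ⟩
    nat (m ℕ.* n) ℚ.* recip (m ℕ.* n)        ≡⟨ nat-recip (m ℕ.* n) ⟩
    1ℚ                                ∎

-- Formal power series: exp(-log(1-x)) = 1/(1-x).

module Log {c ℓ : Level} {{K : ℚ-Algebra c ℓ}} where

  open Sums {{K}}

  N inv : ℕ → Carrier
  N n   = ι (nat n)
  inv n = ι (recip (suc n))

  N-0 : N 0 ≈ 0#
  N-0 = ≈-trans (≈-reflexive (cong ι (nat-def 0))) ι-0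

  N-1 : N 1 ≈ 1#
  N-1 = ≈-trans (≈-reflexive (cong ι (nat-def 1))) ι-1

  N-+ : ∀ m n → N (m + n) ≈ N m +ᴷ N n
  N-+ m n = ≈-trans (≈-reflexive (cong ι (nat-+ m n))) (ι-+ (nat m) (nat n))

  N-suc : ∀ n → N (suc n) ≈ 1# +ᴷ N n
  N-suc n = ≈-trans (N-+ 1 n) (+-congʳ N-1)

  N-inv : ∀ n → N (suc n) *ᴷ inv n ≈ 1#
  N-inv n = ≈-trans (≈-sym (ι-* (nat (suc n)) (recip (suc n)))) (≈-trans (≈-reflexive (cong ι (nat-recip (suc n)))) ι-1)

  -- The coefficient ring may have zero divisors; positive integers can still be cancelled, since
  -- `ι` carries their reciprocals over from ℚ.
  N-cancel : ∀ n {x y} → N (suc n) *ᴷ x ≈ N (suc n) *ᴷ y → x ≈ y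
  N-cancel n {x} {y} e = ≈-trans (≈-sym (undo x)) (≈-trans (*-congˡ e) (undo y))
    where
    undo : ∀ z → inv n *ᴷ (N (suc n) *ᴷ z) ≈ z
    undo z = begin
      inv n *ᴷ (N (suc n) *ᴷ z)  ≈⟨ *-assoc _ _ _ ⟨
      (inv n *ᴷ N (suc n)) *ᴷ z  ≈⟨ *-congʳ (≈-trans (*-comm _ _) (N-inv n)) ⟩
      1# *ᴷ z                    ≈⟨ *-identityˡ z ⟩
      z                          ∎

  Seq : Set c
  Seq = ℕ → Carrier

  -- The Cauchy product: the coefficient of x^m in u(x) v(x).
  conv : Seq → Seq → ℕ → Carrier
  conv u v zero    = u 0 *ᴷ v 0
  conv u v (suc m) = u 0 *ᴷ v (suc m) +ᴷ conv (u ∘ suc) v m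

  -- The coefficients of x v(x) / (1-x); the entry at `m` stops just before `v m`.
  partial : Seq → ℕ → Carrier
  partial v zero    = 0#
  partial v (suc m) = partial v m +ᴷ v m

  conv-cong : ∀ {u u′ v v′ : Seq} m → (∀ i → u i ≈ u′ i) → (∀ j → j ≤ m → v j ≈ v′ j) → conv u v m ≈ conv u′ v′ m
  conv-cong zero    p q = *-cong (p 0) (q 0 z≤n)
  conv-cong (suc m) p q = +-cong (*-cong (p 0) (q (suc m) ℕ.≤-refl)) (conv-cong m (p ∘ suc) (λ j j≤m → q j (ℕ.m≤n⇒m≤1+n j≤m)))

  partial-cong : ∀ {v v′ : Seq} m → (∀ j → v j ≈ v′ j) → partial v m ≈ partial v′ m
  partial-cong zero    p = ≈-refl
  partial-cong (suc m) p = +-cong (partial-cong m p) (p m)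

  partial-+ : ∀ (u v : Seq) m → partial u m +ᴷ partial v m ≈ partial (λ j → u j +ᴷ v j) m
  partial-+ u v zero    = +-identityˡ 0#
  partial-+ u v (suc m) = ≈-trans
    (solve 4 (λ x a y b → (x :+ a) :+ (y :+ b) := (x :+ y) :+ (a :+ b)) ≈-refl _ _ _ _)
    (+-congʳ (partial-+ u v m))
    where open Solver

  partial-shift : ∀ (v : Seq) m → v 0 +ᴷ partial (v ∘ suc) m ≈ partial v (suc m)
  partial-shift v zero    = +-comm _ _
  partial-shift v (suc m) = ≈-trans (≈-sym (+-assoc _ _ _)) (+-congʳ (partial-shift v m))

  conv-ones : ∀ (v : Seq) m → conv (λ _ → 1#) v m ≈ partial v (suc m)
  conv-ones v zero    = ≈-trans (*-identityˡ _) (≈-sym (+-identityˡ _))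
  conv-ones v (suc m) = ≈-trans (+-cong (*-identityˡ _) (conv-ones v m)) (+-comm _ _)

  partial-conv-suc : ∀ (u v : Seq) m → partial (conv u v) (suc m) ≈ u 0 *ᴷ partial v (suc m) +ᴷ partial (conv (u ∘ suc) v) m
  partial-conv-suc u v zero    = solve 2 (λ x y → con 0 :+ x :* y := x :* (con 0 :+ y) :+ con 0) ≈-refl (u 0) (v 0)
    where open Solver
  partial-conv-suc u v (suc m) = ≈-trans (+-congʳ (partial-conv-suc u v m))
    (solve 5 (λ x p q y r → (x :* p :+ q) :+ (x :* y :+ r) := x :* (p :+ y) :+ (q :+ r)) ≈-refl
      (u 0) (partial v (suc m)) (partial (conv (u ∘ suc) v) m) (v (suc m)) (conv (u ∘ suc) v m))
    where open Solver

  -- Multiplication by x/(1-x) may be applied to one factor or to the whole product.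
  conv-partial : ∀ (u v : Seq) m → conv u (partial v) m ≈ partial (conv u v) m
  conv-partial u v zero    = zeroʳ (u 0)
  conv-partial u v (suc m) = ≈-trans (+-congˡ (conv-partial (u ∘ suc) v m)) (≈-sym (partial-conv-suc u v m))

  -- The product rule for the derivation multiplying the m-th coefficient by m
  -- (shifted by a on the first factor).
  conv-leibniz : ∀ a (u v : Seq) m →
                 N (a + m) *ᴷ conv u v m ≈ conv (λ i → N (a + i) *ᴷ u i) v m +ᴷ conv u (λ j → N j *ᴷ v j) m
  conv-leibniz a u v zero = begin
    N (a + 0) *ᴷ (u 0 *ᴷ v 0)
      ≈⟨ solve 3 (λ n x y → n :* (x :* y) := n :* x :* y :+ x :* (con 0 :* y)) ≈-refl (N (a + 0)) (u 0) (v 0) ⟩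
    N (a + 0) *ᴷ u 0 *ᴷ v 0 +ᴷ u 0 *ᴷ (0# *ᴷ v 0)
      ≈⟨ +-congˡ (*-congˡ (*-congʳ N-0)) ⟨
    N (a + 0) *ᴷ u 0 *ᴷ v 0 +ᴷ u 0 *ᴷ (N 0 *ᴷ v 0) ∎
    where open Solver
  conv-leibniz a u v (suc m) = begin
    N (a + suc m) *ᴷ (u 0 *ᴷ v (suc m) +ᴷ C)
      ≈⟨ distribˡ _ _ _ ⟩
    N (a + suc m) *ᴷ (u 0 *ᴷ v (suc m)) +ᴷ N (a + suc m) *ᴷ C
      ≈⟨ +-cong (*-congʳ (≈-trans (N-+ a (suc m)) (+-congʳ (≈-reflexive (cong N (sym (ℕ.+-identityʳ a)))))))
                (≈-trans (*-congʳ (≈-reflexive (cong N (ℕ.+-suc a m)))) (conv-leibniz (suc a) (u ∘ suc) v m)) ⟩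
    (N (a + 0) +ᴷ N (suc m)) *ᴷ (u 0 *ᴷ v (suc m)) +ᴷ (conv (λ i → N (suc a + i) *ᴷ u (suc i)) v m +ᴷ D)
      ≈⟨ +-congˡ (+-congʳ (conv-cong m (λ i → *-congʳ (≈-reflexive (cong N (sym (ℕ.+-suc a i))))) (λ _ _ → ≈-refl))) ⟩
    (N (a + 0) +ᴷ N (suc m)) *ᴷ (u 0 *ᴷ v (suc m)) +ᴷ (E +ᴷ D)
      ≈⟨ solve 6 (λ n n′ x y e d → (n :+ n′) :* (x :* y) :+ (e :+ d) := (n :* x :* y :+ e) :+ (x :* (n′ :* y) :+ d)) ≈-refl
           (N (a + 0)) (N (suc m)) (u 0) (v (suc m)) E D ⟩
    (N (a + 0) *ᴷ u 0 *ᴷ v (suc m) +ᴷ E) +ᴷ (u 0 *ᴷ (N (suc m) *ᴷ v (suc m)) +ᴷ D) ∎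
    where
    open Solver
    C = conv (u ∘ suc) v m
    D = conv (u ∘ suc) (λ j → N j *ᴷ v j) m
    E = conv (λ i → N (a + suc i) *ᴷ u (suc i)) v m

  -- T g n = Σ_{β ⊨ n} g(ℓ(β)) / Πβ, and tailSum g a m is the sum over the
  -- compositions of a + 1 + m with first part > a, weighted by g(ℓ - 1).
  tailSum : Seq → ℕ → ℕ → Carrier
  tailSum g a zero    = g 0 *ᴷ inv a
  tailSum g a (suc m) = inv a *ᴷ tailSum (g ∘ suc) 0 m +ᴷ tailSum g (suc a) m

  T : Seq → ℕ → Carrier
  T g zero    = g 0
  T g (suc m) = tailSum (g ∘ suc) 0 m

  tailSum-cong : ∀ {g h : Seq} a m → (∀ l → g l ≈ h l) → tailSum g a m ≈ tailSum h a m
  tailSum-cong a zero    e = *-congʳ (e 0)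
  tailSum-cong a (suc m) e = +-cong (*-congˡ (tailSum-cong 0 m (e ∘ suc))) (tailSum-cong (suc a) m e)

  tailSum-+ : ∀ (g h : Seq) a m → tailSum g a m +ᴷ tailSum h a m ≈ tailSum (λ l → g l +ᴷ h l) a m
  tailSum-+ g h a zero    = ≈-sym (distribʳ _ _ _)
  tailSum-+ g h a (suc m) = ≈-trans
    (solve 5 (λ i x y z w → (i :* x :+ y) :+ (i :* z :+ w) := i :* (x :+ z) :+ (y :+ w)) ≈-refl
      (inv a) (tailSum (g ∘ suc) 0 m) (tailSum g (suc a) m) (tailSum (h ∘ suc) 0 m) (tailSum h (suc a) m))
    (+-cong (*-congˡ (tailSum-+ (g ∘ suc) (h ∘ suc) 0 m)) (tailSum-+ g h (suc a) m))
    where open Solver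

  T-cong : ∀ {g h : Seq} n → (∀ l → g l ≈ h l) → T g n ≈ T h n
  T-cong zero    e = e 0
  T-cong (suc m) e = tailSum-cong 0 m (e ∘ suc)

  T-+ : ∀ (g h : Seq) n → T g n +ᴷ T h n ≈ T (λ l → g l +ᴷ h l) n
  T-+ g h zero    = ≈-refl
  T-+ g h (suc m) = tailSum-+ (g ∘ suc) (h ∘ suc) 0 m

  -- Sorts the compositions by their first part a + 1 + i; what remains is an arbitrary composition
  -- of m - i.
  tailSum-conv : ∀ (g : Seq) a m → tailSum g a m ≈ conv (λ i → inv (a + i)) (T g) m
  tailSum-conv g a zero    = ≈-trans (*-comm _ _) (*-congʳ (≈-reflexive (cong inv (sym (ℕ.+-identityʳ a)))))
  tailSum-conv g a (suc m) = +-cong (*-congʳ (≈-reflexive (cong inv (sym (ℕ.+-identityʳ a)))))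
    (≈-trans (tailSum-conv g (suc a) m) (conv-cong m (λ i → ≈-reflexive (cong inv (sym (ℕ.+-suc a i)))) (λ _ _ → ≈-refl)))

  -- The coefficients of g′(y) for g(y) = Σ g(l) y^l.
  deriv : Seq → Seq
  deriv g l = N (suc l) *ᴷ g (suc l)

  -- With L = -log(1-x) and T g the coefficients of g(L): x (g(L))′ = g′(L) · x/(1-x).
  T-deriv : ∀ b n → n ≤ b → ∀ g → N n *ᴷ T g n ≈ partial (T (deriv g)) n
  T-deriv b       zero    _         g = ≈-trans (*-congʳ N-0) (zeroˡ _)
  -- The bound `b` makes a strong induction structural: the hypothesis is called for every `j ≤ m`
  -- at once.
  T-deriv (suc b) (suc m) (s≤s m≤b) g = begin
    N (suc m) *ᴷ tailSum g′ 0 m                  ≈⟨ *-congˡ (tailSum-conv g′ 0 m) ⟩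
    -- The shift is 1 because `inv i` is the coefficient of x^(i+1) in L. Then `N-inv` says that L′
    -- = 1/(1-x), and the hypothesis differentiates the other factor.
    N (suc m) *ᴷ conv inv (T g′) m            ≈⟨ conv-leibniz 1 inv (T g′) m ⟩
    conv (λ i → N (suc i) *ᴷ inv i) (T g′) m +ᴷ conv inv (λ j → N j *ᴷ T g′ j) m
      ≈⟨ +-cong (conv-cong m N-inv (λ _ _ → ≈-refl))
                (conv-cong m (λ _ → ≈-refl) (λ j j≤m → T-deriv b j (ℕ.≤-trans j≤m m≤b) g′)) ⟩
    conv (λ _ → 1#) (T g′) m +ᴷ conv inv (partial (T (deriv g′))) m
      ≈⟨ +-cong (conv-ones (T g′) m) (conv-partial inv (T (deriv g′)) m) ⟩
    partial (T g′) (suc m) +ᴷ partial (conv inv (T (deriv g′))) m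
      ≈⟨ +-congˡ (partial-cong m (λ j → ≈-sym (tailSum-conv (deriv g′) 0 j))) ⟩
    partial (T g′) (suc m) +ᴷ partial (T h ∘ suc) m
      ≈⟨ +-congˡ (+-identityˡ _) ⟨
    partial (T g′) (suc m) +ᴷ (0# +ᴷ partial (T h ∘ suc) m)
      ≈⟨ +-congˡ (+-congʳ (≈-trans (*-congʳ N-0) (zeroˡ _))) ⟨
    partial (T g′) (suc m) +ᴷ (T h 0 +ᴷ partial (T h ∘ suc) m)
      ≈⟨ +-congˡ (partial-shift (T h) m) ⟩
    partial (T g′) (suc m) +ᴷ partial (T h) (suc m)
      ≈⟨ partial-+ (T g′) (T h) (suc m) ⟩
    partial (λ j → T g′ j +ᴷ T h j) (suc m)
      ≈⟨ partial-cong (suc m) (λ j → ≈-trans (T-+ g′ h j) (T-cong j regroup)) ⟩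
    partial (T (deriv g)) (suc m) ∎
    where
    g′ h : Seq
    g′ = g ∘ suc
    h l = N l *ᴷ g (suc l)
    regroup : ∀ l → g′ l +ᴷ h l ≈ deriv g l
    regroup l = ≈-sym (≈-trans (*-congʳ (N-suc l)) (≈-trans (distribʳ _ _ _) (+-congʳ (*-identityˡ _))))

  invFactorial : Seq
  invFactorial l = ι (recip (l !))

  deriv-invFactorial : ∀ l → deriv invFactorial l ≈ invFactorial l
  deriv-invFactorial l = begin
    N (suc l) *ᴷ ι (recip (suc l ℕ.* l !))               ≈⟨ *-congˡ (≈-trans (≈-reflexive (cong ι (recip-* (suc l) (l !) {{_}} {{l ℕ.!≢0}}))) (ι-* _ _)) ⟩
    N (suc l) *ᴷ (inv l *ᴷ invFactorial l)          ≈⟨ *-assoc _ _ _ ⟨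
    (N (suc l) *ᴷ inv l) *ᴷ invFactorial l          ≈⟨ *-congʳ (N-inv l) ⟩
    1# *ᴷ invFactorial l                            ≈⟨ *-identityˡ _ ⟩
    invFactorial l                                  ∎

  -- exp(-log(1-x)) = 1/(1-x).
  T-invFactorial : ∀ b n → n ≤ b → T invFactorial n ≈ 1#
  T-invFactorial b       zero    _         = ≈-trans (≈-reflexive (cong ι (recip-def 1))) ι-1
  T-invFactorial (suc b) (suc m) (s≤s m≤b) = N-cancel m (begin
    -- Since exp′ = exp, the differential equation reads n T(n) = T(0) + ... + T(n-1), and the
    -- hypothesis makes the right side n.
    N (suc m) *ᴷ T invFactorial (suc m)      ≈⟨ T-deriv (suc m) (suc m) ℕ.≤-refl invFactorial ⟩
    partial (T (deriv invFactorial)) (suc m) ≈⟨ partial-cong (suc m) (λ j → T-cong j deriv-invFactorial) ⟩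
    partial (T invFactorial) (suc m)         ≈⟨ count (suc m) (λ j j≤m → T-invFactorial b j (ℕ.≤-trans (ℕ.≤-pred j≤m) m≤b)) ⟩
    N (suc m)                                ≈⟨ *-identityʳ _ ⟨
    N (suc m) *ᴷ 1#                          ∎)
    where
    count : ∀ {v : Seq} n → (∀ j → j < n → v j ≈ 1#) → partial v n ≈ N n
    count zero    e = ≈-sym N-0
    count (suc n) e = ≈-trans (+-cong (count n (λ j j<n → e j (ℕ.m≤n⇒m≤1+n j<n))) (e n ℕ.≤-refl))
                        (≈-trans (+-comm _ _) (≈-sym (N-suc n)))

  -- Sums over all ways of cutting a pattern.

  -- cutSum g c c p sums g(k - 1) · c(p₁)⋯c(p_k) over all ways of cutting the pattern p
  -- into k pieces p₁,…,p_k, where every cut swallows one letter; in cutSum g c c₀ p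
  -- the first piece is weighted by c₀ instead.
  cutSum : Seq → (List Bool → Carrier) → (List Bool → Carrier) → List Bool → Carrier
  cutSum g c c₀ []      = g 0 *ᴷ c₀ []
  cutSum g c c₀ (x ∷ p) = c₀ [] *ᴷ cutSum (g ∘ suc) c c p +ᴷ cutSum g c (c₀ ∘ (x ∷_)) p

  cutSum-cong : ∀ (g : Seq) c {c₀ c₁} p → (∀ r → c₀ r ≈ c₁ r) → cutSum g c c₀ p ≈ cutSum g c c₁ p
  cutSum-cong g c []      e = *-congˡ (e [])
  cutSum-cong g c (x ∷ p) e = +-cong (*-congʳ (e [])) (cutSum-cong g c p (e ∘ (x ∷_)))

  X-+ : ∀ (g : Seq) c c₀ c₁ p → cutSum g c (λ r → c₀ r +ᴷ c₁ r) p ≈ cutSum g c c₀ p +ᴷ cutSum g c c₁ p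
  X-+ g c c₀ c₁ []      = distribˡ _ _ _
  X-+ g c c₀ c₁ (x ∷ p) = ≈-trans (+-congˡ (X-+ g c (c₀ ∘ (x ∷_)) (c₁ ∘ (x ∷_)) p))
    (solve 5 (λ a b t y z → (a :+ b) :* t :+ (y :+ z) := (a :* t :+ y) :+ (b :* t :+ z)) ≈-refl
       (c₀ []) (c₁ []) (cutSum (g ∘ suc) c c p) (cutSum g c (c₀ ∘ (x ∷_)) p) (cutSum g c (c₁ ∘ (x ∷_)) p))
    where open Solver

  -- For c(p) = ∫ (-t)^#true (1-t)^#false dt this is (1-t) = (-t) + 1.
  Splits : Bool → (List Bool → Carrier) → Set ℓ
  Splits s c = ∀ u v → c (u ++ s ∷ v) ≈ c (u ++ not s ∷ v) +ᴷ c (u ++ v)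

  -- A cut at the letter in question swallows it, so these terms are the same for `s` and `not s`.
  -- Without that cut the letter lies inside one piece, whose weight splits by hypothesis; the extra
  -- terms, with the letter deleted, run exactly over the cuts of `u ++ v`.
  cutSum-splits : ∀ s {c c₀} → Splits s c → Splits s c₀ → ∀ g → Splits s (cutSum g c c₀)
  cutSum-splits s {c} {c₀} R R₀ g [] v = begin
    A +ᴷ cutSum g c (c₀ ∘ (s ∷_)) v
      ≈⟨ +-congˡ (≈-trans (cutSum-cong g c v (R₀ [])) (X-+ g c (c₀ ∘ (not s ∷_)) c₀ v)) ⟩
    A +ᴷ (cutSum g c (c₀ ∘ (not s ∷_)) v +ᴷ cutSum g c c₀ v)
      ≈⟨ +-assoc _ _ _ ⟨
    A +ᴷ cutSum g c (c₀ ∘ (not s ∷_)) v +ᴷ cutSum g c c₀ v ∎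
    where A = c₀ [] *ᴷ cutSum (g ∘ suc) c c v
  cutSum-splits s {c} {c₀} R R₀ g (x ∷ u) v = ≈-trans
    (+-cong (*-congˡ (cutSum-splits s R R (g ∘ suc) u v)) (cutSum-splits s R (R₀ ∘ (x ∷_)) g u v))
    (solve 5 (λ a t y z w → a :* (t :+ y) :+ (z :+ w) := (a :* t :+ z) :+ (a :* y :+ w)) ≈-refl
      (c₀ []) (cutSum (g ∘ suc) c c (u ++ not s ∷ v)) (cutSum (g ∘ suc) c c (u ++ v))
      (cutSum g c (c₀ ∘ (x ∷_)) (u ++ not s ∷ v)) (cutSum g c (c₀ ∘ (x ∷_)) (u ++ v)))
    where open Solver

  -- The cuts of a constant pattern of `m` letters are the compositions of m + 1, and a piece weighs
  -- the reciprocal of its part. The number `a` counts the letters of the first piece that `c₀` has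
  -- already absorbed.
  cutSum-replicate : ∀ s {c c₀} a → (∀ m → c (replicate m s) ≈ inv m) → (∀ m → c₀ (replicate m s) ≈ inv (a + m)) →
                ∀ g m → cutSum g c c₀ (replicate m s) ≈ tailSum g a m
  cutSum-replicate s a B B₀ g zero    = *-congˡ (≈-trans (B₀ 0) (≈-reflexive (cong inv (ℕ.+-identityʳ a))))
  cutSum-replicate s a B B₀ g (suc m) = +-cong
    (*-cong (≈-trans (B₀ 0) (≈-reflexive (cong inv (ℕ.+-identityʳ a)))) (cutSum-replicate s 0 B B (g ∘ suc) m))
    (cutSum-replicate s (suc a) B (λ j → ≈-trans (B₀ (suc j)) (≈-reflexive (cong inv (ℕ.+-suc a j)))) g m)

  constantly : Bool → List Bool → Carrier
  constantly s []      = 1#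
  constantly s (x ∷ p) = 𝟙 (x Bool.≟ s) *ᴷ constantly s p

  +-cancelʳ-0 : ∀ {x y} → x ≈ y +ᴷ x → y ≈ 0#
  +-cancelʳ-0 {x} {y} e = begin
    y                       ≈⟨ +-identityʳ y ⟨
    y +ᴷ 0#                 ≈⟨ +-congˡ (-‿inverseʳ x) ⟨
    y +ᴷ (x +ᴷ (-ᴷ x))      ≈⟨ +-assoc _ _ _ ⟨
    (y +ᴷ x) +ᴷ (-ᴷ x)      ≈⟨ +-congʳ e ⟨
    x +ᴷ (-ᴷ x)             ≈⟨ -‿inverseʳ x ⟩
    0#                      ∎

  -- Write Y for the cut sum. Behind a prefix s^k, the splitting relation is Y(s^k s v) = Y(s^k (not
  -- s) v) + Y(s^k v). By induction on `v`, for all `k` at once, Y(s^k s v) and Y(s^k v) are both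
  -- `constantly s v`, so the remaining term vanishes. A pattern that is entirely `s` is the case of
  -- exp(-log(1-x)).
  cutSum-constantly : ∀ s {c} → Splits s c → (∀ m → c (replicate m s) ≈ inv m) →
                 ∀ p → cutSum (invFactorial ∘ suc) c c p ≈ constantly s p
  cutSum-constantly s {c} R B = go 0
    where
    Y = cutSum (invFactorial ∘ suc) c c
    shift : ∀ k v → replicate k s ++ s ∷ v ≡ s ∷ replicate k s ++ v
    shift zero    v = refl
    shift (suc k) v = cong (s ∷_) (shift k v)
    go : ∀ k v → Y (replicate k s ++ v) ≈ constantly s v
    same : ∀ k v → Y (replicate k s ++ s ∷ v) ≈ constantly s v
    other : ∀ k v → Y (replicate k s ++ not s ∷ v) ≈ 0#
    same k v = ≈-trans (≈-reflexive (cong Y (shift k v))) (go (suc k) v)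
    other k v = +-cancelʳ-0 (≈-trans (≈-sym (same k v)) (≈-trans (cutSum-splits s R R _ (replicate k s) v) (+-congˡ (go k v))))
    go k []      = ≈-trans (≈-reflexive (cong Y (++-identityʳ (replicate k s))))
      (≈-trans (cutSum-replicate s 0 B B _ k) (T-invFactorial (suc k) (suc k) ℕ.≤-refl))
    go k (x ∷ v) with x Bool.≟ s
    ... | yes refl = ≈-trans (same k v) (≈-sym (*-identityˡ _))
    ... | no x≢s = ≈-trans (≈-trans (≈-reflexive (cong (λ y → Y (replicate k s ++ y ∷ v)) (Bool.¬-not x≢s))) (other k v)) (≈-sym (zeroˡ _))

-- Compositions as Boolean patterns.

-- A composition of n + 1 is encoded by its pattern, the list of n Booleans
-- telling which k ∈ [n] belong to its set.
Pattern : Set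
Pattern = List Bool

firstPart : Pattern → ℕ
firstPart []          = 0
firstPart (true ∷ p)  = 0
firstPart (false ∷ p) = suc (firstPart p)

otherParts : Pattern → Composition
otherParts []          = []
otherParts (true ∷ p)  = 1+ firstPart p ∷ otherParts p
otherParts (false ∷ p) = otherParts p

comp : Pattern → Composition
comp p = 1+ firstPart p ∷ otherParts p

enlarge : Composition → Composition
enlarge []           = []
enlarge ((1+ k) ∷ α) = 1+ (suc k) ∷ α

-- Encodes `1+ k ∷ α`. Passing head and tail separately excludes the empty composition, which has no
-- pattern.
pattern-of : ℕ → Composition → Pattern
pattern-of zero    []            = []
pattern-of zero    ((1+ k) ∷ α)  = true ∷ pattern-of k α
pattern-of (suc k) α             = false ∷ pattern-of k α

comp-pattern : ∀ k α → comp (pattern-of k α) ≡ 1+ k ∷ α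
comp-pattern zero    []           = refl
comp-pattern zero    ((1+ k) ∷ α) = cong (1+ 0 ∷_) (comp-pattern k α)
comp-pattern (suc k) α            = cong enlarge (comp-pattern k α)

pattern-comp : ∀ p → pattern-of (firstPart p) (otherParts p) ≡ p
pattern-comp []          = refl
pattern-comp (true ∷ p)  = cong (true ∷_) (pattern-comp p)
pattern-comp (false ∷ p) = cong (false ∷_) (pattern-comp p)

comp-injective : ∀ {p q} → comp p ≡ comp q → p ≡ q
comp-injective {p} {q} e = trans (sym (pattern-comp p)) (trans (cong decode e) (pattern-comp q))
  where
  decode : Composition → Pattern
  decode []           = []
  decode ((1+ k) ∷ α) = pattern-of k α

-- Matching on this view reduces a claim about a composition to the empty case and a claim about
-- patterns.
data View : Composition → Set where
  empty   : View []
  nonempty : ∀ p → View (comp p)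

view : ∀ α → View α
view []           = empty
view ((1+ k) ∷ α) = subst View (comp-pattern k α) (nonempty (pattern-of k α))

size-comp : ∀ p → size (comp p) ≡ suc (length p)
size-comp []          = refl
size-comp (true ∷ p)  = cong suc (size-comp p)
size-comp (false ∷ p) = cong suc (size-comp p)

trues : Pattern → ℕ
trues []          = 0
trues (true ∷ p)  = suc (trues p)
trues (false ∷ p) = trues p

length-otherParts : ∀ p → length (otherParts p) ≡ trues p
length-otherParts []          = refl
length-otherParts (true ∷ p)  = cong suc (length-otherParts p)
length-otherParts (false ∷ p) = length-otherParts p

-- Shaped like `positions`, so that descent sets of words become `ones` of descent patterns by
-- congruence alone.
ones : Pattern → List ℕ
ones []      = []
ones (b ∷ p) = (if b then [ 1 ] else []) ++ map suc (ones p)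

set-comp : ∀ p → set (comp p) ≡ ones p
set-comp []          = refl
set-comp (true ∷ p)  = cong (λ ks → 1 ∷ map suc ks) (set-comp p)
set-comp (false ∷ p) = trans (set-grow (firstPart p) (otherParts p)) (cong (map suc) (set-comp p))
  where
  set-grow : ∀ k α → set (1+ (suc k) ∷ α) ≡ map suc (set (1+ k ∷ α))
  set-grow k []      = refl
  set-grow k (b ∷ α) = cong (suc (suc k) ∷_) (map-∘ (set (b ∷ α)))

0∉map-suc : ∀ {ks} → 0 ∉ map suc ks
0∉map-suc 0∈ with () ← proj₂ (proj₂ (∈-map⁻ suc 0∈))

1∉map-suc-ones : ∀ p → 1 ∉ map suc (ones p)
1∉map-suc-ones p 1∈ with ∈-map⁻ suc 1∈
... | zero , 0∈ , refl = zero∉ p 0∈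
  where
  zero∉ : ∀ p → 0 ∉ ones p
  zero∉ (true ∷ p)  (there 0∈) = 0∉map-suc 0∈
  zero∉ (false ∷ p) 0∈         = 0∉map-suc 0∈

ones-injective : ∀ p q → length p ≡ length q → ones p ≡ ones q → p ≡ q
ones-injective []          []          _  _ = refl
ones-injective (true ∷ p)  (true ∷ q)  le e =
  cong (true ∷_) (ones-injective p q (ℕ.suc-injective le) (map-injective ℕ.suc-injective (∷-injectiveʳ e)))
ones-injective (false ∷ p) (false ∷ q) le e =
  cong (false ∷_) (ones-injective p q (ℕ.suc-injective le) (map-injective ℕ.suc-injective e))
ones-injective (true ∷ p)  (false ∷ q) le e = ⊥-elim (1∉map-suc-ones q (subst (1 ∈_) e (here refl)))
ones-injective (false ∷ p) (true ∷ q)  le e = ⊥-elim (1∉map-suc-ones p (subst (1 ∈_) (sym e) (here refl)))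

set-injective : ∀ α β → size α ≡ size β → set α ≡ set β → α ≡ β
set-injective α β se e with view α | view β
... | empty      | empty      = refl
... | empty      | nonempty q with () ← trans se (size-comp q)
... | nonempty p | empty      with () ← trans (sym se) (size-comp p)
... | nonempty p | nonempty q = cong comp (ones-injective p q
        (ℕ.suc-injective (trans (sym (size-comp p)) (trans se (size-comp q))))
        (trans (sym (set-comp p)) (trans e (set-comp q))))

patterns : ℕ → List Pattern
patterns zero    = [ [] ]
patterns (suc n) = concatMap (λ p → (true ∷ p) ∷ (false ∷ p) ∷ []) (patterns n)

patterns-unique : ∀ n → Unique (patterns n)
patterns-unique zero    = [] ∷ []
patterns-unique (suc n) = concatMap-unique (λ p → (true ∷ p) ∷ (false ∷ p) ∷ []) parent
  (λ { p (here refl) → refl ; p (there (here refl)) → refl })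
  (λ p → ((λ ()) ∷ []) ∷ [] ∷ []) (patterns-unique n)
  where
  parent : Pattern → Pattern
  parent []      = []
  parent (_ ∷ p) = p

∈-patterns : ∀ p → p ∈ patterns (length p)
∈-patterns []          = here refl
∈-patterns (true ∷ p)  = ∈-concatMap-intro _ (∈-patterns p) (here refl)
∈-patterns (false ∷ p) = ∈-concatMap-intro _ (∈-patterns p) (there (here refl))

patterns-length : ∀ n {p} → p ∈ patterns n → length p ≡ n
patterns-length zero    (here refl) = refl
patterns-length (suc n) p∈ with ∈-concatMap-elim _ {patterns n} p∈
... | q , q∈ , here refl         = cong suc (patterns-length n q∈)
... | q , q∈ , there (here refl) = cong suc (patterns-length n q∈)

compositions-patterns : ∀ n → compositions (suc n) ≡ map comp (patterns n)
compositions-patterns zero    = refl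
compositions-patterns (suc n) = trans (cong (concatMap _) (compositions-patterns n)) (commute _ (λ _ → refl) (patterns n))
  where
  -- The `grow` of `compositions` is local to that definition, so it enters here as a variable
  -- specified by its values on nonempty compositions.
  commute : (grow : Composition → List Composition) →
            (∀ p → grow (comp p) ≡ comp (true ∷ p) ∷ comp (false ∷ p) ∷ []) → ∀ ps →
            concatMap grow (map comp ps) ≡ map comp (concatMap (λ p → (true ∷ p) ∷ (false ∷ p) ∷ []) ps)
  commute grow e []       = refl
  commute grow e (p ∷ ps) = cong₂ _++_ (e p) (commute grow e ps)

compositions-unique : ∀ n → Unique (compositions n)
compositions-unique zero    = [] ∷ []
compositions-unique (suc n) = subst Unique (sym (compositions-patterns n)) (Unique.map⁺ comp-injective (patterns-unique n))

∈-compositions : ∀ α → α ∈ compositions (size α)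
∈-compositions α with view α
... | empty      = here refl
... | nonempty p = subst (λ n → comp p ∈ compositions n) (sym (size-comp p))
                     (subst (comp p ∈_) (sym (compositions-patterns (length p))) (∈-map⁺ comp (∈-patterns p)))

compositions-size : ∀ n {α} → α ∈ compositions n → size α ≡ n
compositions-size zero    (here refl) = refl
compositions-size (suc n) α∈ with ∈-map⁻ comp (subst (_ ∈_) (compositions-patterns n) α∈)
... | p , p∈ , refl = trans (size-comp p) (cong suc (patterns-length n p∈))

descentPattern : ℕ⁺ → Word → Pattern
descentPattern i []      = []
descentPattern i (j ∷ w) = does (i >⁺? j) ∷ descentPattern j w

length-descentPattern : ∀ i w → length (descentPattern i w) ≡ length w
length-descentPattern i []      = refl
length-descentPattern i (j ∷ w) = cong suc (length-descentPattern j w)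

descents-pattern : ∀ i w → descents (i ∷ w) ≡ ones (descentPattern i w)
descents-pattern i []      = refl
descents-pattern i (j ∷ w) = cong (λ ks → (if does (i >⁺? j) then [ 1 ] else []) ++ map suc ks) (descents-pattern j w)

descentComposition : Word → Composition
descentComposition []      = []
descentComposition (i ∷ w) = comp (descentPattern i w)

size-descentComposition : ∀ w → size (descentComposition w) ≡ length w
size-descentComposition []      = refl
size-descentComposition (i ∷ w) = trans (size-comp (descentPattern i w)) (cong suc (length-descentPattern i w))

set-descentComposition : ∀ w → set (descentComposition w) ≡ descents w
set-descentComposition []      = refl
set-descentComposition (i ∷ w) = trans (set-comp (descentPattern i w)) (sym (descents-pattern i w))

suc∈ones : ∀ b p {k} → k ∈ ones p → suc k ∈ ones (b ∷ p)
suc∈ones true  p k∈ = there (∈-map⁺ suc k∈)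
suc∈ones false p k∈ = ∈-map⁺ suc k∈

suc∈ones⁻ : ∀ b p {k} → suc (suc k) ∈ ones (b ∷ p) → suc k ∈ ones p
suc∈ones⁻ true  p (there k∈) with _ , k∈′ , refl ← ∈-map⁻ suc k∈ = k∈′
suc∈ones⁻ false p k∈         with _ , k∈′ , refl ← ∈-map⁻ suc k∈ = k∈′

ones-positive : ∀ p {k} → k ∈ ones p → 1 ≤ k
ones-positive (true ∷ p)  (here refl) = s≤s z≤n
ones-positive (true ∷ p)  (there k∈) with _ , _ , refl ← ∈-map⁻ suc k∈ = s≤s z≤n
ones-positive (false ∷ p) k∈         with _ , _ , refl ← ∈-map⁻ suc k∈ = s≤s z≤n

filter-map-suc : ∀ {P Q : ℕ → Set} (P? : ∀ k → Dec (P k)) (Q? : ∀ k → Dec (Q k)) ks →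
                 (∀ k → k ∈ ks → (P (suc k) → Q k) × (Q k → P (suc k))) →
                 filter P? (map suc ks) ≡ map suc (filter Q? ks)
filter-map-suc P? Q? []       e = refl
filter-map-suc P? Q? (k ∷ ks) e with P? (suc k) | Q? k
... | yes _ | yes _ = cong (suc k ∷_) (filter-map-suc P? Q? ks (λ j j∈ → e j (there j∈)))
... | no _  | no _  = filter-map-suc P? Q? ks (λ j j∈ → e j (there j∈))
... | yes p | no ¬q = contradiction (proj₁ (e k (here refl)) p) ¬q
... | no ¬p | yes q = contradiction (proj₂ (e k (here refl)) q) ¬p

applyUpTo-suc-positive : ∀ n {k} → k ∈ applyUpTo suc n → ∃ λ (j : ℕ) → k ≡ suc j
applyUpTo-suc-positive (suc n) (here refl) = 0 , refl
applyUpTo-suc-positive (suc n) (there k∈)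
  with _ , _ , refl ← ∈-map⁻ suc (subst (_ ∈_) (sym (map-applyUpTo suc suc n)) k∈) = _ , refl

filter-∉-ones : ∀ p → filter (λ k → ¬? (mem? ℕ._≟_ k (ones p))) (applyUpTo suc (length p)) ≡ ones (map not p)
filter-∉-ones []      = refl
filter-∉-ones (b ∷ p) = go b
  where
  higher : ∀ b → filter (λ k → ¬? (mem? ℕ._≟_ k (ones (b ∷ p)))) (applyUpTo (λ k → suc (suc k)) (length p)) ≡ map suc (ones (map not p))
  higher b = trans (cong (filter _) (sym (map-applyUpTo suc suc (length p))))
    (trans (filter-map-suc _ (λ k → ¬? (mem? ℕ._≟_ k (ones p))) (applyUpTo suc (length p)) shift)
           (cong (map suc) (filter-∉-ones p)))
    where
    shift : ∀ k → k ∈ applyUpTo suc (length p) → (suc k ∉ ones (b ∷ p) → k ∉ ones p) × (k ∉ ones p → suc k ∉ ones (b ∷ p))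
    shift k k∈ with _ , refl ← applyUpTo-suc-positive (length p) k∈ =
      (λ k∉ k∈ → k∉ (suc∈ones b p k∈)) , (λ k∉ k∈ → k∉ (suc∈ones⁻ b p k∈))
  go : ∀ b → filter (λ k → ¬? (mem? ℕ._≟_ k (ones (b ∷ p)))) (1 ∷ applyUpTo (λ k → suc (suc k)) (length p)) ≡ ones (not b ∷ map not p)
  go true  = higher true
  go false with mem? ℕ._≟_ 1 (ones (false ∷ p)) in eq
  ... | yes 1∈ = contradiction 1∈ (1∉map-suc-ones p)
  ... | no 1∉  = cong (1 ∷_) (higher false)

∸-suc : ∀ {m n} → m < n → n ∸ m ≡ suc (n ∸ suc m)
∸-suc {zero}  {suc n} _         = refl
∸-suc {suc m} {suc n} (s≤s m<n) = ∸-suc m<n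

differences-enlarge : ∀ m ks n → (∀ {k} → k ∈ ks → suc m < k) → suc m < n →
                      differences m ks n ≡ enlarge (differences (suc m) ks n)
differences-enlarge m []       n _  m<n = cong (λ k → 1+ k ∷ []) (∸-suc m<n)
differences-enlarge m (k ∷ ks) n lt _   = cong (λ j → 1+ j ∷ differences k ks n) (∸-suc (lt (here refl)))

-- The base point `m` is the last position passed. A letter `false` moves it on without closing a
-- part, and `enlarge` restores the missing unit.
differences-ones : ∀ m q → differences m (map (m +_) (ones q)) (m + suc (length q)) ≡ comp q
differences-ones m []          = cong (λ k → 1+ k ∷ []) (trans (cong (_∸ suc m) (ℕ.+-comm m 1)) (ℕ.n∸n≡0 (suc m)))
differences-ones m (x ∷ q)     = go x
  where
  shifted : map (m +_) (map suc (ones q)) ≡ map (suc m +_) (ones q)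
  shifted = trans (sym (map-∘ (ones q))) (map-cong (ℕ.+-suc m) (ones q))
  above : ∀ {k} → k ∈ map (suc m +_) (ones q) → suc m < k
  above k∈ with j , j∈ , refl ← ∈-map⁻ (suc m +_) k∈ = ℕ.m<m+n (suc m) (ones-positive q j∈)
  go : ∀ x → differences m (map (m +_) (ones (x ∷ q))) (m + suc (suc (length q))) ≡ comp (x ∷ q)
  go true rewrite shifted | ℕ.+-comm m 1 | ℕ.n∸n≡0 m | ℕ.+-suc m (suc (length q)) =
    cong (1+ 0 ∷_) (differences-ones (suc m) q)
  go false rewrite shifted | ℕ.+-suc m (suc (length q)) =
    trans (differences-enlarge m _ _ above (ℕ.m<m+n (suc m) (s≤s z≤n))) (cong enlarge (differences-ones (suc m) q))

complement-comp : ∀ p → comp p ᶜ ≡ comp (map not p)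
complement-comp p = begin
  fromSet (size (comp p)) (complementSet (comp p))  ≡⟨ cong₂ fromSet (size-comp p) complementSet-comp ⟩
  differences 0 (ones q) (suc (length p))           ≡⟨ cong₂ (differences 0) (sym (map-id (ones q))) (cong suc (sym (length-map not p))) ⟩
  differences 0 (map (0 +_) (ones q)) (suc (length q)) ≡⟨ differences-ones 0 q ⟩
  comp q ∎
  where
  open ≡-Reasoning
  q = map not p
  complementSet-comp : complementSet (comp p) ≡ ones q
  complementSet-comp = trans
    (cong₂ (λ ks n → filter (λ k → ¬? (mem? ℕ._≟_ k ks)) (applyUpTo suc (n ∸ 1))) (set-comp p) (size-comp p))
    (filter-∉-ones p)

complement-involutive : ∀ α → (α ᶜ) ᶜ ≡ α
complement-involutive α with view α
... | empty      = refl
... | nonempty p = begin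
  (comp p ᶜ) ᶜ               ≡⟨ cong _ᶜ (complement-comp p) ⟩
  comp (map not p) ᶜ         ≡⟨ complement-comp (map not p) ⟩
  comp (map not (map not p)) ≡⟨ cong comp (trans (sym (map-∘ p)) (trans (map-cong Bool.not-involutive p) (map-id p))) ⟩
  comp p                     ∎
  where open ≡-Reasoning

-- The coefficients of 𝛟 as Beta integrals.

module _ where
  open ℚ.+-*-Solver
  x∙yz≡y∙xz : ∀ x y z → x ℚ.* (y ℚ.* z) ≡ y ℚ.* (x ℚ.* z)
  x∙yz≡y∙xz = solve 3 (λ x y z → x :* (y :* z) := y :* (x :* z)) refl
  xy∙zw≡yz∙xw : ∀ x y z w → (x ℚ.* y) ℚ.* (z ℚ.* w) ≡ (y ℚ.* z) ℚ.* (x ℚ.* w)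
  xy∙zw≡yz∙xw = solve 4 (λ x y z w → (x :* y) :* (z :* w) := (y :* z) :* (x :* w)) refl
  xy∙zw≡x∙z∙yw : ∀ x y z w → (x ℚ.* y) ℚ.* (z ℚ.* w) ≡ x ℚ.* (z ℚ.* (y ℚ.* w))
  xy∙zw≡x∙z∙yw = solve 4 (λ x y z w → (x :* y) :* (z :* w) := x :* (z :* (y :* w))) refl
  xy∙zw≡xz∙yw : ∀ x y z w → (x ℚ.* y) ℚ.* (z ℚ.* w) ≡ (x ℚ.* z) ℚ.* (y ℚ.* w)
  xy∙zw≡xz∙yw = solve 4 (λ x y z w → (x :* y) :* (z :* w) := (x :* z) :* (y :* w)) refl
  neg-square : ∀ x → (ℚ.- x) ℚ.* (ℚ.- x) ≡ x ℚ.* x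
  neg-square = solve 1 (λ x → (:- x) :* (:- x) := x :* x) refl
  split-false : ∀ s x y → s ℚ.* x ≡ (ℚ.- s) ℚ.* y ℚ.+ s ℚ.* (x ℚ.+ y)
  split-false = solve 3 (λ s x y → s :* x := (:- s) :* y :+ s :* (x :+ y)) refl
  split-true : ∀ t s x y → (ℚ.- t) ℚ.* ((ℚ.- s) ℚ.* y) ≡ (ℚ.- t) ℚ.* (s ℚ.* x) ℚ.+ t ℚ.* (s ℚ.* (x ℚ.+ y))
  split-true = solve 4 (λ t s x y → (:- t) :* ((:- s) :* y) := (:- t) :* (s :* x) :+ t :* (s :* (x :+ y))) refl

C-factorial : ∀ d a → ((d + a) C d) ℕ.* (d ! ℕ.* a !) ≡ (d + a) !
C-factorial d a = begin
  ((d + a) C d) ℕ.* (d ! ℕ.* a !)              ≡⟨ cong (λ k → ((d + a) C d) ℕ.* (d ! ℕ.* k !)) (ℕ.m+n∸m≡n d a) ⟨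
  ((d + a) C d) ℕ.* D
    ≡⟨ trans (cong (ℕ._* D) (nCk≡n!/k![n-k]! (ℕ.m≤m+n d a))) (m/n*n≡m {{ d ℕ.!* (d + a ∸ d) !≢0 }} (k![n∸k]!∣n! (ℕ.m≤m+n d a))) ⟩
  (d + a) !                                ∎
  where
  open ≡-Reasoning
  D = d ! ℕ.* (d + a ∸ d) !

C-nonZero : ∀ d a → NonZero ((d + a) C d)
C-nonZero d a = ≢-nonZero λ e → ≢-nonZero⁻¹ ((d + a) !) {{(d + a) ℕ.!≢0}}
  (trans (sym (C-factorial d a)) (cong (ℕ._* (d ! ℕ.* a !)) e))

factorial-split : ∀ d a x y → x ℕ.* (suc a ℕ.* y) + suc d ℕ.* x ℕ.* y ≡ x ℕ.* y ℕ.* suc (suc (d + a))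
factorial-split = solve 4 (λ d a x y →
  x :* ((con 1 :+ a) :* y) :+ (con 1 :+ d) :* x :* y := x :* y :* (con 2 :+ (d :+ a))) refl
  where open ℕ.+-*-Solver

-- The Beta integral ∫ t^d (1-t)^a dt.
beta : ℕ → ℕ → ℚ
beta d a = nat (d ! ℕ.* a !) ℚ.* recip (suc (d + a) !)

-- The left side is, up to sign, the coefficient in 𝛟_n / n of a ribbon with d descents, n = d + a +
-- 1.
beta-C : ∀ d a → recip (suc (d + a)) ℚ.* recip ((d + a) C d) ≡ beta d a
beta-C d a = begin
  recip (suc (d + a)) ℚ.* recip c                         ≡⟨ cong (recip (suc (d + a)) ℚ.*_) claim ⟨
  recip (suc (d + a)) ℚ.* (nat f ℚ.* recip ((d + a) !))   ≡⟨ x∙yz≡y∙xz (recip (suc (d + a))) (nat f) (recip ((d + a) !)) ⟩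
  nat f ℚ.* (recip (suc (d + a)) ℚ.* recip ((d + a) !))   ≡⟨ cong (nat f ℚ.*_) (recip-* (suc (d + a)) ((d + a) !)) ⟨
  beta d a                                        ∎
  where
  open ≡-Reasoning
  c = (d + a) C d
  f = d ! ℕ.* a !
  instance
    _ = C-nonZero d a
    _ = (d + a) ℕ.!≢0
  claim : nat f ℚ.* recip ((d + a) !) ≡ recip c
  claim = trans (recip-unique c (begin
    nat c ℚ.* (nat f ℚ.* recip ((d + a) !))  ≡⟨ ℚ.*-assoc (nat c) (nat f) _ ⟨
    (nat c ℚ.* nat f) ℚ.* recip ((d + a) !)  ≡⟨ cong (ℚ._* recip ((d + a) !)) (trans (sym (nat-* c f)) (cong nat (C-factorial d a))) ⟩
    nat ((d + a) !) ℚ.* recip ((d + a) !)    ≡⟨ nat-recip ((d + a) !) ⟩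
    1ℚ                                    ∎)) (ℚ.*-identityʳ (recip c))

-- Insert (1-t) + t = 1 into the integral of t^d (1-t)^a.
beta-split : ∀ d a → beta d (suc a) ℚ.+ beta (suc d) a ≡ beta d a
beta-split d a = begin
  nat (d ! ℕ.* suc a !) ℚ.* recip (suc (d + suc a) !) ℚ.+ nat (suc d ! ℕ.* a !) ℚ.* recip (suc n !)
    ≡⟨ cong (λ k → nat (d ! ℕ.* suc a !) ℚ.* recip (suc k !) ℚ.+ nat (suc d ! ℕ.* a !) ℚ.* recip (suc n !)) (ℕ.+-suc d a) ⟩
  nat (d ! ℕ.* suc a !) ℚ.* recip (suc n !) ℚ.+ nat (suc d ! ℕ.* a !) ℚ.* recip (suc n !)
    ≡⟨ ℚ.*-distribʳ-+ (recip (suc n !)) (nat (d ! ℕ.* suc a !)) (nat (suc d ! ℕ.* a !)) ⟨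
  (nat (d ! ℕ.* suc a !) ℚ.+ nat (suc d ! ℕ.* a !)) ℚ.* recip (suc n !)
    ≡⟨ cong (ℚ._* recip (suc n !)) (nat-+ (d ! ℕ.* suc a !) (suc d ! ℕ.* a !)) ⟨
  nat (d ! ℕ.* suc a ! + suc d ! ℕ.* a !) ℚ.* recip (suc n !)
    ≡⟨ cong (λ k → nat k ℚ.* recip (suc n !)) (factorial-split d a (d !) (a !)) ⟩
  nat (d ! ℕ.* a ! ℕ.* suc n) ℚ.* recip (suc n ℕ.* n !)
    ≡⟨ cong₂ ℚ._*_ (nat-* (d ! ℕ.* a !) (suc n)) (recip-* (suc n) (n !)) ⟩
  (nat (d ! ℕ.* a !) ℚ.* nat (suc n)) ℚ.* (recip (suc n) ℚ.* recip (n !))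
    ≡⟨ xy∙zw≡yz∙xw (nat (d ! ℕ.* a !)) (nat (suc n)) (recip (suc n)) (recip (n !)) ⟩
  (nat (suc n) ℚ.* recip (suc n)) ℚ.* (nat (d ! ℕ.* a !) ℚ.* recip (n !))
    ≡⟨ trans (cong (ℚ._* beta d a) (nat-recip (suc n))) (ℚ.*-identityˡ (beta d a)) ⟩
  beta d a ∎
  where
  open ≡-Reasoning
  n = suc (d + a)
  instance
    _ = n ℕ.!≢0

sign-* : ∀ n → sign n ℚ.* sign n ≡ 1ℚ
sign-* zero    = refl
sign-* (suc n) = trans (neg-square (sign n)) (sign-* n)

-- The weight of a part; s = false belongs to 𝐡 and s = true to 𝐞.
weight : Bool → ℕ → ℚ
weight false b = recip b
weight true  b = sign (b ∸ 1) ℚ.* recip b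

falses : Pattern → ℕ
falses p = trues (map not p)

trues+falses : ∀ p → trues p + falses p ≡ length p
trues+falses []          = refl
trues+falses (true ∷ p)  = cong suc (trues+falses p)
trues+falses (false ∷ p) = trans (ℕ.+-suc (trues p) (falses p)) (cong suc (trues+falses p))

-- The coefficient of the ribbon of `comp p` in 𝛟_n / n, where n = length p + 1, multiplied by
-- (-1)^(n-1) if `s` is `true`.
coefficient : Bool → Pattern → ℚ
coefficient s p = weight s (suc (length p)) ℚ.* (sign (trues p) ℚ.* recip (length p C trues p))

-- The integral of (-t)^d (1-t)^a for `false`, and of t^d (t-1)^a for `true`.
signed-beta : Bool → ℕ → ℕ → ℚ
signed-beta false d a = sign d ℚ.* beta d a
signed-beta true  d a = sign (d + a) ℚ.* (sign d ℚ.* beta d a)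

coefficient-beta : ∀ s p → coefficient s p ≡ signed-beta s (trues p) (falses p)
coefficient-beta s p = trans
  (cong (λ n → weight s (suc n) ℚ.* (sign (trues p) ℚ.* recip (n C trues p))) (sym (trues+falses p)))
  (go s (trues p) (falses p))
  where
  go : ∀ s d a → weight s (suc (d + a)) ℚ.* (sign d ℚ.* recip ((d + a) C d)) ≡ signed-beta s d a
  go false d a = trans
    (x∙yz≡y∙xz (recip (suc (d + a))) (sign d) (recip ((d + a) C d)))
    (cong (sign d ℚ.*_) (beta-C d a))
  go true d a = trans
    (xy∙zw≡x∙z∙yw (sign (d + a)) (recip (suc (d + a))) (sign d) (recip ((d + a) C d)))
    (cong (λ x → sign (d + a) ℚ.* (sign d ℚ.* x)) (beta-C d a))

-- Under the integrals these are 1-t = (-t) + 1 and t = (t-1) + 1.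
signed-beta-split : ∀ d a → (signed-beta false d (suc a) ≡ signed-beta false (suc d) a ℚ.+ signed-beta false d a)
                          × (signed-beta true (suc d) a ≡ signed-beta true d (suc a) ℚ.+ signed-beta true d a)
signed-beta-split d a =
    trans (split-false (sign d) (beta d (suc a)) (beta (suc d) a))
      (cong (λ b → signed-beta false (suc d) a ℚ.+ sign d ℚ.* b) (beta-split d a))
  , trans (split-true (sign (d + a)) (sign d) (beta d (suc a)) (beta (suc d) a))
      (cong₂ (λ k b → sign k ℚ.* (sign d ℚ.* beta d (suc a)) ℚ.+ sign (d + a) ℚ.* (sign d ℚ.* b)) (sym (ℕ.+-suc d a)) (beta-split d a))

trues-insert : ∀ u v → trues (u ++ true ∷ v) ≡ suc (trues (u ++ v)) × trues (u ++ false ∷ v) ≡ trues (u ++ v)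
trues-insert []          v = refl , refl
trues-insert (true ∷ u)  v = let (p , q) = trues-insert u v in cong suc p , cong suc q
trues-insert (false ∷ u) v = trues-insert u v

falses-insert : ∀ u v → falses (u ++ true ∷ v) ≡ falses (u ++ v) × falses (u ++ false ∷ v) ≡ suc (falses (u ++ v))
falses-insert []          v = refl , refl
falses-insert (false ∷ u) v = let (p , q) = falses-insert u v in cong suc p , cong suc q
falses-insert (true ∷ u)  v = falses-insert u v

-- By `coefficient-beta` only the numbers of letters `true` and `false` matter, so the letter may
-- stand anywhere.
coefficient-split : ∀ s u v → coefficient s (u ++ s ∷ v) ≡ coefficient s (u ++ not s ∷ v) ℚ.+ coefficient s (u ++ v)
coefficient-split s u v = go s
  where
  at-true : ∀ s → coefficient s (u ++ true ∷ v) ≡ signed-beta s (suc (trues (u ++ v))) (falses (u ++ v))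
  at-true s = trans (coefficient-beta s (u ++ true ∷ v)) (cong₂ (signed-beta s) (proj₁ (trues-insert u v)) (proj₁ (falses-insert u v)))
  at-false : ∀ s → coefficient s (u ++ false ∷ v) ≡ signed-beta s (trues (u ++ v)) (suc (falses (u ++ v)))
  at-false s = trans (coefficient-beta s (u ++ false ∷ v)) (cong₂ (signed-beta s) (proj₂ (trues-insert u v)) (proj₂ (falses-insert u v)))
  split = signed-beta-split (trues (u ++ v)) (falses (u ++ v))
  go : ∀ s → coefficient s (u ++ s ∷ v) ≡ coefficient s (u ++ not s ∷ v) ℚ.+ coefficient s (u ++ v)
  go false = trans (at-false false) (trans (proj₁ split) (sym (cong₂ ℚ._+_ (at-true false) (coefficient-beta false (u ++ v)))))
  go true  = trans (at-true true) (trans (proj₂ split) (sym (cong₂ ℚ._+_ (at-false true) (coefficient-beta true (u ++ v)))))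

-- With no descents or only descents the binomial coefficient is 1. For `true` the signs (-1)^m of
-- the weight and of the descents cancel, which is the purpose of the sign in `weight true`.
coefficient-replicate : ∀ s m → coefficient s (replicate m s) ≡ recip (suc m)
coefficient-replicate s m = go s
  where
  trues-false : ∀ m → trues (replicate m false) ≡ 0
  trues-false zero    = refl
  trues-false (suc m) = trues-false m
  trues-true : ∀ m → trues (replicate m true) ≡ m
  trues-true zero    = refl
  trues-true (suc m) = cong suc (trues-true m)
  at : ∀ s {d} → trues (replicate m s) ≡ d → m C d ≡ 1 →
       coefficient s (replicate m s) ≡ weight s (suc m) ℚ.* (sign d ℚ.* 1ℚ)
  at s refl e = trans
    (cong (λ n → weight s (suc n) ℚ.* (sign (trues (replicate m s)) ℚ.* recip (n C trues (replicate m s)))) (length-replicate m {s}))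
    (cong (λ c → weight s (suc m) ℚ.* (sign (trues (replicate m s)) ℚ.* c)) (trans (cong recip e) (recip-def 1)))
  go : ∀ s → coefficient s (replicate m s) ≡ recip (suc m)
  go false = trans (at false (trues-false m) (trans (nCk≡nC[n∸k] {0} {m} z≤n) (nCn≡1 m))) (ℚ.*-identityʳ (recip (suc m)))
  go true  = trans (at true (trues-true m) (nCn≡1 m))
    (trans (xy∙zw≡xz∙yw (sign m) (recip (suc m)) (sign m) 1ℚ)
      (trans (cong₂ ℚ._*_ (sign-* m) (ℚ.*-identityʳ (recip (suc m)))) (ℚ.*-identityˡ (recip (suc m)))))

-- Coefficients of products of noncommutative series.

module Words {c ℓ : Level} {{K : ℚ-Algebra c ℓ}} where

  open Sums {{K}}
  open Log {{K}}

  ⊛-[] : ∀ (f g : Series Word) → (f ⊛ g) [] ≈ f [] *ᴷ g []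
  ⊛-[] f g = +-identityʳ _

  ⊛-∷ : ∀ (f g : Series Word) i w → (f ⊛ g) (i ∷ w) ≈ f [] *ᴷ g (i ∷ w) +ᴷ ((f ∘ (i ∷_)) ⊛ g) w
  ⊛-∷ f g i w = +-congˡ (S-map (map₁ (i ∷_)) (splits w) (λ uv → f (proj₁ uv) *ᴷ g (proj₂ uv)))

  ⊛-cong : ∀ {f f′ g g′ : Series Word} → f ≋ f′ → g ≋ g′ → (f ⊛ g) ≋ (f′ ⊛ g′)
  ⊛-cong e e′ w = S-cong (splits w) (λ (u , v) → *-cong (e u) (e′ v))

  ⊛-⊕ˡ : ∀ (f f′ g : Series Word) w → ((f ⊕ f′) ⊛ g) w ≈ (f ⊛ g) w +ᴷ (f′ ⊛ g) w
  ⊛-⊕ˡ f f′ g w = ≈-trans (S-cong (splits w) (λ (u , v) → distribʳ (g v) (f u) (f′ u))) (S-+ (splits w) _ _)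

  ⊛-•ˡ : ∀ k (f g : Series Word) w → ((k • f) ⊛ g) w ≈ k *ᴷ (f ⊛ g) w
  ⊛-•ˡ k f g w = ≈-trans (S-cong (splits w) (λ (u , v) → *-assoc k (f u) (g v))) (≈-sym (S-*ˡ k (splits w) _))

  ⊛-•ʳ : ∀ k (f g : Series Word) w → (f ⊛ (k • g)) w ≈ k *ᴷ (f ⊛ g) w
  ⊛-•ʳ k f g w = ≈-trans
    (S-cong (splits w) (λ (u , v) → solve 3 (λ x k y → x :* (k :* y) := k :* (x :* y)) ≈-refl (f u) k (g v)))
    (≈-sym (S-*ˡ k (splits w) _))
    where open Solver

  ⊛-zeroˡ : ∀ {f g : Series Word} → (∀ u → f u ≈ 0#) → ∀ w → (f ⊛ g) w ≈ 0#
  ⊛-zeroˡ e w = S-zero (splits w) (λ (u , v) → ≈-trans (*-congʳ (e u)) (zeroˡ _))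

  ⊛-identityˡ : ∀ g → (one ⊛ g) ≋ g
  ⊛-identityˡ g []      = ≈-trans (⊛-[] one g) (*-identityˡ _)
  ⊛-identityˡ g (i ∷ w) = ≈-trans (⊛-∷ one g i w)
    (≈-trans (+-cong (*-identityˡ _) (⊛-zeroˡ (λ _ → ≈-refl) w)) (+-identityʳ _))

  ⊛-assoc : ∀ f g h → ((f ⊛ g) ⊛ h) ≋ (f ⊛ (g ⊛ h))
  ⊛-assoc f g h [] = begin
    ((f ⊛ g) ⊛ h) []            ≈⟨ ⊛-[] (f ⊛ g) h ⟩
    (f ⊛ g) [] *ᴷ h []          ≈⟨ *-congʳ (⊛-[] f g) ⟩
    (f [] *ᴷ g []) *ᴷ h []      ≈⟨ *-assoc _ _ _ ⟩
    f [] *ᴷ (g [] *ᴷ h [])      ≈⟨ *-congˡ (⊛-[] g h) ⟨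
    f [] *ᴷ (g ⊛ h) []          ≈⟨ ⊛-[] f (g ⊛ h) ⟨
    (f ⊛ (g ⊛ h)) []            ∎
  ⊛-assoc f g h (i ∷ w) = begin
    ((f ⊛ g) ⊛ h) (i ∷ w)
      ≈⟨ ⊛-∷ (f ⊛ g) h i w ⟩
    (f ⊛ g) [] *ᴷ h (i ∷ w) +ᴷ (((f ⊛ g) ∘ (i ∷_)) ⊛ h) w
      ≈⟨ +-cong (*-congʳ (⊛-[] f g)) (⊛-cong {g = h} (⊛-∷ f g i) (λ _ → ≈-refl) w) ⟩
    (f [] *ᴷ g []) *ᴷ h (i ∷ w) +ᴷ ((f [] • g′ ⊕ f′ ⊛ g) ⊛ h) w
      ≈⟨ +-congˡ (≈-trans (⊛-⊕ˡ (f [] • g′) (f′ ⊛ g) h w) (+-cong (⊛-•ˡ (f []) g′ h w) (⊛-assoc f′ g h w))) ⟩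
    (f [] *ᴷ g []) *ᴷ h (i ∷ w) +ᴷ (f [] *ᴷ (g′ ⊛ h) w +ᴷ (f′ ⊛ (g ⊛ h)) w)
      ≈⟨ solve 5 (λ a b c d e → (a :* b) :* c :+ (a :* d :+ e) := a :* (b :* c :+ d) :+ e) ≈-refl
           (f []) (g []) (h (i ∷ w)) ((g′ ⊛ h) w) ((f′ ⊛ (g ⊛ h)) w) ⟩
    f [] *ᴷ (g [] *ᴷ h (i ∷ w) +ᴷ (g′ ⊛ h) w) +ᴷ (f′ ⊛ (g ⊛ h)) w
      ≈⟨ +-congʳ (*-congˡ (⊛-∷ g h i w)) ⟨
    f [] *ᴷ (g ⊛ h) (i ∷ w) +ᴷ (f′ ⊛ (g ⊛ h)) w
      ≈⟨ ⊛-∷ f (g ⊛ h) i w ⟨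
    (f ⊛ (g ⊛ h)) (i ∷ w) ∎
    where
    open Solver
    f′ g′ : Series Word
    f′ = f ∘ (i ∷_)
    g′ = g ∘ (i ∷_)

  ⊛-S : ∀ {A B : Set} (as : List A) (bs : List B) (f : A → Series Word) (g : B → Series Word) w →
        ((λ u → S as (λ a → f a u)) ⊛ (λ v → S bs (λ b → g b v))) w ≈ S as (λ a → S bs (λ b → (f a ⊛ g b) w))
  ⊛-S []       bs f g w = ⊛-zeroˡ {g = λ v → S bs (λ b → g b v)} (λ _ → ≈-refl) w
  ⊛-S (a ∷ as) bs f g w = ≈-trans (⊛-⊕ˡ (f a) (λ u → S as (λ a → f a u)) (λ v → S bs (λ b → g b v)) w) (+-cong (right bs) (⊛-S as bs f g w))
    where
    right : ∀ bs → (f a ⊛ (λ v → S bs (λ b → g b v))) w ≈ S bs (λ b → (f a ⊛ g b) w)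
    right []       = S-zero (splits w) (λ _ → zeroʳ _)
    right (b ∷ bs) = ≈-trans (S-cong (splits w) (λ (u , v) → distribˡ (f a u) (g b v) _))
      (≈-trans (S-+ (splits w) _ _) (+-congˡ (right bs)))

  multiplicatively-++ : ∀ (G : ℕ⁺ → Series Word) α β → multiplicatively G (α ++ β) ≋ (multiplicatively G α ⊛ multiplicatively G β)
  multiplicatively-++ G []      β w = ≈-sym (⊛-identityˡ (multiplicatively G β) w)
  multiplicatively-++ G (a ∷ α) β w = ≈-trans
    (⊛-cong {f = G a} (λ _ → ≈-refl) (multiplicatively-++ G α β) w)
    (≈-sym (⊛-assoc (G a) (multiplicatively G α) (multiplicatively G β) w))

  -- The coefficient of x_{i₁}⋯x_{iₙ} in G_n depends on its descents only.
  Local : (ℕ⁺ → Series Word) → (Pattern → Carrier) → Set ℓ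
  Local G c = (∀ b → G b [] ≈ 0#)
            × (∀ n i u → G (1+ n) (i ∷ u) ≈ 𝟙 (length u ℕ.≟ n) *ᴷ c (descentPattern i u))

  -- The summand of cutSum for the cuts marked by the second pattern; 0 if the
  -- lengths differ.
  cutProduct : (Pattern → Carrier) → (Pattern → Carrier) → Pattern → Pattern → Carrier
  cutProduct c c₀ []      []          = c₀ []
  cutProduct c c₀ (x ∷ p) (true ∷ q)  = c₀ [] *ᴷ cutProduct c c p q
  cutProduct c c₀ (x ∷ p) (false ∷ q) = cutProduct c (c₀ ∘ (x ∷_)) p q
  cutProduct c c₀ []      (_ ∷ _)     = 0#
  cutProduct c c₀ (_ ∷ _) []          = 0#

  module _ {G : ℕ⁺ → Series Word} {c : Pattern → Carrier} (L : Local G c) where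

    multiplicatively-[] : ∀ a α → multiplicatively G (a ∷ α) [] ≈ 0#
    multiplicatively-[] a α = ≈-trans (⊛-[] (G a) (multiplicatively G α)) (≈-trans (*-congʳ (proj₁ L a)) (zeroˡ _))

    -- The first factor after its letters up to `i` have been read: `k` letters are still to come,
    -- and `c₀` remembers the pattern so far.
    piece : (Pattern → Carrier) → ℕ → ℕ⁺ → Series Word
    piece c₀ k i u = 𝟙 (length u ℕ.≟ k) *ᴷ c₀ (descentPattern i u)

    -- The part sizes dictate where the word is split, so at most one splitting contributes. Its
    -- boundaries are the letters `true` of `pattern-of k β`.
    multiplicatively-cutProduct : ∀ k β i w → multiplicatively G (1+ k ∷ β) (i ∷ w) ≈ cutProduct c c (descentPattern i w) (pattern-of k β)

    -- Reading one more letter either extends the first factor, which only changes `c₀`, or starts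
    -- the next factor; then the comparison of `i` with the new letter enters no weight.
    first-piece-cutProduct : ∀ c₀ k β i w → (piece c₀ k i ⊛ multiplicatively G β) w ≈ cutProduct c c₀ (descentPattern i w) (pattern-of k β)

    multiplicatively-cutProduct k β i w = begin
      (G (1+ k) ⊛ multiplicatively G β) (i ∷ w)
        ≈⟨ ⊛-∷ (G (1+ k)) (multiplicatively G β) i w ⟩
      G (1+ k) [] *ᴷ multiplicatively G β (i ∷ w) +ᴷ ((G (1+ k) ∘ (i ∷_)) ⊛ multiplicatively G β) w
        ≈⟨ +-cong (≈-trans (*-congʳ (proj₁ L (1+ k))) (zeroˡ _))
                  (⊛-cong {g = multiplicatively G β} (proj₂ L k i) (λ _ → ≈-refl) w) ⟩
      0# +ᴷ (piece c k i ⊛ multiplicatively G β) w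
        ≈⟨ ≈-trans (+-identityˡ _) (first-piece-cutProduct c k β i w) ⟩
      cutProduct c c (descentPattern i w) (pattern-of k β) ∎

    first-piece-cutProduct c₀ zero [] i [] = ≈-trans (⊛-[] (piece c₀ 0 i) one) (≈-trans (*-identityʳ _) (*-identityˡ _))
    first-piece-cutProduct c₀ zero (b ∷ β) i [] =
      ≈-trans (⊛-[] (piece c₀ 0 i) (multiplicatively G (b ∷ β))) (≈-trans (*-congˡ (multiplicatively-[] b β)) (zeroʳ _))
    first-piece-cutProduct c₀ (suc k) β i [] = ≈-trans (⊛-[] (piece c₀ (suc k) i) (multiplicatively G β)) (≈-trans (*-congʳ (zeroˡ _)) (zeroˡ _))
    first-piece-cutProduct c₀ zero β i (j ∷ w) = begin
      (piece c₀ 0 i ⊛ multiplicatively G β) (j ∷ w)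
        ≈⟨ ⊛-∷ _ (multiplicatively G β) j w ⟩
      (1# *ᴷ c₀ []) *ᴷ multiplicatively G β (j ∷ w) +ᴷ (_ ⊛ multiplicatively G β) w
        ≈⟨ +-cong (*-congʳ (*-identityˡ _)) (⊛-zeroˡ {g = multiplicatively G β} (λ u → zeroˡ (c₀ (descentPattern i (j ∷ u)))) w) ⟩
      c₀ [] *ᴷ multiplicatively G β (j ∷ w) +ᴷ 0#
        ≈⟨ +-identityʳ _ ⟩
      c₀ [] *ᴷ multiplicatively G β (j ∷ w)
        ≈⟨ next β ⟩
      cutProduct c c₀ (descentPattern i (j ∷ w)) (pattern-of zero β) ∎
      where
      next : ∀ β → c₀ [] *ᴷ multiplicatively G β (j ∷ w) ≈ cutProduct c c₀ (descentPattern i (j ∷ w)) (pattern-of zero β)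
      next []            = zeroʳ _
      next ((1+ k) ∷ β)  = *-congˡ (multiplicatively-cutProduct k β j w)
    first-piece-cutProduct c₀ (suc k) β i (j ∷ w) = begin
      (piece c₀ (suc k) i ⊛ multiplicatively G β) (j ∷ w)
        ≈⟨ ⊛-∷ _ (multiplicatively G β) j w ⟩
      (0# *ᴷ c₀ []) *ᴷ multiplicatively G β (j ∷ w)
        +ᴷ (piece (c₀ ∘ (does (i >⁺? j) ∷_)) k j ⊛ multiplicatively G β) w
        ≈⟨ +-congʳ (≈-trans (*-congʳ (zeroˡ _)) (zeroˡ _)) ⟩
      0# +ᴷ (piece (c₀ ∘ (does (i >⁺? j) ∷_)) k j ⊛ multiplicatively G β) w
        ≈⟨ +-identityˡ _ ⟩
      (piece (c₀ ∘ (does (i >⁺? j) ∷_)) k j ⊛ multiplicatively G β) w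
        ≈⟨ first-piece-cutProduct (c₀ ∘ (does (i >⁺? j) ∷_)) k β j w ⟩
      cutProduct c (c₀ ∘ (does (i >⁺? j) ∷_)) (descentPattern j w) (pattern-of k β) ∎

  S-patterns : ∀ n f → S (patterns (suc n)) f ≈ S (patterns n) (λ q → f (true ∷ q)) +ᴷ S (patterns n) (λ q → f (false ∷ q))
  S-patterns n f = ≈-trans (S-concatMap _ (patterns n) f)
    (≈-trans (S-cong (patterns n) (λ q → +-congˡ (+-identityʳ (f (false ∷ q))))) (S-+ (patterns n) _ _))

  -- The pattern `q` marks the cuts. Its `trues q` cuts make one piece more, in accordance with the
  -- weight g(k - 1) for k pieces.
  cutSum-as-sum : ∀ (g : Seq) c c₀ p → S (patterns (length p)) (λ q → g (trues q) *ᴷ cutProduct c c₀ p q) ≈ cutSum g c c₀ p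
  cutSum-as-sum g c c₀ []      = +-identityʳ _
  cutSum-as-sum g c c₀ (x ∷ p) = begin
    S (patterns (suc (length p))) (λ q → g (trues q) *ᴷ cutProduct c c₀ (x ∷ p) q)
      ≈⟨ S-patterns (length p) _ ⟩
    S (patterns (length p)) (λ q → g (suc (trues q)) *ᴷ (c₀ [] *ᴷ cutProduct c c p q))
      +ᴷ S (patterns (length p)) (λ q → g (trues q) *ᴷ cutProduct c (c₀ ∘ (x ∷_)) p q)
      ≈⟨ +-cong (≈-trans (S-cong (patterns (length p)) (λ q → solve 3 (λ x y z → x :* (y :* z) := y :* (x :* z)) ≈-refl (g (suc (trues q))) (c₀ []) (cutProduct c c p q)))
                         (≈-trans (≈-sym (S-*ˡ (c₀ []) (patterns (length p)) _)) (*-congˡ (cutSum-as-sum (g ∘ suc) c c p))))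
                (cutSum-as-sum g c (c₀ ∘ (x ∷_)) p) ⟩
    c₀ [] *ᴷ cutSum (g ∘ suc) c c p +ᴷ cutSum g c (c₀ ∘ (x ∷_)) p ∎
    where open Solver

  cutProduct-length : ∀ c c₀ p q → length p ≢ length q → cutProduct c c₀ p q ≈ 0#
  cutProduct-length c c₀ []      []          ne = contradiction refl ne
  cutProduct-length c c₀ (x ∷ p) (true ∷ q)  ne = ≈-trans (*-congˡ (cutProduct-length c c p q (ne ∘ cong suc))) (zeroʳ _)
  cutProduct-length c c₀ (x ∷ p) (false ∷ q) ne = cutProduct-length c (c₀ ∘ (x ∷_)) p q (ne ∘ cong suc)
  cutProduct-length c c₀ []      (_ ∷ _)     ne = ≈-refl
  cutProduct-length c c₀ (_ ∷ _) []          ne = ≈-refl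

  𝐫-descents : ∀ γ w → 𝐫 γ w ≈ 𝟙 (descentComposition w ≟ᶜ γ)
  𝐫-descents γ w = 𝟙-cong ((length w ℕ.≟ size γ) ×-dec ≡-dec ℕ._≟_ (descents w) (set γ)) (descentComposition w ≟ᶜ γ)
    (λ (le , se) → set-injective (descentComposition w) γ (trans (size-descentComposition w) le) (trans (set-descentComposition w) se))
    (λ { refl → sym (size-descentComposition w) , sym (set-descentComposition w) })

  -- A word occurs in exactly one ribbon, that of its descent composition, and this one is listed
  -- precisely if the word has length `n`.
  ribbon-sum : ∀ n (κ : Composition → Carrier) w →
               ∑ (compositions n) (λ γ → κ γ • 𝐫 γ) w ≈ 𝟙 (length w ℕ.≟ n) *ᴷ κ (descentComposition w)
  ribbon-sum n κ w = ≈-trans (∑-S (compositions n) _ w)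
    (≈-trans (S-cong (compositions n) (λ γ → *-congˡ (𝐫-descents γ w))) (go (length w ℕ.≟ n)))
    where
    go : (l? : Dec (length w ≡ n)) → S (compositions n) (λ γ → κ γ *ᴷ 𝟙 (descentComposition w ≟ᶜ γ)) ≈ 𝟙 l? *ᴷ κ (descentComposition w)
    go (yes refl) = ≈-trans
      (S-delta _≟ᶜ_ (compositions-unique n) (subst (λ m → descentComposition w ∈ compositions m) (size-descentComposition w) (∈-compositions (descentComposition w))) κ)
      (≈-sym (*-identityˡ _))
    go (no l≢n) = ≈-trans
      (S-zero∈ (compositions n) (λ {γ} γ∈ → ≈-trans (*-congˡ (𝟙-no (descentComposition w ≟ᶜ γ)
        (λ e → l≢n (trans (sym (size-descentComposition w)) (trans (cong size e) (compositions-size n γ∈)))))) (zeroʳ _)))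
      (≈-sym (zeroˡ _))

  linked-constantly : ∀ s {r} {_∼_ : Rel ℕ⁺ r} (_∼?_ : Binary.Decidable _∼_) →
                      (∀ i j → 𝟙 (i ∼? j) ≈ 𝟙 (does (i >⁺? j) Bool.≟ s)) →
                      ∀ i w → 𝟙 (linked? _∼?_ (i ∷ w)) ≈ constantly s (descentPattern i w)
  linked-constantly s _∼?_ e i []      = ≈-refl
  linked-constantly s _∼?_ e i (j ∷ w) = ≈-trans
    (𝟙-cong (linked? _∼?_ (i ∷ j ∷ w)) ((i ∼? j) ×-dec linked? _∼?_ (j ∷ w)) (λ { (r ∷ l) → r , l }) (λ (r , l) → r ∷ l))
    (≈-trans (𝟙-× (i ∼? j) (linked? _∼?_ (j ∷ w))) (*-cong (e i j) (linked-constantly s _∼?_ e j w)))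

  𝐠₁ : Bool → ℕ⁺ → Series Word
  𝐠₁ false = 𝐡₁
  𝐠₁ true  = 𝐞₁

  𝐠 : Bool → Composition → Series Word
  𝐠 s = multiplicatively (𝐠₁ s)

  𝐠₁-local : ∀ s → Local (𝐠₁ s) (constantly s)
  𝐠₁-local false = (λ _ → ≈-refl) , λ n i u → ≈-trans (𝟙-× (length (i ∷ u) ℕ.≟ suc n) (linked? _≤⁺?_ (i ∷ u)))
    (*-congˡ (linked-constantly false _≤⁺?_ agree i u))
    where
    agree : ∀ i j → 𝟙 (i ≤⁺? j) ≈ 𝟙 (does (i >⁺? j) Bool.≟ false)
    agree i j = 𝟙-cong (i ≤⁺? j) (does (i >⁺? j) Bool.≟ false)
      (λ i≤j → dec-false (i >⁺? j) (ℕ.≤⇒≯ i≤j))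
      (λ e → ℕ.≮⇒≥ (λ lt → contradiction (trans (sym (dec-true (i >⁺? j) lt)) e) λ ()))
  𝐠₁-local true = (λ _ → ≈-refl) , λ n i u → ≈-trans (𝟙-× (length (i ∷ u) ℕ.≟ suc n) (linked? _>⁺?_ (i ∷ u)))
    (*-congˡ (linked-constantly true _>⁺?_ agree i u))
    where
    agree : ∀ i j → 𝟙 (i >⁺? j) ≈ 𝟙 (does (i >⁺? j) Bool.≟ true)
    agree i j with does (i >⁺? j)
    ... | true  = ≈-refl
    ... | false = ≈-refl

  weighted-𝛟₁ : Bool → ℕ⁺ → Series Word
  weighted-𝛟₁ s b = ι (weight s (value b)) • 𝛟₁ b

  weighted-𝛟₁-local : ∀ s → Local (weighted-𝛟₁ s) (λ p → ι (coefficient s p))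
  weighted-𝛟₁-local s =
      (λ b → ≈-trans (*-congˡ (≈-trans (ribbon-sum (value b) _ []) (zeroˡ _))) (zeroʳ _))
    , λ n i u → begin
        ι (weight s (suc n)) *ᴷ 𝛟₁ (1+ n) (i ∷ u)
          ≈⟨ *-congˡ (ribbon-sum (suc n) _ (i ∷ u)) ⟩
        ι (weight s (suc n)) *ᴷ (𝟙 (length u ℕ.≟ n) *ᴷ ι (κ n (descentPattern i u)))
          ≈⟨ solve 3 (λ x y z → x :* (y :* z) := y :* (x :* z)) ≈-refl (ι (weight s (suc n))) (𝟙 (length u ℕ.≟ n)) (ι (κ n (descentPattern i u))) ⟩
        𝟙 (length u ℕ.≟ n) *ᴷ (ι (weight s (suc n)) *ᴷ ι (κ n (descentPattern i u)))
          ≈⟨ 𝟙-guard (length u ℕ.≟ n) (λ { refl → ≈-trans (≈-sym (ι-* _ _)) (≈-reflexive (cong ι (identify i u))) }) ⟩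
        𝟙 (length u ℕ.≟ n) *ᴷ ι (coefficient s (descentPattern i u)) ∎
    where
    open Solver
    κ : ℕ → Pattern → ℚ
    κ n p = sign (length (otherParts p)) ℚ.* 1/ (n C length (otherParts p))
    identify : ∀ i u → weight s (suc (length u)) ℚ.* κ (length u) (descentPattern i u) ≡ coefficient s (descentPattern i u)
    identify i u = trans (cong (λ r → weight s (suc (length u)) ℚ.* (sign (length (otherParts (descentPattern i u))) ℚ.* r)) (sym (recip-def _)))
     $ cong₂ (λ n d → weight s (suc n) ℚ.* (sign d ℚ.* recip (n C d))) (sym (length-descentPattern i u)) (length-otherParts (descentPattern i u))

-- Enumerating walls by shape and by type.

toRow : Pattern → Row
toRow p = 1+ firstPart p ∷⁺ otherParts p

rows : ℕ⁺ → List Row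
rows (1+ n) = map toRow (patterns n)

rowSum : Row → ℕ⁺
rowSum = foldr₁ _+⁺_

value-rowSum : ∀ b β → value (rowSum (b ∷⁺ β)) ≡ size (b ∷ β)
value-rowSum b []      = sym (ℕ.+-identityʳ (value b))
value-rowSum b (c ∷ β) = cong (value b +_) (value-rowSum c β)

value-injective : ∀ {a b} → value a ≡ value b → a ≡ b
value-injective refl = refl

toRow-pattern : ∀ k β → toRow (pattern-of k β) ≡ 1+ k ∷⁺ β
toRow-pattern k β = let (e , e′) = ∷-injective (comp-pattern k β) in cong₂ _∷⁺_ e e′

∈-rows : ∀ row → row ∈ rows (rowSum row)
∈-rows ((1+ k) ∷⁺ β) = subst (_∈ rows a) (toRow-pattern k β) (∈-map⁺ toRow (subst (λ n → p ∈ patterns n) eq (∈-patterns p)))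
  where
  p = pattern-of k β
  a = rowSum (1+ k ∷⁺ β)
  eq : length p ≡ ℕ⁺.pred a
  eq = ℕ.suc-injective (trans (sym (size-comp p)) (trans (cong size (comp-pattern k β)) (sym (value-rowSum (1+ k) β))))

rows-sum : ∀ a {row} → row ∈ rows a → rowSum row ≡ a
rows-sum (1+ n) row∈ with p , p∈ , refl ← ∈-map⁻ toRow row∈ =
  value-injective (trans (value-rowSum (1+ firstPart p) (otherParts p)) (trans (size-comp p) (cong suc (patterns-length n p∈))))

rows-unique : ∀ a → Unique (rows a)
rows-unique (1+ n) = Unique.map⁺ (λ e → comp-injective (cong toList e)) (patterns-unique n)

-- A second enumeration of the walls that `IW-sh` obtains by filtering. Built row by row, it lets
-- sums over walls factor into sums over rows.
wallsOfShape : Composition → List Wall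
wallsOfShape []      = [ [] ]
wallsOfShape (a ∷ α) = concatMap (λ row → map (row ∷_) (wallsOfShape α)) (rows a)

wallsOfShape-unique : ∀ α → Unique (wallsOfShape α)
wallsOfShape-unique []      = [] ∷ []
wallsOfShape-unique (a ∷ α) = concatMap-unique (λ row → map (row ∷_) (wallsOfShape α)) bottom bottom-row
  (λ row → Unique.map⁺ ∷-injectiveʳ (wallsOfShape-unique α)) (rows-unique a)
  where
  bottom : Wall → Row
  bottom []        = [ 1+ 0 ]⁺
  bottom (row ∷ _) = row
  bottom-row : ∀ row {W} → W ∈ map (row ∷_) (wallsOfShape α) → bottom W ≡ row
  bottom-row row W∈ with _ , _ , refl ← ∈-map⁻ (row ∷_) W∈ = refl

∈-wallsOfShape : ∀ W → W ∈ wallsOfShape (sh W)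
∈-wallsOfShape []        = here refl
∈-wallsOfShape (row ∷ W) = ∈-concatMap-intro (λ r → map (r ∷_) (wallsOfShape (sh W))) (∈-rows row) (∈-map⁺ (row ∷_) (∈-wallsOfShape W))

wallsOfShape-sh : ∀ α {W} → W ∈ wallsOfShape α → sh W ≡ α
wallsOfShape-sh []      (here refl) = refl
wallsOfShape-sh (a ∷ α) W∈ with row , row∈ , W∈′ ← ∈-concatMap-elim (λ r → map (r ∷_) (wallsOfShape α)) {rows a} W∈
                            with _ , V∈ , refl ← ∈-map⁻ (row ∷_) W∈′ = cong₂ _∷_ (rows-sum a row∈) (wallsOfShape-sh α V∈)

-- Recovers the wall from which `wallsOfType` built the given one, as `concatMap-unique` demands.
removeBrick : Wall → Wall
removeBrick []                    = []
removeBrick ((_ ∷⁺ []) ∷ W)       = W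
removeBrick ((_ ∷⁺ (b ∷ β)) ∷ W)  = (b ∷⁺ β) ∷ W

wallsOfType-unique : ∀ β → Unique (wallsOfType β)
wallsOfType-unique []      = [] ∷ []
wallsOfType-unique (b ∷ β) = concatMap-unique _ removeBrick
  (λ { []      (here refl)         → refl
     ; (_ ∷ _) (here refl)         → refl
     ; (_ ∷ _) (there (here refl)) → refl })
  (λ { []      → [] ∷ []
     ; (_ ∷ _) → ((λ ()) ∷ []) ∷ [] ∷ [] })
  (wallsOfType-unique β)

∈-wallsOfType : ∀ β W → type W ≡ β → W ∈ wallsOfType β
∈-wallsOfType []      []                    e = here refl
∈-wallsOfType (b ∷ β) ((_ ∷⁺ []) ∷ [])      e with refl ← ∷-injectiveˡ e =
  ∈-concatMap-intro _ (∈-wallsOfType β [] (∷-injectiveʳ e)) (here refl)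
∈-wallsOfType (b ∷ β) ((_ ∷⁺ []) ∷ row ∷ W) e with refl ← ∷-injectiveˡ e =
  ∈-concatMap-intro _ (∈-wallsOfType β (row ∷ W) (∷-injectiveʳ e)) (here refl)
∈-wallsOfType (b ∷ β) ((_ ∷⁺ (c ∷ γ)) ∷ W)  e with refl ← ∷-injectiveˡ e =
  ∈-concatMap-intro _ (∈-wallsOfType β ((c ∷⁺ γ) ∷ W) (∷-injectiveʳ e)) (there (here refl))

wallsOfType-type : ∀ β {W} → W ∈ wallsOfType β → type W ≡ β
wallsOfType-type []      (here refl) = refl
wallsOfType-type (b ∷ β) W∈ with ∈-concatMap-elim _ {wallsOfType β} W∈
... | []      , V∈ , here refl         = cong (b ∷_) (wallsOfType-type β V∈)
... | (_ ∷ _) , V∈ , here refl         = cong (b ∷_) (wallsOfType-type β V∈)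
... | (_ ∷ _) , V∈ , there (here refl) = cong (b ∷_) (wallsOfType-type β V∈)

allWalls : ℕ → List Wall
allWalls n = concatMap wallsOfType (compositions n)

allWalls-unique : ∀ n → Unique (allWalls n)
allWalls-unique n = concatMap-unique wallsOfType type wallsOfType-type wallsOfType-unique (compositions-unique n)

∈-allWalls : ∀ W → W ∈ allWalls (size (type W))
∈-allWalls W = ∈-concatMap-intro wallsOfType (∈-compositions (type W)) (∈-wallsOfType (type W) W refl)

size-++ : ∀ α β → size (α ++ β) ≡ size α + size β
size-++ α β = trans (cong sum (map-++ value α β)) (sum-++ (map value α) (map value β))

size-sh : ∀ W → size (sh W) ≡ size (type W)
size-sh []                = refl
size-sh ((b ∷⁺ β) ∷ W) = trans (cong₂ _+_ (value-rowSum b β) (size-sh W)) (sym (size-++ (b ∷ β) (type W)))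

-- Both lists are free of duplicates, so membership decides. A wall of shape `α` occurs among all
-- walls with |α| cells because its shape and type have the same size.
filter-sh-↭ : ∀ α → filter (λ W → sh W ≟ᶜ α) (allWalls (size α)) ↭ wallsOfShape α
filter-sh-↭ α = unique-sets-↭ (Unique.filter⁺ (λ W → sh W ≟ᶜ α) (allWalls-unique (size α))) (wallsOfShape-unique α)
  (λ {W} W∈ → subst (λ β → W ∈ wallsOfShape β) (proj₂ (∈-filter⁻ (λ W → sh W ≟ᶜ α) {xs = allWalls (size α)} W∈)) (∈-wallsOfShape W))
  (λ {W} W∈ → let e = wallsOfShape-sh α W∈ in
    ∈-filter⁺ (λ W → sh W ≟ᶜ α) (subst (λ n → W ∈ allWalls n) (trans (sym (size-sh W)) (cong size e)) (∈-allWalls W)) e)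

-- Signs and reciprocals attached to the type of a wall.

fb-nonZero : ∀ W → NonZero (fb W)
fb-nonZero []        = _
fb-nonZero (row ∷ W) = ℕ.m*n≢0 (length⁺ row !) (fb W) {{length⁺ row ℕ.!≢0}} {{fb-nonZero W}}

parts-product : Composition → ℕ
parts-product β = product (map value β)

parts-product-nonZero : ∀ β → NonZero (parts-product β)
parts-product-nonZero []      = _
parts-product-nonZero (b ∷ β) = ℕ.m*n≢0 (value b) (parts-product β) {{_}} {{parts-product-nonZero β}}

weights : Bool → Composition → ℚ
weights s []      = 1ℚ
weights s (b ∷ β) = weight s (value b) ℚ.* weights s β

parity : Bool → ℕ → ℚ
parity false n = 1ℚ
parity true  n = sign n

sign-+ : ∀ m n → sign (m + n) ≡ sign m ℚ.* sign n
sign-+ zero    n = sym (ℚ.*-identityˡ (sign n))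
sign-+ (suc m) n = trans (cong ℚ.-_ (sign-+ m n)) (ℚ.neg-distribˡ-* (sign m) (sign n))

length≤size : ∀ β → length β ≤ size β
length≤size []      = z≤n
length≤size (b ∷ β) = s≤s (ℕ.≤-trans (length≤size β) (ℕ.m≤n+m (size β) (ℕ⁺.pred b)))

weights-parity : ∀ s β → weights s β ≡ parity s (size β ∸ length β) ℚ.* recip (parts-product β)
weights-parity false []      = trans (sym (recip-def 1)) (sym (ℚ.*-identityˡ _))
weights-parity true  []      = trans (sym (recip-def 1)) (sym (ℚ.*-identityˡ _))
weights-parity false (b ∷ β) = trans (cong (recip (value b) ℚ.*_) (trans (weights-parity false β) (ℚ.*-identityˡ _)))
  (trans (sym (recip-* (value b) (parts-product β) {{_}} {{parts-product-nonZero β}})) (sym (ℚ.*-identityˡ _)))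
weights-parity true ((1+ k) ∷ β) = trans (cong (sign k ℚ.* recip (suc k) ℚ.*_) (weights-parity true β))
  (trans (xy∙zw≡xz∙yw (sign k) (recip (suc k)) (sign e) (recip (parts-product β)))
    (cong₂ ℚ._*_
      -- The part k + 1 adds k + 1 to the size and 1 to the length; `length≤size` keeps the
      -- truncated subtraction exact.
      (trans (sym (sign-+ k e)) (cong sign (sym (ℕ.+-∸-assoc k (length≤size β)))))
      (sym (recip-* (suc k) (parts-product β) {{_}} {{parts-product-nonZero β}}))))
  where e = size β ∸ length β

-- Unlabelled walls of a given shape.

module ShapeSum {c ℓ : Level} {{K : ℚ-Algebra c ℓ}} where

  open Sums {{K}}
  open Log {{K}}
  open Words {{K}}

  weighted-𝛟 : Bool → Composition → Series Word
  weighted-𝛟 s = multiplicatively (weighted-𝛟₁ s)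

  weighted-𝛟-weights : ∀ s β w → weighted-𝛟 s β w ≈ ι (weights s β) *ᴷ 𝛟 β w
  weighted-𝛟-weights s []      w = ≈-sym (≈-trans (*-congʳ ι-1) (*-identityˡ _))
  weighted-𝛟-weights s (b ∷ β) w = begin
    ((ι (weight s (value b)) • 𝛟₁ b) ⊛ weighted-𝛟 s β) w
      ≈⟨ ⊛-cong {f = ι (weight s (value b)) • 𝛟₁ b} (λ _ → ≈-refl) (weighted-𝛟-weights s β) w ⟩
    ((ι (weight s (value b)) • 𝛟₁ b) ⊛ (ι (weights s β) • 𝛟 β)) w
      ≈⟨ ≈-trans (⊛-•ˡ _ (𝛟₁ b) (ι (weights s β) • 𝛟 β) w) (*-congˡ (⊛-•ʳ (ι (weights s β)) (𝛟₁ b) (𝛟 β) w)) ⟩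
    ι (weight s (value b)) *ᴷ (ι (weights s β) *ᴷ 𝛟 (b ∷ β) w)
      ≈⟨ *-assoc _ _ _ ⟨
    (ι (weight s (value b)) *ᴷ ι (weights s β)) *ᴷ 𝛟 (b ∷ β) w
      ≈⟨ *-congʳ (ι-* (weight s (value b)) (weights s β)) ⟨
    ι (weights s (b ∷ β)) *ᴷ 𝛟 (b ∷ β) w ∎

  -- The bricks of a row of length n + 1 are the pieces of a cut of n letters, and 1/ℓ! is their
  -- weight. At words of length n + 1 this is the cut sum of their descent pattern; at all other
  -- words both sides vanish.
  row-sum : ∀ s a w → S (rows a) (λ row → invFactorial (length⁺ row) *ᴷ weighted-𝛟 s (toList row) w) ≈ 𝐠₁ s a w
  row-sum s (1+ n) w = ≈-trans (S-map toRow (patterns n) _) (go w)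
    where
    c₀ : Pattern → Carrier
    c₀ p = ι (coefficient s p)
    local : Local (weighted-𝛟₁ s) c₀
    local = weighted-𝛟₁-local s
    go : ∀ w → S (patterns n) (λ q → invFactorial (suc (length (otherParts q))) *ᴷ weighted-𝛟 s (comp q) w) ≈ 𝐠₁ s (1+ n) w
    go [] = ≈-trans (S-zero (patterns n) (λ q → ≈-trans (*-congˡ (multiplicatively-[] {c = c₀} local (1+ firstPart q) (otherParts q))) (zeroʳ _)))
              (≈-sym (proj₁ (𝐠₁-local s) (1+ n)))
    go (i ∷ u) = begin
      S (patterns n) (λ q → invFactorial (suc (length (otherParts q))) *ᴷ weighted-𝛟 s (comp q) (i ∷ u))
        ≈⟨ S-cong (patterns n) (λ q → *-cong (≈-reflexive (cong (invFactorial ∘ suc) (length-otherParts q)))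
             (≈-trans (multiplicatively-cutProduct local (firstPart q) (otherParts q) i u) (≈-reflexive (cong (cutProduct c₀ c₀ p) (pattern-comp q))))) ⟩
      S (patterns n) (λ q → invFactorial (suc (trues q)) *ᴷ cutProduct c₀ c₀ p q)
        ≈⟨ by-length (length u ℕ.≟ n) ⟩
      𝟙 (length u ℕ.≟ n) *ᴷ constantly s p
        ≈⟨ proj₂ (𝐠₁-local s) n i u ⟨
      𝐠₁ s (1+ n) (i ∷ u) ∎
      where
      p = descentPattern i u
      by-length : (l? : Dec (length u ≡ n)) → S (patterns n) (λ q → invFactorial (suc (trues q)) *ᴷ cutProduct c₀ c₀ p q) ≈ 𝟙 l? *ᴷ constantly s p
      by-length (yes refl) = begin
        S (patterns (length u)) (λ q → invFactorial (suc (trues q)) *ᴷ cutProduct c₀ c₀ p q)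
          ≈⟨ ≈-reflexive (cong (λ m → S (patterns m) (λ q → invFactorial (suc (trues q)) *ᴷ cutProduct c₀ c₀ p q)) (sym (length-descentPattern i u))) ⟩
        S (patterns (length p)) (λ q → invFactorial (suc (trues q)) *ᴷ cutProduct c₀ c₀ p q)
          ≈⟨ cutSum-as-sum (invFactorial ∘ suc) c₀ c₀ p ⟩
        cutSum (invFactorial ∘ suc) c₀ c₀ p
          ≈⟨ cutSum-constantly s (λ u v → ≈-trans (≈-reflexive (cong ι (coefficient-split s u v))) (ι-+ _ _))
                            (λ m → ≈-reflexive (cong ι (coefficient-replicate s m))) p ⟩
        constantly s p
          ≈⟨ *-identityˡ _ ⟨
        1# *ᴷ constantly s p ∎
      by-length (no l≢n) = ≈-trans
        (S-zero∈ (patterns n) (λ {q} q∈ → ≈-trans (*-congˡ (cutProduct-length c₀ c₀ p q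
          (λ e → l≢n (trans (sym (length-descentPattern i u)) (trans e (patterns-length n q∈)))))) (zeroʳ _)))
        (≈-sym (zeroˡ _))

  -- The rows of a wall are chosen independently, `fb` is multiplicative over them and the type is
  -- their concatenation, so the sum is the product of the row sums.
  shape-sum : ∀ s α w → S (wallsOfShape α) (λ W → ι (recip (fb W)) *ᴷ weighted-𝛟 s (type W) w) ≈ 𝐠 s α w
  shape-sum s []      w = ≈-trans (+-identityʳ _) (≈-trans (*-congʳ (≈-trans (≈-reflexive (cong ι (recip-def 1))) ι-1)) (*-identityˡ _))
  shape-sum s (a ∷ α) w = begin
    S (wallsOfShape (a ∷ α)) (λ W → ι (recip (fb W)) *ᴷ weighted-𝛟 s (type W) w)
      ≈⟨ ≈-trans (S-concatMap (λ row → map (row ∷_) (wallsOfShape α)) (rows a) _) (S-cong (rows a) (λ row → S-map (row ∷_) (wallsOfShape α) _)) ⟩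
    S (rows a) (λ row → S (wallsOfShape α) (λ W → ι (recip (fb (row ∷ W))) *ᴷ weighted-𝛟 s (toList row ++ type W) w))
      ≈⟨ S-cong (rows a) (λ row → S-cong (wallsOfShape α) (split row)) ⟩
    S (rows a) (λ row → S (wallsOfShape α) (λ W → (f row ⊛ g W) w))
      ≈⟨ ⊛-S (rows a) (wallsOfShape α) f g w ⟨
    ((λ u → S (rows a) (λ row → f row u)) ⊛ (λ v → S (wallsOfShape α) (λ W → g W v))) w
      ≈⟨ ⊛-cong (row-sum s a) (shape-sum s α) w ⟩
    𝐠 s (a ∷ α) w ∎
    where
    f : Row → Series Word
    f row = invFactorial (length⁺ row) • weighted-𝛟 s (toList row)
    g : Wall → Series Word
    g W = ι (recip (fb W)) • weighted-𝛟 s (type W)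
    split : ∀ row W → ι (recip (fb (row ∷ W))) *ᴷ weighted-𝛟 s (toList row ++ type W) w ≈ (f row ⊛ g W) w
    split row W = begin
      ι (recip (fb (row ∷ W))) *ᴷ weighted-𝛟 s (toList row ++ type W) w
        ≈⟨ *-cong (≈-trans (≈-reflexive (cong ι (recip-* (length⁺ row !) (fb W) {{length⁺ row ℕ.!≢0}} {{fb-nonZero W}}))) (ι-* _ _))
                  (multiplicatively-++ (weighted-𝛟₁ s) (toList row) (type W) w) ⟩
      (invFactorial (length⁺ row) *ᴷ ι (recip (fb W))) *ᴷ (weighted-𝛟 s (toList row) ⊛ weighted-𝛟 s (type W)) w
        ≈⟨ *-assoc _ _ _ ⟩
      invFactorial (length⁺ row) *ᴷ (ι (recip (fb W)) *ᴷ (weighted-𝛟 s (toList row) ⊛ weighted-𝛟 s (type W)) w)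
        ≈⟨ *-congˡ (⊛-•ʳ (ι (recip (fb W))) (weighted-𝛟 s (toList row)) (weighted-𝛟 s (type W)) w) ⟨
      invFactorial (length⁺ row) *ᴷ (weighted-𝛟 s (toList row) ⊛ g W) w
        ≈⟨ ⊛-•ˡ (invFactorial (length⁺ row)) (weighted-𝛟 s (toList row)) (g W) w ⟨
      (f row ⊛ g W) w ∎

-- Counting the indexings of a list of bricks.

module _ {A : Set} where

  count : {P : A → Set} → Decidable P → List A → ℕ
  count P? xs = length (filter P? xs)

  count-mono : ∀ {P Q : A → Set} (P? : Decidable P) (Q? : Decidable Q) → (∀ x → P x → Q x) → ∀ xs → count P? xs ≤ count Q? xs
  count-mono P? Q? f []       = z≤n
  count-mono P? Q? f (x ∷ xs) with P? x | Q? x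
  ... | yes _ | yes _ = s≤s (count-mono P? Q? f xs)
  ... | yes p | no ¬q = contradiction (f x p) ¬q
  ... | no _  | yes _ = ℕ.m≤n⇒m≤1+n (count-mono P? Q? f xs)
  ... | no _  | no _  = count-mono P? Q? f xs

  count-cong : ∀ {P Q : A → Set} (P? : Decidable P) (Q? : Decidable Q) → (∀ x → P x → Q x) → (∀ x → Q x → P x) → ∀ xs → count P? xs ≡ count Q? xs
  count-cong P? Q? f g xs = ℕ.≤-antisym (count-mono P? Q? f xs) (count-mono Q? P? g xs)

  count-mono-< : ∀ {P Q : A → Set} (P? : Decidable P) (Q? : Decidable Q) → (∀ x → P x → Q x) →
                 ∀ {x xs} → x ∈ xs → Q x → ¬ P x → count P? xs < count Q? xs
  count-mono-< P? Q? f {x} {y ∷ xs} (here refl) q ¬p with P? x | Q? x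
  ... | yes p | _     = contradiction p ¬p
  ... | no _  | no ¬q = contradiction q ¬q
  ... | no _  | yes _ = s≤s (count-mono P? Q? f xs)
  count-mono-< P? Q? f {x} {y ∷ xs} (there x∈) q ¬p with P? y | Q? y
  ... | yes _ | yes _ = s≤s (count-mono-< P? Q? f x∈ q ¬p)
  ... | yes p | no ¬q = contradiction (f y p) ¬q
  ... | no _  | yes _ = ℕ.m≤n⇒m≤1+n (count-mono-< P? Q? f x∈ q ¬p)
  ... | no _  | no _  = count-mono-< P? Q? f x∈ q ¬p

  count-disjoint : ∀ {P Q R : A → Set} (P? : Decidable P) (Q? : Decidable Q) (R? : Decidable R) →
                   (∀ x → R x → P x ⊎ Q x) → (∀ x → P x → R x) → (∀ x → Q x → R x) → (∀ x → P x → ¬ Q x) →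
                   ∀ xs → count R? xs ≡ count P? xs + count Q? xs
  count-disjoint P? Q? R? f g h d []       = refl
  count-disjoint P? Q? R? f g h d (x ∷ xs) with P? x | Q? x | R? x
  ... | yes p | yes q | _     = contradiction q (d x p)
  ... | yes p | no _  | yes _ = cong suc (count-disjoint P? Q? R? f g h d xs)
  ... | yes p | no _  | no ¬r = contradiction (g x p) ¬r
  ... | no _  | yes q | yes _ = trans (cong suc (count-disjoint P? Q? R? f g h d xs)) (sym (ℕ.+-suc _ _))
  ... | no _  | yes q | no ¬r = contradiction (h x q) ¬r
  ... | no ¬p | no ¬q | yes r = contradiction (f x r) [ ¬p , ¬q ]′
  ... | no _  | no _  | no _  = count-disjoint P? Q? R? f g h d xs

  count-none : ∀ {P : A → Set} (P? : Decidable P) xs → (∀ {x} → x ∈ xs → ¬ P x) → count P? xs ≡ 0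
  count-none P? []       ¬P = refl
  count-none P? (x ∷ xs) ¬P with P? x
  ... | yes p = contradiction p (¬P (here refl))
  ... | no _  = count-none P? xs (¬P ∘ there)

count-map : ∀ {A B : Set} {P : B → Set} (P? : Decidable P) (f : A → B) xs → count P? (map f xs) ≡ count (P? ∘ f) xs
count-map P? f []       = refl
count-map P? f (x ∷ xs) with P? (f x)
... | yes _ = cong suc (count-map P? f xs)
... | no _  = count-map P? f xs

allFin-suc : ∀ n → allFin (suc n) ≡ zero ∷ map suc (allFin n)
allFin-suc n = cong (zero ∷_) (sym (map-tabulate (λ i → i) suc))

count-toℕ< : ∀ n t → t ≤ n → count (λ (k : Fin n) → toℕ k ℕ.<? t) (allFin n) ≡ t
count-toℕ< n       zero    _         = count-none _ (allFin n) (λ _ ())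
count-toℕ< (suc n) (suc t) (s≤s t≤n) = trans (cong (count (λ k → toℕ k ℕ.<? suc t)) (allFin-suc n))
  (cong suc (trans (count-map (λ k → toℕ k ℕ.<? suc t) suc (allFin n))
    (trans (count-cong _ (λ k → toℕ k ℕ.<? t) (λ _ → ℕ.≤-pred) (λ _ → s≤s) (allFin n)) (count-toℕ< n t t≤n))))

allVectors-unique : ∀ m n → Unique (allVectors m n)
allVectors-unique m zero    = [] ∷ []
allVectors-unique m (suc n) = concatMap-unique (λ i → map (i ∷ᵛ_) (allVectors m n)) Vec.head
  (λ i v∈ → let (_ , _ , e) = ∈-map⁻ (i ∷ᵛ_) v∈ in cong Vec.head e)
  (λ i → Unique.map⁺ (cong Vec.tail) (allVectors-unique m n)) (Unique.allFin⁺ m)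

∈-allVectors : ∀ {m n} (v : Vec (Fin m) n) → v ∈ allVectors m n
∈-allVectors []ᵛ      = here refl
∈-allVectors (i ∷ᵛ v) = ∈-concatMap-intro (λ i → map (i ∷ᵛ_) (allVectors _ _)) (∈-allFin i) (∈-map⁺ (i ∷ᵛ_) (∈-allVectors v))

indexings-unique : ∀ β → Unique (indexings β)
indexings-unique β = Unique.filter⁺ (isIndexing? β) (allVectors-unique (length β) (length β))

-- An indexing is a bijection, so exactly t bricks carry a label below t.
count-labels< : ∀ β (σ : Labels β) → IsIndexing β σ → ∀ t → t ≤ length β →
                count (λ j → toℕ (lookupᵛ σ j) ℕ.<? t) (allFin (length β)) ≡ t
count-labels< β σ (inj , surj , _) t t≤n = begin
  count (λ j → toℕ (lookupᵛ σ j) ℕ.<? t) (allFin n)         ≡⟨ count-map (λ k → toℕ k ℕ.<? t) (lookupᵛ σ) (allFin n) ⟨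
  count (λ k → toℕ k ℕ.<? t) (map (lookupᵛ σ) (allFin n))   ≡⟨ ↭-length (filter-↭ (λ k → toℕ k ℕ.<? t) permuted) ⟩
  count (λ k → toℕ k ℕ.<? t) (allFin n)                     ≡⟨ count-toℕ< n t t≤n ⟩
  t                                                         ∎
  where
  open ≡-Reasoning
  n = length β
  permuted : map (lookupᵛ σ) (allFin n) ↭ allFin n
  permuted = unique-sets-↭ (Unique.map⁺ (inj _ _) (Unique.allFin⁺ n)) (Unique.allFin⁺ n)
    (λ {k} _ → ∈-allFin k)
    (λ {k} _ → subst (_∈ map (lookupᵛ σ) (allFin n)) (proj₂ (surj k)) (∈-map⁺ (lookupᵛ σ) (∈-allFin (proj₁ (surj k)))))

toℕ-punchIn-< : ∀ {n} (k : Fin (suc n)) x → toℕ x < toℕ k → toℕ (punchIn k x) ≡ toℕ x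
toℕ-punchIn-< (suc k) zero    _         = refl
toℕ-punchIn-< (suc k) (suc x) (s≤s x<k) = cong suc (toℕ-punchIn-< k x x<k)

toℕ-punchIn-≥ : ∀ {n} (k : Fin (suc n)) x → toℕ k ≤ toℕ x → toℕ (punchIn k x) ≡ suc (toℕ x)
toℕ-punchIn-≥ zero    x       _         = refl
toℕ-punchIn-≥ (suc k) (suc x) (s≤s k≤x) = cong suc (toℕ-punchIn-≥ k x k≤x)

punchIn<⁻ : ∀ {n} (k : Fin (suc n)) x → punchIn k x Fin.< k → toℕ x < toℕ k
punchIn<⁻ k x lt with toℕ x ℕ.<? toℕ k
... | yes x<k = x<k
... | no x≮k  = contradiction (subst (_< toℕ k) (toℕ-punchIn-≥ k x (ℕ.≮⇒≥ x≮k)) lt)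
                  (ℕ.≤⇒≯ (ℕ.m≤n⇒m≤1+n (ℕ.≮⇒≥ x≮k)))

<punchIn⁻ : ∀ {n} (k : Fin (suc n)) x → k Fin.< punchIn k x → toℕ k ≤ toℕ x
<punchIn⁻ k x lt with toℕ x ℕ.<? toℕ k
... | yes x<k = contradiction (subst (toℕ k <_) (toℕ-punchIn-< k x x<k) lt) (ℕ.<-asym x<k)
... | no x≮k  = ℕ.≮⇒≥ x≮k

module _ (b : ℕ⁺) (β : Composition) where

  private
    n = length β

    smaller? : ∀ j → Dec (lookup β j <⁺ b)
    smaller? j = lookup β j <⁺? b

    atMost? : ∀ j → Dec (lookup β j ≤⁺ b)
    atMost? j = lookup β j ≤⁺? b

    lo hi : ℕ
    lo = count smaller? (allFin n)
    hi = count atMost? (allFin n)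

  -- The labels, counted from 0, that the first brick `b` may carry: at least the number of smaller
  -- bricks in `β`, at most the number of bricks not larger than `b`.
  Admissible : Fin (suc n) → Set
  Admissible k = lo ≤ toℕ k × toℕ k ≤ hi

  admissible? : ∀ k → Dec (Admissible k)
  admissible? k = (lo ℕ.≤? toℕ k) ×-dec (toℕ k ℕ.≤? hi)

  -- Raises the labels from `k` on by one, which frees `k` for the first brick.
  insertLabel : Fin (suc n) → Labels β → Vec (Fin (suc n)) n
  insertLabel k = Vec.map (punchIn k)

  lookup-insertLabel : ∀ k σ j → lookupᵛ (insertLabel k σ) j ≡ punchIn k (lookupᵛ σ j)
  lookup-insertLabel k σ j = Vec.lookup-map j (punchIn k) σ

  insertLabel-injective : ∀ k {σ τ} → insertLabel k σ ≡ insertLabel k τ → σ ≡ τ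
  insertLabel-injective k {σ} {τ} e = trans (sym (Vec.tabulate∘lookup σ)) (trans (Vec.tabulate-cong same) (Vec.tabulate∘lookup τ))
    where
    same : ∀ j → lookupᵛ σ j ≡ lookupᵛ τ j
    same j = Fin.punchIn-injective k _ _ (trans (sym (lookup-insertLabel k σ j)) (trans (cong (λ v → lookupᵛ v j) e) (lookup-insertLabel k τ j)))

  module _ {k : Fin (suc n)} {σ : Labels β} (idx : IsIndexing β σ) where

    private
      order : ∀ i j → lookup β i <⁺ lookup β j → lookupᵛ σ i Fin.< lookupᵛ σ j
      order = proj₂ (proj₂ idx)

      below? : ∀ j → Dec (toℕ (lookupᵛ σ j) < toℕ k)
      below? j = toℕ (lookupᵛ σ j) ℕ.<? toℕ k

      #below : count below? (allFin n) ≡ toℕ k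
      #below = count-labels< β σ idx (toℕ k) (ℕ.≤-pred (Fin.toℕ<n k))

    -- Exactly `k` bricks of `β` have a label below `k`. They include the smaller bricks and exclude
    -- the larger ones, so their number lies between `lo` and `hi`.
    compatible⇒admissible : (∀ j → lookup β j <⁺ b → toℕ (lookupᵛ σ j) < toℕ k) →
                            (∀ j → b <⁺ lookup β j → toℕ k ≤ toℕ (lookupᵛ σ j)) → Admissible k
    compatible⇒admissible f g =
        subst (lo ≤_) #below (count-mono smaller? below? f (allFin n))
      , subst (_≤ hi) #below (count-mono below? atMost? (λ j lt → ℕ.≮⇒≥ (λ b<βj → ℕ.<⇒≱ lt (g j b<βj))) (allFin n))

    -- If a smaller brick `j` had a label at least `k`, all bricks labelled below `k` would be no
    -- larger than `j`, hence smaller than `b`; with `j` as an additional smaller brick, k < lo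
    -- follows. The next lemma is the mirror image.
    admissible⇒below : Admissible k → ∀ j → lookup β j <⁺ b → toℕ (lookupᵛ σ j) < toℕ k
    admissible⇒below (lo≤k , _) j βj<b = ℕ.≰⇒> λ k≤σj → ℕ.<⇒≱
      (subst (_< lo) #below (count-mono-< below? smaller?
        (λ i σi<k → ℕ.≤-<-trans (ℕ.≮⇒≥ (λ βj<βi → ℕ.<-asym (order j i βj<βi) (ℕ.<-≤-trans σi<k k≤σj))) βj<b)
        (∈-allFin j) βj<b (ℕ.≤⇒≯ k≤σj)))
      lo≤k

    admissible⇒above : Admissible k → ∀ j → b <⁺ lookup β j → toℕ k ≤ toℕ (lookupᵛ σ j)
    admissible⇒above (_ , k≤hi) j b<βj = ℕ.≮⇒≥ λ σj<k → ℕ.<⇒≱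
      (subst (hi <_) #below (count-mono-< atMost? below?
        (λ i βi≤b → ℕ.<-trans (order i j (ℕ.≤-<-trans βi≤b b<βj)) σj<k)
        (∈-allFin j) σj<k (ℕ.<⇒≱ b<βj)))
      k≤hi

    insert-isIndexing : Admissible k → IsIndexing (b ∷ β) (k ∷ᵛ insertLabel k σ)
    insert-isIndexing adm = inj′ , surj′ , order′
      where
      inj  = proj₁ idx
      surj = proj₁ (proj₂ idx)
      τ    = k ∷ᵛ insertLabel k σ
      inj′ : ∀ i j → lookupᵛ τ i ≡ lookupᵛ τ j → i ≡ j
      inj′ zero    zero    e = refl
      inj′ zero    (suc j) e = ⊥-elim (Fin.punchInᵢ≢i k (lookupᵛ σ j) (sym (trans e (lookup-insertLabel k σ j))))
      inj′ (suc i) zero    e = ⊥-elim (Fin.punchInᵢ≢i k (lookupᵛ σ i) (trans (sym (lookup-insertLabel k σ i)) e))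
      inj′ (suc i) (suc j) e = cong suc (inj i j (Fin.punchIn-injective k _ _
        (trans (sym (lookup-insertLabel k σ i)) (trans e (lookup-insertLabel k σ j)))))
      surj′ : ∀ l → ∃ λ i → lookupᵛ τ i ≡ l
      surj′ l with k Fin.≟ l
      ... | yes k≡l = zero , k≡l
      ... | no k≢l  = let (j , e) = surj (punchOut k≢l) in
        suc j , trans (lookup-insertLabel k σ j) (trans (cong (punchIn k) e) (Fin.punchIn-punchOut k≢l))
      order′ : ∀ i j → lookup (b ∷ β) i <⁺ lookup (b ∷ β) j → lookupᵛ τ i Fin.< lookupᵛ τ j
      order′ zero    zero    lt = contradiction lt (ℕ.<-irrefl refl)
      order′ zero    (suc j) lt = let k≤σj = admissible⇒above adm j lt in
        subst (toℕ k <_) (sym (trans (cong toℕ (lookup-insertLabel k σ j)) (toℕ-punchIn-≥ k _ k≤σj))) (s≤s k≤σj)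
      order′ (suc i) zero    lt = let σi<k = admissible⇒below adm i lt in
        subst (_< toℕ k) (sym (trans (cong toℕ (lookup-insertLabel k σ i)) (toℕ-punchIn-< k _ σi<k))) σi<k
      order′ (suc i) (suc j) lt rewrite lookup-insertLabel k σ i | lookup-insertLabel k σ j =
        ℕ.≰⇒> (λ ge → ℕ.<⇒≱ (order i j lt) (Fin.punchIn-cancel-≤ k _ _ ge))

  module _ {k : Fin (suc n)} {v : Vec (Fin (suc n)) n} (idx : IsIndexing (b ∷ β) (k ∷ᵛ v)) where

    private
      inj : ∀ i j → lookupᵛ (k ∷ᵛ v) i ≡ lookupᵛ (k ∷ᵛ v) j → i ≡ j
      inj = proj₁ idx

      order : ∀ i j → lookup (b ∷ β) i <⁺ lookup (b ∷ β) j → lookupᵛ (k ∷ᵛ v) i Fin.< lookupᵛ (k ∷ᵛ v) j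
      order = proj₂ (proj₂ idx)

      k≢ : ∀ j → k ≢ lookupᵛ v j
      k≢ j e with () ← inj zero (suc j) e

    removeLabel : Labels β
    removeLabel = Vec.tabulate (λ j → punchOut (k≢ j))

    punchIn-removeLabel : ∀ j → punchIn k (lookupᵛ removeLabel j) ≡ lookupᵛ v j
    punchIn-removeLabel j = trans (cong (punchIn k) (Vec.lookup∘tabulate _ j)) (Fin.punchIn-punchOut (k≢ j))

    insert-removeLabel : insertLabel k removeLabel ≡ v
    insert-removeLabel = trans (sym (Vec.tabulate∘lookup _)) (trans
      (Vec.tabulate-cong (λ j → trans (lookup-insertLabel k removeLabel j) (punchIn-removeLabel j))) (Vec.tabulate∘lookup v))

    removeLabel-isIndexing : IsIndexing β removeLabel
    removeLabel-isIndexing = inj′ , surj′ , order′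
      where
      inj′ : ∀ i j → lookupᵛ removeLabel i ≡ lookupᵛ removeLabel j → i ≡ j
      inj′ i j e = Fin.suc-injective (inj (suc i) (suc j)
        (trans (sym (punchIn-removeLabel i)) (trans (cong (punchIn k) e) (punchIn-removeLabel j))))
      surj′ : ∀ l → ∃ λ i → lookupᵛ removeLabel i ≡ l
      surj′ l with proj₁ (proj₂ idx) (punchIn k l)
      ... | zero  , e = contradiction (sym e) (Fin.punchInᵢ≢i k l)
      ... | suc j , e = j , Fin.punchIn-injective k _ _ (trans (punchIn-removeLabel j) e)
      order′ : ∀ i j → lookup β i <⁺ lookup β j → lookupᵛ removeLabel i Fin.< lookupᵛ removeLabel j
      order′ i j lt = ℕ.≰⇒> λ ge → ℕ.<⇒≱ (order (suc i) (suc j) lt)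
        (subst (λ x → toℕ x ≤ toℕ (lookupᵛ v i)) (punchIn-removeLabel j)
          (subst (λ y → punchIn k (lookupᵛ removeLabel j) Fin.≤ y) (punchIn-removeLabel i) (Fin.punchIn-mono-≤ k _ _ ge)))

    first-label-admissible : Admissible k
    first-label-admissible = compatible⇒admissible {σ = removeLabel} removeLabel-isIndexing
      (λ j lt → punchIn<⁻ k _ (subst (Fin._< k) (sym (punchIn-removeLabel j)) (order (suc j) zero lt)))
      (λ j lt → <punchIn⁻ k _ (subst (k Fin.<_) (sym (punchIn-removeLabel j)) (order zero (suc j) lt)))

  withFirst? : ∀ k (v : Vec (Fin (suc n)) n) → Dec (IsIndexing (b ∷ β) (k ∷ᵛ v))
  withFirst? k v = isIndexing? (b ∷ β) (k ∷ᵛ v)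

  -- For an admissible first label, inserting and removing it are mutually inverse, so the rest is
  -- an arbitrary indexing of `β`.
  count-admissible : ∀ k → Admissible k → count (withFirst? k) (allVectors (suc n) n) ≡ length (indexings β)
  count-admissible k adm = trans (↭-length permuted) (length-map (insertLabel k) (indexings β))
    where
    permuted : filter (withFirst? k) (allVectors (suc n) n) ↭ map (insertLabel k) (indexings β)
    permuted = unique-sets-↭
      (Unique.filter⁺ (withFirst? k) (allVectors-unique (suc n) n))
      (Unique.map⁺ (insertLabel-injective k) (indexings-unique β))
      (λ {v} v∈ → let idx = proj₂ (∈-filter⁻ (withFirst? k) {xs = allVectors (suc n) n} v∈) in
        subst (_∈ map (insertLabel k) (indexings β)) (insert-removeLabel idx)
          (∈-map⁺ (insertLabel k) (∈-filter⁺ (isIndexing? β) (∈-allVectors (removeLabel idx)) (removeLabel-isIndexing idx))))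
      (λ v∈ → let (σ , σ∈ , e) = ∈-map⁻ (insertLabel k) v∈ in
        subst (_∈ filter (withFirst? k) (allVectors (suc n) n)) (sym e)
          (∈-filter⁺ (withFirst? k) (∈-allVectors (insertLabel k σ))
            (insert-isIndexing {σ = σ} (proj₂ (∈-filter⁻ (isIndexing? β) {xs = allVectors n n} σ∈)) adm)))

  count-inadmissible : ∀ k → ¬ Admissible k → count (withFirst? k) (allVectors (suc n) n) ≡ 0
  count-inadmissible k ¬adm = count-none (withFirst? k) (allVectors (suc n) n) (λ _ idx → ¬adm (first-label-admissible idx))

  count-by-first : ∀ ks → length (filter (isIndexing? (b ∷ β)) (concatMap (λ k → map (k ∷ᵛ_) (allVectors (suc n) n)) ks))
                        ≡ count admissible? ks ℕ.* length (indexings β)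
  count-by-first []       = refl
  count-by-first (k ∷ ks) = begin
    length (filter P? (map (k ∷ᵛ_) A ++ rest))                    ≡⟨ cong length (filter-++ P? (map (k ∷ᵛ_) A) rest) ⟩
    length (filter P? (map (k ∷ᵛ_) A) ++ filter P? rest)          ≡⟨ length-++ (filter P? (map (k ∷ᵛ_) A)) ⟩
    count P? (map (k ∷ᵛ_) A) + count P? rest                      ≡⟨ cong₂ _+_ (count-map P? (k ∷ᵛ_) A) (count-by-first ks) ⟩
    count (withFirst? k) A + count admissible? ks ℕ.* N             ≡⟨ step (admissible? k) ⟩
    count admissible? (k ∷ ks) ℕ.* N                                ∎
    where
    open ≡-Reasoning
    P? = isIndexing? (b ∷ β)
    A = allVectors (suc n) n
    N = length (indexings β)
    rest = concatMap (λ k → map (k ∷ᵛ_) A) ks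
    step : Dec (Admissible k) → count (withFirst? k) A + count admissible? ks ℕ.* N ≡ count admissible? (k ∷ ks) ℕ.* N
    step (yes adm) = trans (cong (_+ count admissible? ks ℕ.* N) (count-admissible k adm))
      (cong (λ L → length L ℕ.* N) (sym (filter-accept admissible? {xs = ks} adm)))
    step (no ¬adm) = trans (cong (_+ count admissible? ks ℕ.* N) (count-inadmissible k ¬adm))
      (cong (λ L → length L ℕ.* N) (sym (filter-reject admissible? {xs = ks} ¬adm)))

  count-lookup : ∀ {P : ℕ⁺ → Set} (P? : Decidable P) → count (P? ∘ lookup β) (allFin n) ≡ count P? β
  count-lookup P? = trans (sym (count-map P? (lookup β) (allFin n)))
    (cong (count P?) (trans (map-tabulate (λ i → i) (lookup β)) (tabulate-lookup β)))

  hi≡lo+multiplicity : hi ≡ lo + multiplicity (value b) β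
  hi≡lo+multiplicity = trans
    (count-disjoint smaller? (λ j → value (lookup β j) ℕ.≟ value b) atMost?
      (λ j → ℕ.m≤n⇒m<n∨m≡n) (λ j → ℕ.<⇒≤) (λ j → ℕ.≤-reflexive) (λ j → ℕ.<⇒≢) (allFin n))
    (cong (lo +_) (count-lookup (λ a → value a ℕ.≟ value b)))

  hi≤n : hi ≤ n
  hi≤n = ℕ.≤-trans (count-mono atMost? (λ k → toℕ k ℕ.<? n) (λ k _ → Fin.toℕ<n k) (allFin n)) (ℕ.≤-reflexive (count-toℕ< n n ℕ.≤-refl))

  -- The admissible labels fill the interval from `lo` to `hi`, which fits into `Fin (suc n)` as
  -- `hi ≤ n`. Its hi - lo + 1 elements are one more than the parts of `β` equal to `b`.
  count-admissible-labels : count admissible? (allFin (suc n)) ≡ suc (multiplicity (value b) β)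
  count-admissible-labels = ℕ.+-cancelˡ-≡ lo _ _ (begin
    lo + count admissible? (allFin (suc n))
      ≡⟨ cong (_+ count admissible? (allFin (suc n))) (count-toℕ< (suc n) lo (ℕ.≤-trans lo≤hi (ℕ.m≤n⇒m≤1+n hi≤n))) ⟨
    count (λ k → toℕ k ℕ.<? lo) (allFin (suc n)) + count admissible? (allFin (suc n))
      ≡⟨ count-disjoint (λ k → toℕ k ℕ.<? lo) admissible? (λ k → toℕ k ℕ.<? suc hi)
           (λ k k≤hi → [ inj₁ , (λ lo≤k → inj₂ (lo≤k , ℕ.≤-pred k≤hi)) ]′ (ℕ.<-≤-connex (toℕ k) lo))
           (λ k k<lo → ℕ.m≤n⇒m≤1+n (ℕ.<-≤-trans k<lo lo≤hi)) (λ k adm → s≤s (proj₂ adm))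
           (λ k k<lo adm → ℕ.<⇒≱ k<lo (proj₁ adm)) (allFin (suc n)) ⟨
    count (λ k → toℕ k ℕ.<? suc hi) (allFin (suc n))
      ≡⟨ count-toℕ< (suc n) (suc hi) (s≤s hi≤n) ⟩
    suc hi
      ≡⟨ trans (cong suc hi≡lo+multiplicity) (sym (ℕ.+-suc lo _)) ⟩
    lo + suc (multiplicity (value b) β) ∎)
    where
    open ≡-Reasoning
    lo≤hi : lo ≤ hi
    lo≤hi = subst (lo ≤_) (sym hi≡lo+multiplicity) (ℕ.m≤m+n lo _)

  -- The recurrence of Π m_i!: a further part `b` raises m_b by one and multiplies m_b! by the new
  -- m_b.
  length-indexings-∷ : length (indexings (b ∷ β)) ≡ suc (multiplicity (value b) β) ℕ.* length (indexings β)
  length-indexings-∷ = trans (count-by-first (allFin (suc n))) (cong (ℕ._* length (indexings β)) count-admissible-labels)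

-- Factoring z into the number of indexings and the product of the parts.

productTo : (ℕ → ℕ) → ℕ → ℕ
productTo f n = product (map f (applyUpTo suc n))

productTo-suc : ∀ f n → productTo f (suc n) ≡ productTo f n ℕ.* f (suc n)
productTo-suc f n = begin
  product (map f (applyUpTo suc (suc n)))            ≡⟨ cong (product ∘ map f) (applyUpTo-∷ʳ suc n) ⟨
  product (map f (applyUpTo suc n ∷ʳ suc n))         ≡⟨ cong product (map-++ f (applyUpTo suc n) [ suc n ]) ⟩
  product (map f (applyUpTo suc n) ++ [ f (suc n) ]) ≡⟨ product-++ (map f (applyUpTo suc n)) [ f (suc n) ] ⟩
  productTo f n ℕ.* (f (suc n) ℕ.* 1)                    ≡⟨ cong (productTo f n ℕ.*_) (ℕ.*-identityʳ (f (suc n))) ⟩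
  productTo f n ℕ.* f (suc n)                          ∎
  where open ≡-Reasoning

productTo-extend : ∀ f n → (∀ i → n < i → f i ≡ 1) → ∀ k → productTo f (k + n) ≡ productTo f n
productTo-extend f n e zero    = refl
productTo-extend f n e (suc k) = trans (productTo-suc f (k + n))
  (trans (cong₂ ℕ._*_ (productTo-extend f n e k) (e (suc (k + n)) (s≤s (ℕ.m≤n+m n k)))) (ℕ.*-identityʳ _))

module _ {f g : ℕ → ℕ} {b c : ℕ} (away : ∀ i → i ≢ b → f i ≡ g i) (at-b : f b ≡ c ℕ.* g b) where

  productTo-below : ∀ n → n < b → productTo f n ≡ productTo g n
  productTo-below zero    _   = refl
  productTo-below (suc n) n<b = trans (productTo-suc f n) (trans
    (cong₂ ℕ._*_ (productTo-below n (ℕ.<-trans (ℕ.n<1+n n) n<b)) (away (suc n) (ℕ.<⇒≢ n<b))) (sym (productTo-suc g n)))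

  productTo-scale : ∀ n → 0 < b → b ≤ n → productTo f n ≡ c ℕ.* productTo g n
  productTo-scale zero    0<b b≤0 = contradiction 0<b (ℕ.≤⇒≯ b≤0)
  productTo-scale (suc n) 0<b b≤n with b ℕ.≟ suc n
  ... | yes refl = begin
      productTo f (suc n)                ≡⟨ productTo-suc f n ⟩
      productTo f n ℕ.* f (suc n)          ≡⟨ cong₂ ℕ._*_ (productTo-below n ℕ.≤-refl) at-b ⟩
      productTo g n ℕ.* (c ℕ.* g (suc n))    ≡⟨ solve 3 (λ x c y → x :* (c :* y) := c :* (x :* y)) refl (productTo g n) c (g (suc n)) ⟩
      c ℕ.* (productTo g n ℕ.* g (suc n))    ≡⟨ cong (c ℕ.*_) (productTo-suc g n) ⟨
      c ℕ.* productTo g (suc n)            ∎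
    where
    open ≡-Reasoning
    open ℕ.+-*-Solver
  ... | no b≢1+n = begin
      productTo f (suc n)                ≡⟨ productTo-suc f n ⟩
      productTo f n ℕ.* f (suc n)          ≡⟨ cong₂ ℕ._*_ (productTo-scale n 0<b (ℕ.≤-pred (ℕ.≤∧≢⇒< b≤n b≢1+n))) (away (suc n) (b≢1+n ∘ sym)) ⟩
      c ℕ.* productTo g n ℕ.* g (suc n)      ≡⟨ ℕ.*-assoc c (productTo g n) (g (suc n)) ⟩
      c ℕ.* (productTo g n ℕ.* g (suc n))    ≡⟨ cong (c ℕ.*_) (productTo-suc g n) ⟨
      c ℕ.* productTo g (suc n)            ∎
    where open ≡-Reasoning

part≤size : ∀ β {a} → a ∈ β → value a ≤ size β
part≤size (b ∷ β) (here refl) = ℕ.m≤m+n (value b) (size β)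
part≤size (b ∷ β) (there a∈)  = ℕ.≤-trans (part≤size β a∈) (ℕ.m≤n+m (size β) (value b))

-- Only the factor at i = b changes. The range of the product also grows, from |β| to b + |β|, but
-- the new indices exceed every part of `β` and give factors 1.
z-∷ : ∀ b β → z (b ∷ β) ≡ value b ℕ.* suc (multiplicity (value b) β) ℕ.* z β
z-∷ b β = trans (productTo-scale {factor (b ∷ β)} {factor β} {c = value b ℕ.* suc (multiplicity (value b) β)} away at-b (size (b ∷ β)) (s≤s z≤n) (ℕ.m≤m+n (value b) (size β)))
  (cong (value b ℕ.* suc (multiplicity (value b) β) ℕ.*_) (productTo-extend (factor β) (size β) beyond (value b)))
  where
  factor : Composition → ℕ → ℕ
  factor β i = i ^ multiplicity i β ℕ.* multiplicity i β !
  beyond : ∀ i → size β < i → factor β i ≡ 1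
  beyond i lt = cong (λ m → i ^ m ℕ.* m !) (count-none (λ a → value a ℕ.≟ i) β (λ a∈ e → ℕ.<⇒≱ lt (subst (_≤ size β) e (part≤size β a∈))))
  away : ∀ i → i ≢ value b → factor (b ∷ β) i ≡ factor β i
  away i i≢b = cong (λ L → i ^ length L ℕ.* length L !) (filter-reject (λ a → value a ℕ.≟ i) {xs = β} (i≢b ∘ sym))
  at-b : factor (b ∷ β) (value b) ≡ value b ℕ.* suc (multiplicity (value b) β) ℕ.* factor β (value b)
  at-b = trans (cong (λ L → value b ^ length L ℕ.* length L !) (filter-accept (λ a → value a ℕ.≟ value b) {xs = β} refl))
    (solve 4 (λ b s p f → b :* p :* (s :* f) := b :* s :* (p :* f)) refl (value b) (suc m) (value b ^ m) (m !))
    where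
    open ℕ.+-*-Solver
    m = multiplicity (value b) β

length-indexings : ∀ β → length (indexings β) ℕ.* parts-product β ≡ z β
length-indexings []      = refl
length-indexings (b ∷ β) = begin
  length (indexings (b ∷ β)) ℕ.* (value b ℕ.* parts-product β)  ≡⟨ cong (ℕ._* (value b ℕ.* parts-product β)) (length-indexings-∷ b β) ⟩
  suc m ℕ.* length (indexings β) ℕ.* (value b ℕ.* parts-product β)
    ≡⟨ solve 4 (λ s l b p → s :* l :* (b :* p) := b :* s :* (l :* p)) refl (suc m) (length (indexings β)) (value b) (parts-product β) ⟩
  value b ℕ.* suc m ℕ.* (length (indexings β) ℕ.* parts-product β) ≡⟨ cong (value b ℕ.* suc m ℕ.*_) (length-indexings β) ⟩
  value b ℕ.* suc m ℕ.* z β                                      ≡⟨ z-∷ b β ⟨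
  z (b ∷ β)                                                  ∎
  where
  open ≡-Reasoning
  open ℕ.+-*-Solver
  m = multiplicity (value b) β

length-indexings-nonZero : ∀ β → NonZero (length (indexings β))
length-indexings-nonZero []      = _
length-indexings-nonZero (b ∷ β) = subst NonZero (sym (length-indexings-∷ b β))
  (ℕ.m*n≢0 (suc (multiplicity (value b) β)) (length (indexings β)) {{_}} {{length-indexings-nonZero β}})

-- 𝐡 and 𝐞 as sums over indexed walls.

x∙[yz∙[wv]]≡xw∙[z∙yv] : ∀ x y z w v → x ℚ.* ((y ℚ.* z) ℚ.* (w ℚ.* v)) ≡ (x ℚ.* w) ℚ.* (z ℚ.* (y ℚ.* v))
x∙[yz∙[wv]]≡xw∙[z∙yv] = solve 5 (λ x y z w v → x :* ((y :* z) :* (w :* v)) := (x :* w) :* (z :* (y :* v))) refl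
  where open ℚ.+-*-Solver

wallParity : Bool → Wall → ℚ
wallParity s W = parity s (size (sh W) ∸ length (type W))

wallCoefficient : Bool → Wall → ℚ
wallCoefficient s W = wallParity s W ℚ.* recip (fb W)

z-nonZero : ∀ β → NonZero (z β)
z-nonZero β = subst NonZero (length-indexings β)
  (ℕ.m*n≢0 (length (indexings β)) (parts-product β) {{length-indexings-nonZero β}} {{parts-product-nonZero β}})

recip-z-cancel : ∀ x β → x ℚ.* recip (z β) ℚ.* (ℤ.+ z β ℚ./ 1) ≡ x
recip-z-cancel x β = begin
  x ℚ.* recip (z β) ℚ.* (ℤ.+ z β ℚ./ 1) ≡⟨ cong (x ℚ.* recip (z β) ℚ.*_) (nat-def (z β)) ⟨
  x ℚ.* recip (z β) ℚ.* nat (z β)       ≡⟨ ℚ.*-assoc x (recip (z β)) (nat (z β)) ⟩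
  x ℚ.* (recip (z β) ℚ.* nat (z β))     ≡⟨ cong (x ℚ.*_) (trans (ℚ.*-comm (recip (z β)) (nat (z β))) (nat-recip (z β) {{z-nonZero β}})) ⟩
  x ℚ.* 1ℚ                              ≡⟨ ℚ.*-identityʳ x ⟩
  x                                     ∎
  where open ≡-Reasoning

labelled-coefficient : ∀ s W →
  nat (length (indexings (type W))) ℚ.* (wallCoefficient s W ℚ.* recip (z (type W))) ≡ recip (fb W) ℚ.* weights s (type W)
labelled-coefficient s W = begin
  nat l ℚ.* (wallParity s W ℚ.* recip (fb W) ℚ.* recip (z β))
    ≡⟨ cong (λ r → nat l ℚ.* (wallParity s W ℚ.* recip (fb W) ℚ.* r)) (trans (cong recip (sym (length-indexings β))) (recip-* l (parts-product β))) ⟩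
  nat l ℚ.* (wallParity s W ℚ.* recip (fb W) ℚ.* (recip l ℚ.* recip (parts-product β)))
    ≡⟨ x∙[yz∙[wv]]≡xw∙[z∙yv] (nat l) (wallParity s W) (recip (fb W)) (recip l) (recip (parts-product β)) ⟩
  (nat l ℚ.* recip l) ℚ.* (recip (fb W) ℚ.* (wallParity s W ℚ.* recip (parts-product β)))
    ≡⟨ trans (cong (ℚ._* (recip (fb W) ℚ.* (wallParity s W ℚ.* recip (parts-product β)))) (nat-recip l)) (ℚ.*-identityˡ _) ⟩
  recip (fb W) ℚ.* (wallParity s W ℚ.* recip (parts-product β))
    ≡⟨ cong (λ n → recip (fb W) ℚ.* (parity s (n ∸ length β) ℚ.* recip (parts-product β))) (size-sh W) ⟩
  recip (fb W) ℚ.* (parity s (size β ∸ length β) ℚ.* recip (parts-product β))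
    ≡⟨ cong (recip (fb W) ℚ.*_) (weights-parity s β) ⟨
  recip (fb W) ℚ.* weights s β ∎
  where
  open ≡-Reasoning
  β = type W
  l = length (indexings β)
  instance
    _ = length-indexings-nonZero β
    _ = parts-product-nonZero β

module WallExpansion {c ℓ : Level} {{K : ℚ-Algebra c ℓ}} where

  open Sums {{K}}
  open Log {{K}}
  open Words {{K}}
  open ShapeSum {{K}}

  S-const : ∀ {A : Set} (as : List A) k → S as (λ _ → k) ≈ N (length as) *ᴷ k
  S-const []       k = ≈-sym (≈-trans (*-congʳ N-0) (zeroˡ k))
  S-const (_ ∷ as) k = ≈-sym (≈-trans (*-congʳ (N-suc (length as)))
    (≈-trans (distribʳ k _ _) (+-cong (*-identityˡ k) (≈-sym (S-const as k)))))

  -- The summand ignores the labels, so each wall counts with the number of its indexings.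
  IW-sh-sum : ∀ α (f : Wall → Carrier) →
              S (IW-sh α) (f ∘ wall) ≈ S (wallsOfShape α) (λ W → N (length (indexings (type W))) *ᴷ f W)
  IW-sh-sum α f = begin
    S (IW-sh α) (f ∘ wall)
      ≈⟨ S-filter (λ W → sh (wall W) ≟ᶜ α) (indexedWalls (size α)) (f ∘ wall) ⟩
    S (indexedWalls (size α)) (λ W → 𝟙 (sh (wall W) ≟ᶜ α) *ᴷ f (wall W))
      ≈⟨ S-concatMap (λ W → map (λ σ → W , σ) (indexings (type W))) (allWalls (size α)) _ ⟩
    S (allWalls (size α)) (λ W → S (map (λ σ → W , σ) (indexings (type W))) (λ W → 𝟙 (sh (wall W) ≟ᶜ α) *ᴷ f (wall W)))
      ≈⟨ S-cong (allWalls (size α)) (λ W → ≈-trans (S-map (λ σ → W , σ) (indexings (type W)) (λ W → 𝟙 (sh (wall W) ≟ᶜ α) *ᴷ f (wall W)))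
           (≈-trans (S-const (indexings (type W)) (𝟙 (sh W ≟ᶜ α) *ᴷ f W))
             (solve 3 (λ x y z → x :* (y :* z) := y :* (x :* z)) ≈-refl (N (length (indexings (type W)))) (𝟙 (sh W ≟ᶜ α)) (f W)))) ⟩
    S (allWalls (size α)) (λ W → 𝟙 (sh W ≟ᶜ α) *ᴷ (N (length (indexings (type W))) *ᴷ f W))
      ≈⟨ S-filter (λ W → sh W ≟ᶜ α) (allWalls (size α)) _ ⟨
    S (filter (λ W → sh W ≟ᶜ α) (allWalls (size α))) (λ W → N (length (indexings (type W))) *ᴷ f W)
      ≈⟨ S-↭ _ (filter-sh-↭ α) ⟩
    S (wallsOfShape α) (λ W → N (length (indexings (type W))) *ᴷ f W) ∎
    where open Solver

  𝐠-expansion : ∀ s α w → 𝐠 s α w ≈ S (IW-sh α) (λ W → ι (wallCoefficient s (wall W) ℚ.* recip (z (type (wall W)))) *ᴷ 𝛟 (type (wall W)) w)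
  𝐠-expansion s α w = ≈-sym (begin
    S (IW-sh α) (λ W → ι (wallCoefficient s (wall W) ℚ.* recip (z (type (wall W)))) *ᴷ 𝛟 (type (wall W)) w)
      ≈⟨ IW-sh-sum α (λ W → ι (wallCoefficient s W ℚ.* recip (z (type W))) *ᴷ 𝛟 (type W) w) ⟩
    S (wallsOfShape α) (λ W → N (length (indexings (type W))) *ᴷ (ι (wallCoefficient s W ℚ.* recip (z (type W))) *ᴷ 𝛟 (type W) w))
      ≈⟨ S-cong (wallsOfShape α) collect ⟩
    S (wallsOfShape α) (λ W → ι (recip (fb W)) *ᴷ weighted-𝛟 s (type W) w)
      ≈⟨ shape-sum s α w ⟩
    𝐠 s α w ∎)
    where
    collect : ∀ W → N (length (indexings (type W))) *ᴷ (ι (wallCoefficient s W ℚ.* recip (z (type W))) *ᴷ 𝛟 (type W) w)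
                  ≈ ι (recip (fb W)) *ᴷ weighted-𝛟 s (type W) w
    collect W = begin
      N l *ᴷ (ι q *ᴷ 𝛟 β w)                             ≈⟨ *-assoc _ _ _ ⟨
      (N l *ᴷ ι q) *ᴷ 𝛟 β w                             ≈⟨ *-congʳ (ι-* (nat l) q) ⟨
      ι (nat l ℚ.* q) *ᴷ 𝛟 β w                          ≈⟨ *-congʳ (≈-trans (≈-reflexive (cong ι (labelled-coefficient s W))) (ι-* _ _)) ⟩
      (ι (recip (fb W)) *ᴷ ι (weights s β)) *ᴷ 𝛟 β w    ≈⟨ *-assoc _ _ _ ⟩
      ι (recip (fb W)) *ᴷ (ι (weights s β) *ᴷ 𝛟 β w)    ≈⟨ *-congˡ (weighted-𝛟-weights s β w) ⟨
      ι (recip (fb W)) *ᴷ weighted-𝛟 s β w              ∎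
      where
      β = type W
      l = length (indexings β)
      q = wallCoefficient s W ℚ.* recip (z β)

-- Ribbon coefficients of 𝐡 and 𝐞, and monomial coefficients of F.

_⊑_ : Pattern → Pattern → Set
q ⊑ p = ∀ k → k ∈ ones q → k ∈ ones p

⊑-tail : ∀ x y q p → (x ∷ q) ⊑ (y ∷ p) → q ⊑ p
⊑-tail x y q p sub zero    k∈ = contradiction (ones-positive q k∈) λ ()
⊑-tail x y q p sub (suc k) k∈ = suc∈ones⁻ y p (sub (suc (suc k)) (suc∈ones x q k∈))

⊑-true : ∀ x q p → q ⊑ p → (x ∷ q) ⊑ (true ∷ p)
⊑-true x q p sub zero          k∈ = contradiction (ones-positive (x ∷ q) k∈) λ ()
⊑-true x q p sub (suc zero)    k∈ = here refl
⊑-true x q p sub (suc (suc k)) k∈ = suc∈ones true p (sub (suc k) (suc∈ones⁻ x q k∈))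

⊑-false : ∀ q p → q ⊑ p → (false ∷ q) ⊑ (false ∷ p)
⊑-false q p sub zero          k∈ = contradiction (ones-positive (false ∷ q) k∈) λ ()
⊑-false q p sub (suc zero)    k∈ = ⊥-elim (1∉map-suc-ones q k∈)
⊑-false q p sub (suc (suc k)) k∈ = suc∈ones false p (sub (suc k) (suc∈ones⁻ false q k∈))

flip : Bool → Pattern → Pattern
flip false p = p
flip true  p = map not p

module QuasiSym {c ℓ : Level} {{K : ℚ-Algebra c ℓ}} where

  open Sums {{K}}
  open Log {{K}}
  open Words {{K}}
  open WallExpansion {{K}}

  -- The indicator of q ⊑ p for patterns of equal length.
  sup : Pattern → Pattern → Carrier
  sup []      []          = 1#
  sup (x ∷ q) (true ∷ p)  = sup q p
  sup (x ∷ q) (false ∷ p) = 𝟙 (x Bool.≟ false) *ᴷ sup q p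
  sup []      (_ ∷ _)     = 0#
  sup (_ ∷ _) []          = 0#

  sup-yes : ∀ q p → length p ≡ length q → q ⊑ p → sup q p ≈ 1#
  sup-yes []          []          _ _   = ≈-refl
  sup-yes (x ∷ q)     (true ∷ p)  e sub = sup-yes q p (ℕ.suc-injective e) (⊑-tail x true q p sub)
  sup-yes (false ∷ q) (false ∷ p) e sub = ≈-trans (*-identityˡ _) (sup-yes q p (ℕ.suc-injective e) (⊑-tail false false q p sub))
  sup-yes (true ∷ q)  (false ∷ p) e sub = ⊥-elim (1∉map-suc-ones p (sub 1 (here refl)))

  sup-no : ∀ q p → ¬ (length p ≡ length q × q ⊑ p) → sup q p ≈ 0#
  sup-no []          []          ¬d = contradiction (refl , λ _ ()) ¬d
  sup-no (x ∷ q)     (true ∷ p)  ¬d = sup-no q p (λ (e , sub) → ¬d (cong suc e , ⊑-true x q p sub))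
  sup-no (false ∷ q) (false ∷ p) ¬d = ≈-trans (*-identityˡ _) (sup-no q p (λ (e , sub) → ¬d (cong suc e , ⊑-false q p sub)))
  sup-no (true ∷ q)  (false ∷ p) ¬d = zeroˡ _
  sup-no []          (_ ∷ _)     ¬d = ≈-refl
  sup-no (_ ∷ _)     []          ¬d = ≈-refl

  cutProduct-scale : ∀ c k c₀ p q → cutProduct c (λ r → k *ᴷ c₀ r) p q ≈ k *ᴷ cutProduct c c₀ p q
  cutProduct-scale c k c₀ []      []          = ≈-refl
  cutProduct-scale c k c₀ (x ∷ p) (true ∷ q)  = *-assoc _ _ _
  cutProduct-scale c k c₀ (x ∷ p) (false ∷ q) = cutProduct-scale c k (c₀ ∘ (x ∷_)) p q
  cutProduct-scale c k c₀ []      (_ ∷ _)     = ≈-sym (zeroʳ k)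
  cutProduct-scale c k c₀ (_ ∷ _) []          = ≈-sym (zeroʳ k)

  -- All pieces are constantly `s` exactly if every letter different from `s` is swallowed by a cut.
  -- For `false` this says that the letters `true` of `p` lie in `q`; for `true` the roles of the
  -- letters are exchanged.
  cutProduct-constantly : ∀ s p q → cutProduct (constantly s) (constantly s) p q ≈ sup (flip s p) q
  cutProduct-constantly false []      []          = ≈-refl
  cutProduct-constantly true  []      []          = ≈-refl
  cutProduct-constantly false (x ∷ p) (true ∷ q)  = ≈-trans (*-identityˡ _) (cutProduct-constantly false p q)
  cutProduct-constantly true  (x ∷ p) (true ∷ q)  = ≈-trans (*-identityˡ _) (cutProduct-constantly true p q)
  cutProduct-constantly false (x ∷ p) (false ∷ q) = ≈-trans (cutProduct-scale (constantly false) (𝟙 (x Bool.≟ false)) (constantly false) p q) (*-congˡ (cutProduct-constantly false p q))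
  cutProduct-constantly true  (x ∷ p) (false ∷ q) = ≈-trans (cutProduct-scale (constantly true) (𝟙 (x Bool.≟ true)) (constantly true) p q)
    (*-cong (𝟙-cong (x Bool.≟ true) (not x Bool.≟ false) (λ { refl → refl }) (λ e → trans (sym (Bool.not-involutive x)) (cong not e))) (cutProduct-constantly true p q))
  cutProduct-constantly false []      (_ ∷ _)     = ≈-refl
  cutProduct-constantly true  []      (_ ∷ _)     = ≈-refl
  cutProduct-constantly false (_ ∷ _) []          = ≈-refl
  cutProduct-constantly true  (_ ∷ _) []          = ≈-refl

  -- Carries a function on patterns over to compositions; the empty composition has no pattern and
  -- pairs with itself only.
  extend : (Pattern → Pattern → Carrier) → Composition → Composition → Carrier
  extend f []            []            = 1#
  extend f ((1+ k) ∷ α)  ((1+ j) ∷ β)  = f (pattern-of k α) (pattern-of j β)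
  extend f []            (_ ∷ _)       = 0#
  extend f (_ ∷ _)       []            = 0#

  extend-comp : ∀ f p q → extend f (comp p) (comp q) ≈ f p q
  extend-comp f p q = ≈-reflexive (cong₂ f (pattern-comp p) (pattern-comp q))

  -- The coefficient of 𝐫 γ in 𝐠 s β.
  κ : Bool → Composition → Composition → Carrier
  κ s β γ = extend (cutProduct (constantly s) (constantly s)) γ β

  κ-size : ∀ s β γ → size γ ≢ size β → κ s β γ ≈ 0#
  κ-size s β γ ne with view β | view γ
  ... | empty      | empty      = contradiction refl ne
  ... | empty      | nonempty _ = ≈-refl
  ... | nonempty _ | empty      = ≈-refl
  ... | nonempty q | nonempty p = ≈-trans (extend-comp (cutProduct (constantly s) (constantly s)) p q)
    (cutProduct-length _ _ p q (λ e → ne (trans (size-comp p) (trans (cong suc e) (sym (size-comp q))))))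

  -- The coefficient of a word in 𝐠_β depends on its descent composition only and is the value of
  -- `κ` there; a wrong length gives 0 on both sides.
  𝐠-ribbons : ∀ s β → 𝐠 s β ≋ ∑ (compositions (size β)) (λ γ → κ s β γ • 𝐫 γ)
  𝐠-ribbons s β w = ≈-trans (go β w) (≈-sym (ribbon-sum (size β) (κ s β) w))
    where
    go : ∀ β w → 𝐠 s β w ≈ 𝟙 (length w ℕ.≟ size β) *ᴷ κ s β (descentComposition w)
    go []           []      = ≈-sym (*-identityˡ _)
    go []           (i ∷ u) = ≈-sym (zeroˡ _)
    go ((1+ k) ∷ β) []      = ≈-trans (multiplicatively-[] {c = constantly s} (𝐠₁-local s) (1+ k) β) (≈-sym (zeroˡ _))
    go ((1+ k) ∷ β) (i ∷ u) = begin
      𝐠 s (1+ k ∷ β) (i ∷ u)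
        ≈⟨ multiplicatively-cutProduct (𝐠₁-local s) k β i u ⟩
      cutProduct (constantly s) (constantly s) (descentPattern i u) (pattern-of k β)
        ≈⟨ ≈-reflexive (cong (λ p → cutProduct (constantly s) (constantly s) p (pattern-of k β)) (pattern-comp (descentPattern i u))) ⟨
      κ s (1+ k ∷ β) (descentComposition (i ∷ u))
        ≈⟨ guard (length (i ∷ u) ℕ.≟ size (1+ k ∷ β)) ⟩
      𝟙 (length (i ∷ u) ℕ.≟ size (1+ k ∷ β)) *ᴷ κ s (1+ k ∷ β) (descentComposition (i ∷ u)) ∎
      where
      guard : (l? : Dec (length (i ∷ u) ≡ size (1+ k ∷ β))) →
              κ s (1+ k ∷ β) (descentComposition (i ∷ u)) ≈ 𝟙 l? *ᴷ κ s (1+ k ∷ β) (descentComposition (i ∷ u))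
      guard (yes _) = ≈-sym (*-identityˡ _)
      guard (no ne) = ≈-trans (κ-size s (1+ k ∷ β) (descentComposition (i ∷ u)) (λ e → ne (trans (sym (size-descentComposition (i ∷ u))) e))) (≈-sym (zeroˡ _))

  -- The expansion of F_α into the M_β with set(β) ⊇ set(α), read off at the monomial `a`.
  F-sup : ∀ α a → F α a ≈ extend sup α (nonzero a)
  F-sup α a = ≈-trans (≈-reflexive (cong₂ (λ d ks → 𝟙 ((d ℕ.≟ size α) ×-dec all? (λ k → mem? ℕ._≟_ k ks) (set α))) (degree-nonzero a) (ascents-sortedWord a)))
    (go (nonzero a))
    where
    go : ∀ β → 𝟙 ((size β ℕ.≟ size α) ×-dec all? (λ k → mem? ℕ._≟_ k (set β)) (set α)) ≈ extend sup α β
    go β with view α | view β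
    ... | empty      | empty      = ≈-refl
    ... | empty      | nonempty p = 𝟙-no ((size (comp p) ℕ.≟ 0) ×-dec all? (λ k → mem? ℕ._≟_ k (set (comp p))) []) (λ { (() , _) })
    ... | nonempty q | empty      = 𝟙-no ((0 ℕ.≟ size (comp q)) ×-dec all? (λ k → mem? ℕ._≟_ k []) (set (comp q))) (λ { (() , _) })
    ... | nonempty q | nonempty p = ≈-trans (by ((size (comp p) ℕ.≟ size (comp q)) ×-dec all? (λ k → mem? ℕ._≟_ k (set (comp p))) (set (comp q)))) (≈-sym (extend-comp sup q p))
      where
      by : (D : Dec (size (comp p) ≡ size (comp q) × All (_∈ set (comp p)) (set (comp q)))) → 𝟙 D ≈ sup q p
      by (yes (e , sub)) = ≈-sym (sup-yes q p (ℕ.suc-injective (trans (sym (size-comp p)) (trans e (size-comp q))))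
        (λ _ k∈ → subst (_ ∈_) (set-comp p) (All.lookup sub (subst (_ ∈_) (sym (set-comp q)) k∈))))
      by (no ¬d) = ≈-sym (sup-no q p (λ (e , sub) → ¬d (trans (size-comp p) (trans (cong suc e) (sym (size-comp q)))
        , All.tabulate (λ k∈ → subst (_ ∈_) (sym (set-comp p)) (sub _ (subst (_ ∈_) (set-comp q) k∈))))))

  κ-false : ∀ α β → κ false β α ≈ extend sup α β
  κ-false []      []      = ≈-refl
  κ-false []      (_ ∷ _) = ≈-refl
  κ-false (_ ∷ _) []      = ≈-refl
  κ-false ((1+ k) ∷ α) ((1+ j) ∷ β) = cutProduct-constantly false (pattern-of k α) (pattern-of j β)

  -- Compare `κ-false`: 𝐫_α has in 𝐡_β the coefficient of M_β in F_α, and in 𝐞_β the coefficient of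
  -- M_β in F of the complement of α. Thus exchanging 𝐡 and 𝐞 corresponds to `ψ`.
  κ-true : ∀ α β → κ true β α ≈ extend sup (α ᶜ) β
  κ-true α β with view α | view β
  ... | empty      | empty      = ≈-refl
  ... | empty      | nonempty _ = ≈-refl
  ... | nonempty p | empty      = ≈-sym (≈-reflexive (cong (λ γ → extend sup γ []) (complement-comp p)))
  ... | nonempty p | nonempty q = begin
    κ true (comp q) (comp p)              ≈⟨ extend-comp (cutProduct (constantly true) (constantly true)) p q ⟩
    cutProduct (constantly true) (constantly true) p q ≈⟨ cutProduct-constantly true p q ⟩
    sup (map not p) q                     ≈⟨ extend-comp sup (map not p) q ⟨
    extend sup (comp (map not p)) (comp q) ≈⟨ ≈-reflexive (cong (λ γ → extend sup γ (comp q)) (complement-comp p)) ⟨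
    extend sup (comp p ᶜ) (comp q)        ∎

  -- The F_α span QSym.

  data Span (n : ℕ) : (Pattern → Carrier) → Set (c ⊔ ℓ) where
    generator : ∀ q → length q ≡ n → Span n (sup q)
    plus      : ∀ {v w} → Span n v → Span n w → Span n (λ p → v p +ᴷ w p)
    scale     : ∀ k {v} → Span n v → Span n (λ p → k *ᴷ v p)
    resp      : ∀ {v w} → (∀ p → v p ≈ w p) → Span n v → Span n w

  prefix : Bool → (Pattern → Carrier) → Pattern → Carrier
  prefix b v []      = 0#
  prefix b v (x ∷ p) = 𝟙 (x Bool.≟ b) *ᴷ v p

  -- Möbius inversion from F to M, one letter at a time: prefixing `sup q` with `true` gives
  -- `sup (true ∷ q)`, and prefixing it with `false` gives `sup (false ∷ q)` minus `sup (true ∷ q)`.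
  -- Iterated, this puts the indicator `δ u` of a single pattern into the span.
  prefix-span : ∀ b {n v} → Span n v → Span (suc n) (prefix b v)
  prefix-span true (generator q e) = resp same (generator (true ∷ q) (cong suc e))
    where
    same : ∀ p → sup (true ∷ q) p ≈ prefix true (sup q) p
    same []          = ≈-refl
    same (true ∷ p)  = ≈-sym (*-identityˡ _)
    same (false ∷ p) = ≈-refl
  prefix-span false (generator q e) =
    resp same (plus (generator (false ∷ q) (cong suc e)) (scale (-ᴷ 1#) (generator (true ∷ q) (cong suc e))))
    where
    same : ∀ p → sup (false ∷ q) p +ᴷ (-ᴷ 1#) *ᴷ sup (true ∷ q) p ≈ prefix false (sup q) p
    same []          = ≈-trans (+-identityˡ _) (zeroʳ _)
    same (true ∷ p)  = begin
      sup q p +ᴷ (-ᴷ 1#) *ᴷ sup q p            ≈⟨ +-congʳ (*-identityˡ _) ⟨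
      1# *ᴷ sup q p +ᴷ (-ᴷ 1#) *ᴷ sup q p      ≈⟨ distribʳ _ _ _ ⟨
      (1# +ᴷ (-ᴷ 1#)) *ᴷ sup q p               ≈⟨ *-congʳ (-‿inverseʳ 1#) ⟩
      0# *ᴷ sup q p                            ∎
    same (false ∷ p) = ≈-trans (+-congˡ (≈-trans (*-congˡ (zeroˡ _)) (zeroʳ _))) (+-identityʳ _)
  prefix-span b (plus {v} {w} s t) = resp same (plus (prefix-span b s) (prefix-span b t))
    where
    same : ∀ p → prefix b v p +ᴷ prefix b w p ≈ prefix b (λ p → v p +ᴷ w p) p
    same []      = +-identityˡ _
    same (x ∷ p) = ≈-sym (distribˡ _ _ _)
  prefix-span b (scale k {v} s) = resp same (scale k (prefix-span b s))
    where
    same : ∀ p → k *ᴷ prefix b v p ≈ prefix b (λ p → k *ᴷ v p) p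
    same []      = zeroʳ _
    same (x ∷ p) = solve 3 (λ k x y → k :* (x :* y) := x :* (k :* y)) ≈-refl k (𝟙 (x Bool.≟ b)) (v p)
      where open Solver
  prefix-span b (resp {v} {w} e s) = resp same (prefix-span b s)
    where
    same : ∀ p → prefix b v p ≈ prefix b w p
    same []      = ≈-refl
    same (x ∷ p) = *-congˡ (e p)

  δ : Pattern → Pattern → Carrier
  δ []      = sup []
  δ (b ∷ u) = prefix b (δ u)

  δ-span : ∀ u → Span (length u) (δ u)
  δ-span []      = generator [] refl
  δ-span (b ∷ u) = prefix-span b (δ-span u)

  δ-yes : ∀ u → δ u u ≈ 1#
  δ-yes []      = ≈-refl
  δ-yes (b ∷ u) = ≈-trans (*-cong (𝟙-yes (b Bool.≟ b) refl) (δ-yes u)) (*-identityˡ _)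

  δ-no : ∀ u p → p ≢ u → δ u p ≈ 0#
  δ-no []      []      ne = contradiction refl ne
  δ-no []      (_ ∷ _) ne = ≈-refl
  δ-no (b ∷ u) []      ne = ≈-refl
  δ-no (b ∷ u) (x ∷ p) ne with x Bool.≟ b
  ... | yes refl = ≈-trans (*-identityˡ _) (δ-no u p (ne ∘ cong (b ∷_)))
  ... | no _     = zeroˡ _

  onPatterns : (Pattern → Carrier) → Composition → Carrier
  onPatterns v []            = 0#
  onPatterns v ((1+ k) ∷ β)  = v (pattern-of k β)

  onPatterns-comp : ∀ v p → onPatterns v (comp p) ≈ v p
  onPatterns-comp v p = ≈-reflexive (cong v (pattern-comp p))

  -- The explicit degree factor bounds the series for every `v`, whatever values `v` takes on
  -- patterns of other lengths.
  homogeneous : ℕ → (Pattern → Carrier) → QSym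
  homogeneous n v = record
    { series         = λ a → 𝟙 (degree a ℕ.≟ suc n) *ᴷ onPatterns v (nonzero a)
    ; bound          = suc n
    ; bounded        = λ a lt → ≈-trans (*-congʳ (𝟙-no (degree a ℕ.≟ suc n) (λ e → ℕ.<-irrefl (sym e) lt))) (zeroˡ _)
    ; quasisymmetric = λ a b e → ≈-reflexive (cong₂ (λ d β → 𝟙 (d ℕ.≟ suc n) *ᴷ onPatterns v β)
        (trans (degree-nonzero a) (trans (cong size e) (sym (degree-nonzero b)))) e)
    }

  -- The empty sum is 0 times F of the empty composition, so a property of all F that is closed
  -- under scaling covers it.
  sumᵠ : ∀ {A : Set} → List A → (A → QSym) → QSym
  sumᵠ as f = foldr (λ a s → f a +ᵠ s) (0# ·ᵠ Fᵠ []) as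

  series-sumᵠ : ∀ {A : Set} (as : List A) (f : A → QSym) x → QSym.series (sumᵠ as f) x ≈ S as (λ a → QSym.series (f a) x)
  series-sumᵠ []       f x = zeroˡ _
  series-sumᵠ (a ∷ as) f x = +-congˡ (series-sumᵠ as f x)

  nonzero-value : ∀ β → nonzero (map value β) ≡ β
  nonzero-value []      = refl
  nonzero-value (b ∷ β) = cong (b ∷_) (nonzero-value β)

  -- Induction over QSym from the F_α. It is applied to predicates saying that two linear operations
  -- agree at `f`.
  module Spanning {r} (Q : QSym → Set r)
    (Q-resp : ∀ {f g} → f ≈ᵠ g → Q f → Q g)
    (Q-plus : ∀ {f g} → Q f → Q g → Q (f +ᵠ g))
    (Q-scale : ∀ k {f} → Q f → Q (k ·ᵠ f))
    (Q-F : ∀ α → Q (Fᵠ α)) where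

    Q-sum : ∀ {A : Set} (as : List A) {f : A → QSym} → (∀ a → Q (f a)) → Q (sumᵠ as f)
    Q-sum []       q = Q-scale 0# (Q-F [])
    Q-sum (a ∷ as) q = Q-plus (q a) (Q-sum as q)

    Q-homogeneous : ∀ {n v} → Span n v → Q (homogeneous n v)
    Q-homogeneous {n} (generator q refl) = Q-resp same (Q-F (comp q))
      where
      same : Fᵠ (comp q) ≈ᵠ homogeneous n (sup q)
      same a = ≈-trans (F-sup (comp q) a) (≈-trans (by-view (nonzero a)) (*-congʳ (≈-reflexive (cong (λ d → 𝟙 (d ℕ.≟ suc n)) (sym (degree-nonzero a))))))
        where
        by-view : ∀ β → extend sup (comp q) β ≈ 𝟙 (size β ℕ.≟ suc n) *ᴷ onPatterns (sup q) β
        by-view β with view β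
        ... | empty      = ≈-sym (zeroʳ _)
        ... | nonempty p = begin
          extend sup (comp q) (comp p)                                  ≈⟨ extend-comp sup q p ⟩
          sup q p                                                       ≈⟨ guard (size (comp p) ℕ.≟ suc n) ⟩
          𝟙 (size (comp p) ℕ.≟ suc n) *ᴷ sup q p                        ≈⟨ *-congˡ (onPatterns-comp (sup q) p) ⟨
          𝟙 (size (comp p) ℕ.≟ suc n) *ᴷ onPatterns (sup q) (comp p)    ∎
          where
          guard : (l? : Dec (size (comp p) ≡ suc n)) → sup q p ≈ 𝟙 l? *ᴷ sup q p
          guard (yes _) = ≈-sym (*-identityˡ _)
          guard (no ne) = ≈-trans (sup-no q p (λ (e , _) → ne (trans (size-comp p) (cong suc e)))) (≈-sym (zeroˡ _))
    Q-homogeneous (plus {v} {w} s t) = Q-resp same (Q-plus (Q-homogeneous s) (Q-homogeneous t))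
      where
      same : ∀ a → _ ≈ _
      same a = ≈-trans (≈-sym (distribˡ (𝟙 (degree a ℕ.≟ _)) _ _)) (*-congˡ (combine (nonzero a)))
        where
        combine : ∀ β → onPatterns v β +ᴷ onPatterns w β ≈ onPatterns (λ p → v p +ᴷ w p) β
        combine []      = +-identityˡ _
        combine (_ ∷ _) = ≈-refl
    Q-homogeneous {n} (scale k {v} s) = Q-resp same (Q-scale k (Q-homogeneous s))
      where
      open Solver
      same : ∀ a → k *ᴷ (𝟙 (degree a ℕ.≟ suc n) *ᴷ onPatterns v (nonzero a)) ≈ 𝟙 (degree a ℕ.≟ suc n) *ᴷ onPatterns (λ p → k *ᴷ v p) (nonzero a)
      same a = ≈-trans (solve 3 (λ k x y → k :* (x :* y) := x :* (k :* y)) ≈-refl k (𝟙 (degree a ℕ.≟ suc n)) (onPatterns v (nonzero a))) (*-congˡ (combine (nonzero a)))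
        where
        combine : ∀ β → k *ᴷ onPatterns v β ≈ onPatterns (λ p → k *ᴷ v p) β
        combine []      = zeroʳ _
        combine (_ ∷ _) = ≈-refl
    Q-homogeneous {n} (resp {v} {w} e s) = Q-resp same (Q-homogeneous s)
      where
      same : ∀ a → 𝟙 (degree a ℕ.≟ suc n) *ᴷ onPatterns v (nonzero a) ≈ 𝟙 (degree a ℕ.≟ suc n) *ᴷ onPatterns w (nonzero a)
      same a = *-congˡ (combine (nonzero a))
        where
        combine : ∀ β → onPatterns v β ≈ onPatterns w β
        combine []           = ≈-refl
        combine ((1+ k) ∷ β) = e (pattern-of k β)

    Q-M : ∀ α → Q (Mᵠ α)
    Q-M α with view α
    ... | empty = Q-resp (λ a → ≈-trans (F-sup [] a) (by (nonzero a))) (Q-F [])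
      where
      by : ∀ β → extend sup [] β ≈ 𝟙 (β ≟ᶜ [])
      by []      = ≈-refl
      by (_ ∷ _) = ≈-refl
    ... | nonempty u = Q-resp same (Q-homogeneous (δ-span u))
      where
      same : homogeneous (length u) (δ u) ≈ᵠ Mᵠ (comp u)
      same a = ≈-trans (*-congʳ (≈-reflexive (cong (λ d → 𝟙 (d ℕ.≟ suc (length u))) (degree-nonzero a)))) (by-view (nonzero a))
        where
        by-view : ∀ β → 𝟙 (size β ℕ.≟ suc (length u)) *ᴷ onPatterns (δ u) β ≈ 𝟙 (β ≟ᶜ comp u)
        by-view β with view β
        ... | empty      = zeroʳ _
        ... | nonempty p = ≈-trans (*-congˡ (onPatterns-comp (δ u) p)) (by (comp p ≟ᶜ comp u))
          where
          by : (D : Dec (comp p ≡ comp u)) → 𝟙 (size (comp p) ℕ.≟ suc (length u)) *ᴷ δ u p ≈ 𝟙 D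
          by (yes e) with refl ← comp-injective {p} {u} e =
            ≈-trans (*-cong (𝟙-yes (size (comp p) ℕ.≟ suc (length p)) (size-comp p)) (δ-yes p)) (*-identityˡ _)
          by (no ne) = ≈-trans (*-congˡ (δ-no u p (ne ∘ cong comp))) (zeroʳ _)

    -- Every `f` is the sum of f_β M_β over the finitely many β with |β| at most the bound, where
    -- f_β is its coefficient at the monomial with exponents β_1, β_2, ... on the first variables;
    -- quasisymmetry carries this value to all monomials with the same nonzero exponents.
    spanning : ∀ f → Q f
    spanning f = Q-resp expansion (Q-sum support (λ β → Q-scale (f.series (map value β)) (Q-M β)))
      where
      module f = QSym f
      support : List Composition
      support = concatMap compositions (upTo (suc f.bound))
      support-unique : Unique support
      support-unique = concatMap-unique compositions size compositions-size compositions-unique (Unique.upTo⁺ (suc f.bound))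
      expansion : sumᵠ support (λ β → f.series (map value β) ·ᵠ Mᵠ β) ≈ᵠ f
      expansion a = ≈-trans (series-sumᵠ support (λ β → f.series (map value β) ·ᵠ Mᵠ β) a) (by (degree a ℕ.≤? f.bound))
        where
        by : Dec (degree a ≤ f.bound) → S support (λ β → f.series (map value β) *ᴷ 𝟙 (nonzero a ≟ᶜ β)) ≈ f.series a
        by (yes le) = ≈-trans
          (S-delta _≟ᶜ_ support-unique (∈-concatMap-intro compositions (∈-upTo⁺ (s≤s (subst (_≤ f.bound) (degree-nonzero a) le))) (∈-compositions (nonzero a))) (f.series ∘ map value))
          (f.quasisymmetric (map value (nonzero a)) a (nonzero-value (nonzero a)))
        by (no gt) = ≈-trans
          (S-zero∈ support (λ {β} β∈ → ≈-trans (*-congˡ (𝟙-no (nonzero a ≟ᶜ β) (outside β∈))) (zeroʳ _)))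
          (≈-sym (f.bounded a (ℕ.≰⇒> gt)))
          where
          outside : ∀ {β} → β ∈ support → nonzero a ≢ β
          outside β∈ refl with n , n∈ , β∈n ← ∈-concatMap-elim compositions {upTo (suc f.bound)} β∈ =
            gt (subst (_≤ f.bound) (sym (trans (degree-nonzero a) (compositions-size n β∈n))) (ℕ.≤-pred (∈-upTo⁻ n∈)))

  -- Duality and the expansions of φ.

  zeroᴺ : NSym
  zeroᴺ = mkNSym 𝟎 zero

  sumᴺ : ∀ {A : Set} → List A → (A → NSym) → NSym
  sumᴺ as f = foldr (λ a s → f a +ᴺ s) zeroᴺ as

  series-sumᴺ : ∀ {A : Set} (as : List A) (f : A → NSym) x → NSym.series (sumᴺ as f) x ≈ S as (λ a → NSym.series (f a) x)
  series-sumᴺ []       f x = ≈-refl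
  series-sumᴺ (a ∷ as) f x = +-congˡ (series-sumᴺ as f x)

  ribbonExpansion wallExpansion : Bool → Composition → NSym
  ribbonExpansion s β = sumᴺ (compositions (size β)) (λ γ → κ s β γ ·ᴺ 𝐫ᴺ γ)
  wallExpansion s β = sumᴺ (IW-sh β) (λ W → ι (wallCoefficient s (wall W) ℚ.* recip (z (type (wall W)))) ·ᴺ 𝛟ᴺ (type (wall W)))

  -- Both are 𝐠_β. The left form can be paired with the F_α, the right form with the φ_α.
  ribbon≈wall : ∀ s β → ribbonExpansion s β ≈ᴺ wallExpansion s β
  ribbon≈wall s β w = begin
    NSym.series (ribbonExpansion s β) w                        ≈⟨ series-sumᴺ (compositions (size β)) (λ γ → κ s β γ ·ᴺ 𝐫ᴺ γ) w ⟩
    S (compositions (size β)) (λ γ → κ s β γ *ᴷ 𝐫 γ w)         ≈⟨ ∑-S (compositions (size β)) (λ γ → κ s β γ • 𝐫 γ) w ⟨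
    ∑ (compositions (size β)) (λ γ → κ s β γ • 𝐫 γ) w          ≈⟨ 𝐠-ribbons s β w ⟨
    𝐠 s β w                                                    ≈⟨ 𝐠-expansion s β w ⟩
    S (IW-sh β) (λ W → ι (wallCoefficient s (wall W) ℚ.* recip (z (type (wall W)))) *ᴷ 𝛟 (type (wall W)) w)
      ≈⟨ series-sumᴺ (IW-sh β) (λ W → ι (wallCoefficient s (wall W) ℚ.* recip (z (type (wall W)))) ·ᴺ 𝛟ᴺ (type (wall W))) w ⟨
    NSym.series (wallExpansion s β) w                          ∎

  module Duality (P : Pairing) where

    open Pairing P

    ⟨⟩-sumʳ : ∀ {A : Set} (f : QSym) (as : List A) (k : A → Carrier) (g : A → NSym) → ⟨ f , sumᴺ as (λ a → k a ·ᴺ g a) ⟩ ≈ S as (λ a → k a *ᴷ ⟨ f , g a ⟩)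
    ⟨⟩-sumʳ f []       k g = begin
      -- That pairing with zero gives 0 follows from homogeneity, once zero is written as 0 times a
      -- ribbon.
      ⟨ f , zeroᴺ ⟩              ≈⟨ ⟨⟩-cong (λ _ → ≈-refl) (λ w → ≈-sym (zeroˡ (𝐫 [] w))) ⟩
      ⟨ f , 0# ·ᴺ 𝐫ᴺ [] ⟩        ≈⟨ ⟨⟩-·ʳ 0# f (𝐫ᴺ []) ⟩
      0# *ᴷ ⟨ f , 𝐫ᴺ [] ⟩        ≈⟨ zeroˡ _ ⟩
      0#                         ∎
    ⟨⟩-sumʳ f (a ∷ as) k g = ≈-trans (⟨⟩-+ʳ f (k a ·ᴺ g a) _) (+-cong (⟨⟩-·ʳ (k a) f (g a)) (⟨⟩-sumʳ f as k g))

    ⟨F,ribbonExpansion⟩ : ∀ α s β → ⟨ Fᵠ α , ribbonExpansion s β ⟩ ≈ κ s β α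
    ⟨F,ribbonExpansion⟩ α s β = begin
      ⟨ Fᵠ α , ribbonExpansion s β ⟩                                       ≈⟨ ⟨⟩-sumʳ (Fᵠ α) (compositions (size β)) (κ s β) 𝐫ᴺ ⟩
      S (compositions (size β)) (λ γ → κ s β γ *ᴷ ⟨ Fᵠ α , 𝐫ᴺ γ ⟩)         ≈⟨ S-cong (compositions (size β)) (λ γ → *-congˡ (⟨F,𝐫⟩ α γ)) ⟩
      S (compositions (size β)) (λ γ → κ s β γ *ᴷ 𝟙 (α ≟ᶜ γ))              ≈⟨ by (size α ℕ.≟ size β) ⟩
      κ s β α                                                              ∎
      where
      by : Dec (size α ≡ size β) → S (compositions (size β)) (λ γ → κ s β γ *ᴷ 𝟙 (α ≟ᶜ γ)) ≈ κ s β α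
      by (yes e) = S-delta _≟ᶜ_ (compositions-unique (size β)) (subst (λ n → α ∈ compositions n) e (∈-compositions α)) (κ s β)
      by (no ne) = ≈-trans
        (S-zero∈ (compositions (size β)) (λ {γ} γ∈ → ≈-trans (*-congˡ (𝟙-no (α ≟ᶜ γ) (λ { refl → ne (compositions-size (size β) γ∈) }))) (zeroʳ _)))
        (≈-sym (κ-size s β α ne))

    -- M_β is dual to 𝐡_β.
    series-pairing : ∀ f a → QSym.series f a ≈ ⟨ f , ribbonExpansion false (nonzero a) ⟩
    series-pairing = Spanning.spanning (λ f → ∀ a → QSym.series f a ≈ ⟨ f , ribbonExpansion false (nonzero a) ⟩)
      (λ e q a → ≈-trans (≈-sym (e a)) (≈-trans (q a) (⟨⟩-cong e (λ _ → ≈-refl))))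
      (λ {f} {g} q r a → ≈-trans (+-cong (q a) (r a)) (≈-sym (⟨⟩-+ˡ f g _)))
      (λ k {f} q a → ≈-trans (*-congˡ (q a)) (≈-sym (⟨⟩-·ˡ k f _)))
      (λ α a → ≈-trans (F-sup α a) (≈-trans (≈-sym (κ-false α (nonzero a))) (≈-sym (⟨F,ribbonExpansion⟩ α false (nonzero a)))))

    module _ (B : DualBasis P) where

      open DualBasis B

      -- The coefficient of M_β in the claimed sum; for β = `nonzero a` the indicator is
      -- `M (sh (wall W)) a` by definition.
      φ-sum : Bool → Composition → Composition → Carrier
      φ-sum s α β = S (IW-type α) (λ W → ι (wallCoefficient s (wall W)) *ᴷ 𝟙 (β ≟ᶜ sh (wall W)))

      -- Pairing with φ_α keeps, among the walls of shape `β`, those of type `α`, and z_α cancels.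
      -- If |α| = |β|, both sides filter the same list of walls; otherwise both vanish, as shape and
      -- type of a wall have equal size.
      ⟨φ,ribbonExpansion⟩ : ∀ s α β → ⟨ φᵠ α , ribbonExpansion s β ⟩ ≈ φ-sum s α β
      ⟨φ,ribbonExpansion⟩ s α β = begin
        ⟨ φᵠ α , ribbonExpansion s β ⟩
          ≈⟨ ⟨⟩-cong (λ _ → ≈-refl) (ribbon≈wall s β) ⟩
        ⟨ φᵠ α , wallExpansion s β ⟩
          ≈⟨ ⟨⟩-sumʳ (φᵠ α) (IW-sh β) _ (λ W → 𝛟ᴺ (type (wall W))) ⟩
        S (IW-sh β) (λ W → ι (q (wall W)) *ᴷ ⟨ φᵠ α , 𝛟ᴺ (type (wall W)) ⟩)
          ≈⟨ S-cong (IW-sh β) (λ W → *-congˡ (⟨φ,𝛟⟩ α (type (wall W)))) ⟩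
        S (IW-sh β) (λ W → ι (q (wall W)) *ᴷ (ι (ℤ.+ z α ℚ./ 1) *ᴷ 𝟙 (α ≟ᶜ type (wall W))))
          ≈⟨ S-filter (λ W → sh (wall W) ≟ᶜ β) (indexedWalls (size β)) _ ⟩
        S (indexedWalls (size β)) (λ W → left (wall W))
          ≈⟨ by (size β ℕ.≟ size α) ⟩
        S (indexedWalls (size α)) (λ W → right (wall W))
          ≈⟨ S-filter (λ W → type (wall W) ≟ᶜ α) (indexedWalls (size α)) _ ⟨
        φ-sum s α β ∎
        where
        q : Wall → ℚ
        q W = wallCoefficient s W ℚ.* recip (z (type W))
        left right : Wall → Carrier
        left  W = 𝟙 (sh W ≟ᶜ β) *ᴷ (ι (q W) *ᴷ (ι (ℤ.+ z α ℚ./ 1) *ᴷ 𝟙 (α ≟ᶜ type W)))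
        right W = 𝟙 (type W ≟ᶜ α) *ᴷ (ι (wallCoefficient s W) *ᴷ 𝟙 (β ≟ᶜ sh W))

        cancel-z : ∀ W → type W ≡ α → ι (q W) *ᴷ ι (ℤ.+ z α ℚ./ 1) ≈ ι (wallCoefficient s W)
        cancel-z W refl = ≈-trans (≈-sym (ι-* (q W) _)) (≈-reflexive (cong ι (recip-z-cancel (wallCoefficient s W) (type W))))

        left≈right : ∀ W → left W ≈ right W
        left≈right W = begin
          𝟙 (sh W ≟ᶜ β) *ᴷ (ι (q W) *ᴷ (ι (ℤ.+ z α ℚ./ 1) *ᴷ 𝟙 (α ≟ᶜ type W)))
            ≈⟨ *-cong (𝟙-cong (sh W ≟ᶜ β) (β ≟ᶜ sh W) sym sym)
                      (*-congˡ (*-congˡ (𝟙-cong (α ≟ᶜ type W) (type W ≟ᶜ α) sym sym))) ⟩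
          𝟙 (β ≟ᶜ sh W) *ᴷ (ι (q W) *ᴷ (ι (ℤ.+ z α ℚ./ 1) *ᴷ 𝟙 (type W ≟ᶜ α)))
            ≈⟨ solve 4 (λ x y z t → x :* (y :* (z :* t)) := t :* ((y :* z) :* x)) ≈-refl
                 (𝟙 (β ≟ᶜ sh W)) (ι (q W)) (ι (ℤ.+ z α ℚ./ 1)) (𝟙 (type W ≟ᶜ α)) ⟩
          𝟙 (type W ≟ᶜ α) *ᴷ ((ι (q W) *ᴷ ι (ℤ.+ z α ℚ./ 1)) *ᴷ 𝟙 (β ≟ᶜ sh W))
            ≈⟨ 𝟙-guard (type W ≟ᶜ α) (λ e → *-congʳ (cancel-z W e)) ⟩
          𝟙 (type W ≟ᶜ α) *ᴷ (ι (wallCoefficient s W) *ᴷ 𝟙 (β ≟ᶜ sh W)) ∎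
          where open Solver

        right-zero : size β ≢ size α → ∀ W → right W ≈ 0#
        right-zero ne W = ≈-trans
          (𝟙-guard (type W ≟ᶜ α) (λ { refl → ≈-trans (*-congˡ (𝟙-no (β ≟ᶜ sh W) (λ { refl → ne (size-sh W) }))) (zeroʳ _) }))
          (zeroʳ _)

        by : Dec (size β ≡ size α) → S (indexedWalls (size β)) (left ∘ wall) ≈ S (indexedWalls (size α)) (right ∘ wall)
        by (yes e) = ≈-trans (S-cong (indexedWalls (size β)) (left≈right ∘ wall))
          (≈-reflexive (cong (λ n → S (indexedWalls n) (right ∘ wall)) e))
        by (no ne) = ≈-trans
          (S-zero (indexedWalls (size β)) (λ W → ≈-trans (left≈right (wall W)) (right-zero ne (wall W))))
          (≈-sym (S-zero (indexedWalls (size α)) (right-zero ne ∘ wall)))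

      φ-M : ∀ α a → φ α a ≈ S (IW-type α) (λ W → ι (wallCoefficient false (wall W)) *ᴷ M (sh (wall W)) a)
      φ-M α a = ≈-trans (series-pairing (φᵠ α) a) (⟨φ,ribbonExpansion⟩ false α (nonzero a))

      module _ (Ψ : Psi) where

        open Psi Ψ

        -- Both sides are linear in `f`, and on F_α the claim is `κ-true`.
        ψ-pairing : ∀ f a → QSym.series (ψ f) a ≈ ⟨ f , ribbonExpansion true (nonzero a) ⟩
        ψ-pairing = Spanning.spanning (λ f → ∀ a → QSym.series (ψ f) a ≈ ⟨ f , ribbonExpansion true (nonzero a) ⟩)
          (λ e q a → ≈-trans (≈-sym (ψ-cong e a)) (≈-trans (q a) (⟨⟩-cong e (λ _ → ≈-refl))))
          (λ {f} {g} q r a → ≈-trans (ψ-+ f g a) (≈-trans (+-cong (q a) (r a)) (≈-sym (⟨⟩-+ˡ f g _))))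
          (λ k {f} q a → ≈-trans (ψ-· k f a) (≈-trans (*-congˡ (q a)) (≈-sym (⟨⟩-·ˡ k f _))))
          (λ α a → ≈-trans (ψ-F α a) (≈-trans (F-sup (α ᶜ) a)
            (≈-trans (≈-sym (κ-true α (nonzero a))) (≈-sym (⟨F,ribbonExpansion⟩ α true (nonzero a))))))

        ψ-involutive : ∀ f → ψ (ψ f) ≈ᵠ f
        ψ-involutive = Spanning.spanning (λ f → ψ (ψ f) ≈ᵠ f)
          (λ e q a → ≈-trans (≈-sym (ψ-cong (ψ-cong e) a)) (≈-trans (q a) (e a)))
          (λ {f} {g} q r a → ≈-trans (ψ-cong (ψ-+ f g) a) (≈-trans (ψ-+ (ψ f) (ψ g) a) (+-cong (q a) (r a))))
          (λ k {f} q a → ≈-trans (ψ-cong (ψ-· k f) a) (≈-trans (ψ-· k (ψ f) a) (*-congˡ (q a))))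
          (λ α a → ≈-trans (ψ-cong (ψ-F α) a) (≈-trans (ψ-F (α ᶜ) a)
            (≈-reflexive (cong (λ γ → F γ a) (complement-involutive α)))))

        ψ-sum : ∀ {A : Set} (as : List A) (k : A → Carrier) (f : A → QSym) a →
                QSym.series (ψ (sumᵠ as (λ x → k x ·ᵠ f x))) a ≈ S as (λ x → k x *ᴷ QSym.series (ψ (f x)) a)
        ψ-sum []       k f a = ≈-trans (ψ-· 0# (Fᵠ []) a) (zeroˡ _)
        ψ-sum (x ∷ as) k f a = ≈-trans (ψ-+ (k x ·ᵠ f x) _ a) (+-cong (ψ-· (k x) (f x) a) (ψ-sum as k f a))

        φ-For : ∀ α a → φ α a ≈ S (IW-type α) (λ W → ι (wallCoefficient true (wall W)) *ᴷ For (sh (wall W)) a)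
        φ-For α a = begin
          φ α a                            ≈⟨ ψ-involutive (φᵠ α) a ⟨
          -- The inner `ψ` is expanded in the M_β by pairing with 𝐞_β; the outer one then turns each
          -- M into For.
          QSym.series (ψ (ψ (φᵠ α))) a     ≈⟨ ψ-cong {ψ (φᵠ α)} {sumᵠ (IW-type α) term} ψφ a ⟩
          QSym.series (ψ (sumᵠ (IW-type α) term)) a
            ≈⟨ ψ-sum (IW-type α) (λ W → ι (wallCoefficient true (wall W))) (λ W → Mᵠ (sh (wall W))) a ⟩
          S (IW-type α) (λ W → ι (wallCoefficient true (wall W)) *ᴷ For (sh (wall W)) a) ∎
          where
          term : LabelledWall → QSym
          term W = ι (wallCoefficient true (wall W)) ·ᵠ Mᵠ (sh (wall W))
          ψφ : ψ (φᵠ α) ≈ᵠ sumᵠ (IW-type α) term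
          ψφ b = ≈-trans (ψ-pairing (φᵠ α) b)
            (≈-trans (⟨φ,ribbonExpansion⟩ true α (nonzero b)) (≈-sym (series-sumᵠ (IW-type α) term b)))

-- Translation into the form of the theorem.

wallCoefficient-false : ∀ W → wallCoefficient false W ≡ 1/ fb W
wallCoefficient-false W = trans (ℚ.*-identityˡ (recip (fb W))) (recip-def (fb W))

module _ {c ℓ : Level} {{K : ℚ-Algebra c ℓ}} where

  open Sums {{K}}
  open WallExpansion {{K}}
  open QuasiSym {{K}}

  wallCoefficient-true : ∀ (W : LabelledWall) → wallCoefficient true (wall W) ≡ wallSign W * 1/ fb (wall W)
  wallCoefficient-true W = cong (wallSign W *_) (recip-def (fb (wall W)))

  -- Passes from sums of coefficients to sums of series, and from the abstract `recip` to `1/_`.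
  series-from-sum : ∀ {A X : Set} (as : List A) (p q : A → ℚ.ℚ) (f : A → Series X) {h : Series X} → (∀ a → p a ≡ q a) →
                    (∀ x → h x ≈ S as (λ a → ι (p a) *ᴷ f a x)) → h ≋ ∑ as (λ a → ι (q a) • f a)
  series-from-sum as p q f e hx x = ≈-trans (hx x) (≈-trans (S-cong as (λ a → *-congʳ (≈-reflexive (cong ι (e a))))) (≈-sym (∑-S as _ x)))

mainTheorem20 : ∀ {c ℓ : Level} {{K : ℚ-Algebra c ℓ}} (α : Composition) →
    (𝐡 α ≋ ∑ (IW-sh α) (λ W →
    ι (1/ fb (wall W) * 1/ z (type (wall W))) • 𝛟 (type (wall W))))
    × (𝐞 α ≋ ∑ (IW-sh α) (λ W →
    ι (wallSign W * 1/ fb (wall W) * 1/ z (type (wall W))) • 𝛟 (type (wall W))))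
    × (∀ (P : Pairing) (B : DualBasis P) →
    DualBasis.φ B α ≋ ∑ (IW-type α) (λ W →
    ι (1/ fb (wall W)) • M (sh (wall W))))
    × (∀ (P : Pairing) (B : DualBasis P) (Ψ : Psi) →
    DualBasis.φ B α ≋ ∑ (IW-type α) (λ W →
    ι (wallSign W * 1/ fb (wall W)) • Psi.For Ψ (sh (wall W))))
mainTheorem20 {{K}} α =
    series-from-sum (IW-sh α) _ (λ W → 1/ fb (wall W) * 1/ z (type (wall W))) (λ W → 𝛟 (type (wall W)))
      (λ W → cong₂ _*_ (wallCoefficient-false (wall W)) (recip-def (z (type (wall W))))) (𝐠-expansion false α)
  , series-from-sum (IW-sh α) _ (λ W → wallSign W * 1/ fb (wall W) * 1/ z (type (wall W))) (λ W → 𝛟 (type (wall W)))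
      (λ W → cong₂ _*_ (wallCoefficient-true W) (recip-def (z (type (wall W))))) (𝐠-expansion true α)
  , (λ P B → series-from-sum (IW-type α) _ (λ W → 1/ fb (wall W)) (λ W → M (sh (wall W)))
      (wallCoefficient-false ∘ wall) (Duality.φ-M P B α))
  , (λ P B Ψ → series-from-sum (IW-type α) _ (λ W → wallSign W * 1/ fb (wall W)) (λ W → Psi.For Ψ (sh (wall W)))
      wallCoefficient-true (Duality.φ-For P B Ψ α))
  where
  open WallExpansion {{K}}
  open QuasiSym {{K}}
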